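{- Let $2 \le \ell < k$ be integers and let $\mathcal{F}$ be a family of $k$-graphs. Then $\pi_{\ell}(\mathcal{F}) \ge \pi(\mathcal{L}_{\ell-1}(\mathcal{F}))$.
   Context: For a positive integer $r$, an $r$-graph $H$ is a pair $(V(H),E(H))$ where $V(H)$ is a finite set and $E(H)$ is a set of $r$-subsets of $V(H)$. For $0\le j<r$ and a $j$-subset $T$ of $V(H)$, $\deg^H(T)$ is the number of $(r-j)$-subsets $S$ of $V(H)$ with $S\cup T\in E(H)$, and $\delta_j(H)=\min\{\deg^H(T): T\subseteq V(H), |T|=j\}$ (so $\delta_0(H)=|E(H)|$). For a family $\mathcal{G}$ of $r$-graphs, an $r$-graph is $\mathcal{G}$-free if it contains no copy of any member of $\mathcal{G}$. Let $\mathrm{ex}_j(n,\mathcal{G})$ be the maximum of $\delta_j(H)$ over all $\mathcal{G}$-free $r$-graphs $H$ on $n$ vertices, and let $\pi_j(\mathcal{G})=\limsup_{n\to\infty}\mathrm{ex}_j(n,\mathcal{G})/\binom{n}{r-j}$. The ordinary Turán density is $\pi(\mathcal{G})=\pi_0(\mathcal{G})$. For a $k$-graph $F$ and a $j$-subset $T$ of $V(F)$, the link-graph $N^F(T)$ is the set of $(k-j)$-subsets $S$ of $V(F)$ with $S\cup T\in E(F)$, viewed as a $(k-j)$-graph (on the vertex set $V(F)\setminus T$). The $j$-link family $\mathcal{L}_j(F)$ is the family of all $N^F(T)$ over all $j$-subsets $T$ of $V(F)$, and $\mathcal{L}_j(\mathcal{F})=\bigcup_{F\in\mathcal{F}}\mathcal{L}_j(F)$.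 -}

module Defs where

open import Data.Bool.Base using (Bool; T)
open import Data.Bool.Properties using (T?)
open import Data.Fin.Base using (Fin)
open import Data.Fin.Properties using (any?) renaming (_≟_ to _≟ᶠ_)
open import Data.Fin.Subset using (Subset; inside; outside; ∣_∣; ∁; _∪_)
open import Data.Fin.Subset.Properties using (_∈?_)
open import Data.Integer.Base using (+_)
open import Data.List.Base using (List; []; _∷_; _++_; map; filter; length)
open import Data.List.Extrema.Nat using (min)
open import Data.Nat.Base using (ℕ; zero; suc; _+_; _∸_; _≤_)
open import Data.Nat.Combinatorics using (_C_)
open import Data.Nat.Properties using (_≟_; +-suc; m+n∸n≡m)
open import Data.Product.Base using (Σ; ∃; _×_)
open import Data.Rational.Base using (ℚ; _/_; _<_; _*_)
open import Data.Vec.Base using ([]; _∷_; tabulate)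
open import Function.Definitions using (Injective)
open import Level using (Level) renaming (suc to lsuc)
open import Relation.Binary.PropositionalEquality
  using (_≡_; refl; sym; trans; cong; cong₂)
open import Relation.Nullary using (¬_; does)
open import Relation.Nullary.Decidable using (_×-dec_)

private
  variable
    a : Level
    m n r j : ℕ

------------------------------------------------------------------------
-- r-graphs

-- Up to relabelling, the vertex set is Fin n.
record Hypergraph (r n : ℕ) : Set where
  field
    edge    : Subset n → Bool
    uniform : ∀ e → T (edge e) → ∣ e ∣ ≡ r

open Hypergraph public

Family : (r : ℕ) (a : Level) → Set (lsuc a)
Family r a = ∀ {n} → Hypergraph r n → Set a

image : (Fin m → Fin n) → Subset m → Subset n
image f s = tabulate λ y → does (any? λ x → (x ∈? s) ×-dec (f x ≟ᶠ y))

-- H contains a (not necessarily induced) copy of G.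
Contains : Hypergraph r n → Hypergraph r m → Set
Contains {n = n} {m = m} H G =
  Σ (Fin m → Fin n) λ f →
    Injective _≡_ _≡_ f × (∀ e → T (edge G e) → T (edge H (image f e)))

Free : Family r a → Hypergraph r n → Set a
Free {r = r} 𝓖 H = ∀ {m} (G : Hypergraph r m) → 𝓖 G → ¬ Contains H G

------------------------------------------------------------------------
-- Degrees

subsets : ∀ n → List (Subset n)
subsets zero    = [] ∷ []
subsets (suc n) = map (outside ∷_) (subsets n) ++ map (inside ∷_) (subsets n)

subsetsOfSize : ∀ n → ℕ → List (Subset n)
subsetsOfSize n i = filter (λ s → ∣ s ∣ ≟ i) (subsets n)

deg : ∀ j → Hypergraph r n → Subset n → ℕ
deg {r = r} {n = n} j H t =
  length (filter (λ s → T? (edge H (s ∪ t))) (subsetsOfSize n (r ∸ j)))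

-- The first argument of min is one more candidate for the minimum. It bounds
-- every degree from above, so it only matters when there are no j-subsets.
δ : ∀ j → Hypergraph r n → ℕ
δ {r = r} {n = n} j H =
  min (length (subsetsOfSize n (r ∸ j))) (map (deg j H) (subsetsOfSize n j))

------------------------------------------------------------------------
-- Extended reals as lower cuts: x q means q < x. The empty cut is -∞.

Cut : (a : Level) → Set (lsuc a)
Cut a = ℚ → Set a

fromℕ : ℕ → ℚ
fromℕ n = + n / 1

_≥ᶜ_ : ∀ {a b} → Cut a → Cut b → Set _
x ≥ᶜ y = ∀ q → y q → x q

-- Quotient by a positive natural number: q < x / c iff q c < x.
_÷_ : Cut a → ℕ → Cut a
(x ÷ c) q = x (q * fromℕ c)

-- q < limsup xₙ iff some q' > q satisfies q' < xₙ for infinitely many n.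
limsup : (ℕ → Cut a) → Cut a
limsup x q = ∃ λ q' → q < q' × (∀ N → ∃ λ n → N ≤ n × x n q')

------------------------------------------------------------------------
-- Turán densities

-- The maximum of δ j H over the 𝓖-free H on n vertices, as a cut: a rational
-- lies below a maximum iff it lies below one of the candidates. It is -∞ when
-- no r-graph on n vertices is 𝓖-free.
ex : ∀ j → ℕ → Family r a → Cut a
ex {r = r} j n 𝓖 q = Σ (Hypergraph r n) λ H → Free 𝓖 H × q < fromℕ (δ j H)

-- For j ≤ r, the binomial coefficient vanishes only for n < r ∸ j, which does
-- not affect the limsup.
π : ∀ j → Family r a → Cut a
π {r = r} j 𝓖 = limsup λ n → ex j n 𝓖 ÷ (n C (r ∸ j))

turánDensity : Family r a → Cut a
turánDensity = π 0

------------------------------------------------------------------------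
-- Link graphs

-- Image of a subset under the increasing bijection from Fin ∣ ∁ t ∣ to the
-- complement of t.
expand : (t : Subset n) → Subset ∣ ∁ t ∣ → Subset n
expand []            []      = []
expand (inside  ∷ t) s       = outside ∷ expand t s
expand (outside ∷ t) (b ∷ s) = b ∷ expand t s

∣expand∪∣ : (t : Subset n) (s : Subset ∣ ∁ t ∣) →
            ∣ expand t s ∪ t ∣ ≡ ∣ s ∣ + ∣ t ∣
∣expand∪∣ []            []            = refl
∣expand∪∣ (inside  ∷ t) s             =
  trans (cong suc (∣expand∪∣ t s)) (sym (+-suc ∣ s ∣ ∣ t ∣))
∣expand∪∣ (outside ∷ t) (inside  ∷ s) = cong suc (∣expand∪∣ t s)
∣expand∪∣ (outside ∷ t) (outside ∷ s) = ∣expand∪∣ t s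

-- The vertex set of the link is the complement of t, relabelled
-- increasingly as Fin ∣ ∁ t ∣.
link : Hypergraph r n → (t : Subset n) → ∣ t ∣ ≡ j →
       Hypergraph (r ∸ j) ∣ ∁ t ∣
edge    (link F t p) s   = edge F (expand t s ∪ t)
uniform (link F t p) s h =
  trans (sym (m+n∸n≡m ∣ s ∣ ∣ t ∣))
        (cong₂ _∸_ (trans (sym (∣expand∪∣ t s)) (uniform F _ h)) p)

data 𝓛 {r a} (j : ℕ) (𝓕 : Family r a) : ∀ {m} → Hypergraph (r ∸ j) m → Set a where
  link∈ : ∀ {n} {F : Hypergraph r n} → 𝓕 F →
          (t : Subset n) (p : ∣ t ∣ ≡ j) → 𝓛 j 𝓕 (link F t p)

{-# OPTIONS --safe #-}

-- Let r = k − ℓ + 1 and let H be a dense r-graph avoiding the (ℓ − 1)-links. A graph G in which, for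
-- every set S of ℓ − 1 vertices, the edges whose ℓ − 1 smallest vertices are S form a subgraph of H
-- on the vertices above S is 𝓕-free: take for S the ℓ − 1 smallest vertices of a copy. It remains to
-- keep all ℓ-degrees of G close to the density of H.
--
-- Sampling m vertices of H, pigeonholing on the graph they span and applying Erdős's theorem on
-- complete multipartite graphs gives an r-graph J on few vertices, as dense as H, whose blow-up is
-- contained in H; deleting vertices of small degree makes every degree of J large. Each S then colours
-- the vertices above it by V(J), and ψ(colour of u, u) maps the edges of G above S to edges of H.
--
-- The colours must look random along every ℓ-set T. Every vertex stores the coefficients of a linear
-- hash function, a table of colours and a starting colour, and S colours u by adding to the starting
-- colour of u the entries that the tables of S have at the hashed place of u. For an edge containing T,
-- either S contains a vertex outside T, whose random data make the r colours almost independent, or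
-- S ⊆ T, and then only one vertex of T is coloured, the colours of the others are independent and
-- uniform, and the minimum degree of J suffices. The vertices are ordered by blocks, so that for almost
-- every choice of the blocks the data of the vertices outside T do not influence S.
module Submission where

open import Defs
open import Data.Bool.Base using (Bool; true; false; _∧_; _∨_; not; T)
open import Data.Bool.Properties using (T?) renaming (_≟_ to _≟ᵇ_)
open import Data.Empty using (⊥-elim)
open import Data.Fin.Base as Fin using (Fin; zero; suc; toℕ; fromℕ<; inject≤; punchIn; combine; remQuot; finToFun; funToFin; _↑ˡ_; _↑ʳ_)
open import Data.Fin.Properties as Fin using (toℕ-fromℕ<; toℕ-injective; toℕ<n; inject≤-injective; punchIn-injective; combine-monoˡ-<; combine-injective; combine-remQuot; remQuot-combine; funToFin-finToFin; all?; any?; ¬∀⟶∃¬) renaming (_≟_ to _≟ᶠ_)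
open import Data.Fin.Subset using (Subset; ∣_∣; ⊤; ⊥; _∪_; ∁; inside; outside)
open import Data.Fin.Subset.Properties using (_∈?_; ∪-identityʳ; ∣⊤∣≡n; ∣∁p∣≡n∸∣p∣)
open import Data.Integer.Base as ℤ using (-[1+_])
import Data.Integer.Properties as ℤ
open import Data.List.Base using (List; []; _∷_; _++_; map; filter; length; allFin; tabulate; lookup; zipWith; take; drop; cartesianProduct; cartesianProductWith)
open import Data.List.Extrema.Nat using (argmin-all; f[argmin]≤f[xs])
open import Data.List.Membership.Propositional using (_∈_; _∉_)
open import Data.List.Membership.Propositional.Properties using (∈-map⁺; ∈-map⁻; ∈-++⁺ˡ; ∈-++⁺ʳ; ∈-++⁻; ∈-filter⁺; ∈-filter⁻; ∈-lookup; ∈-allFin; ∈-cartesianProductWith⁺)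
open import Data.List.Properties using (length-map; length-++; length-tabulate; length-take; length-drop; length-filter; ++-assoc; map-++; map-∘; map-id; map-cong; map-cong-local; map-tabulate; take-map; drop-map; take++drop≡id)
open import Data.List.Relation.Binary.Permutation.Propositional as ↭ using (_↭_; ↭-refl; ↭-sym; ↭-trans; ↭-reflexive; ↭⇒↭ₛ)
open import Data.List.Relation.Binary.Permutation.Propositional.Properties using (∈-resp-↭; ↭-length) renaming (map⁺ to ↭-map⁺; shift to ↭-shift)
import Data.List.Relation.Binary.Permutation.Setoid.Properties as ↭ₛ
open import Data.List.Relation.Unary.All as All using (All; []; _∷_)
import Data.List.Relation.Unary.All.Properties as All
open import Data.List.Relation.Unary.AllPairs as AllPairs using (AllPairs; []; _∷_; allPairs?)
import Data.List.Relation.Unary.AllPairs.Properties as AllPairs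
open import Data.List.Relation.Unary.Any using (here; there)
import Data.List.Relation.Unary.Linked.Properties as Linked
open import Data.List.Relation.Unary.Unique.Propositional using (Unique)
import Data.List.Relation.Unary.Unique.Propositional.Properties as Unique
import Data.List.Sort as Sort
open import Data.Nat.Base
open import Data.Nat.Combinatorics using (_C_; nCk+nC[k+1]≡[n+1]C[k+1])
open import Data.Nat.DivMod
open import Data.Nat.Properties
open import Data.Nat.Tactic.RingSolver using (solve-∀)
open import Data.Product.Base using (Σ; ∃; ∃₂; _×_; _,_; proj₁; proj₂; uncurry)
open import Data.Rational.Base as ℚ using (ℚ; toℚᵘ; fromℚᵘ)
import Data.Rational.Properties as ℚ
open import Data.Rational.Unnormalised.Base as ℚᵘ using (mkℚᵘ)
import Data.Rational.Unnormalised.Properties as ℚᵘ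
open import Data.Sum.Base using (_⊎_; inj₁; inj₂)
open import Data.Sum.Properties using (inj₁-injective; inj₂-injective)
open import Data.Unit.Base using (tt) renaming (⊤ to Unit)
open import Data.Vec.Base as Vec using (Vec; []; _∷_; _[_]≔_; toList)
open import Data.Vec.Properties using (lookup∘update; lookup∘update′; lookup∘tabulate; tabulate∘lookup; tabulate-cong; ≡-dec; lookup-replicate; lookup-map; lookup-zipWith; updateAt-id-local; updateAt-updateAt; length-toList; toList∘fromList; []=⇒lookup; lookup⇒[]=)
open import Function.Base using (_∘_; id; it)
open import Function.Definitions using (Injective)
open import Level using (Level)
import Relation.Binary.Construct.On as On
open import Relation.Binary.Definitions using (tri<; tri≈; tri>)
open import Relation.Binary.PropositionalEquality
open import Relation.Nullary using (¬_; Dec; yes; no; does)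
open import Relation.Nullary.Decidable using (dec-true; dec-false; ¬?; _×-dec_)

-- Averaging over random choices controls one `ℓ`-set at a time, whereas the degree condition
-- concerns all of them at once. No concentration is used: every block contains each possible datum
-- equally often, so a uniform vertex outside `T` is itself a fresh random sample, and the estimate
-- is proved for each `T` separately. This explains the hash function. The data are part of the
-- vertex, and a table with one entry per vertex would have more values than there are vertices. So
-- the table has a length `w` independent of the number of vertices, and the coefficients grow with
-- the keys instead: keys have digits below `D = 2 * E`, coefficients lie below `E`, and the surplus
-- `2 ^ e` of keys over coefficient vectors pays for blocks, tables and start colours. Colours alone
-- do not give an injective map into `H`; inside the blow-up each vertex serves as its own position,
-- so the parts need at least `N` elements. Hence the order of choice: the bound `m` on the colours,
-- then all parameters, then the part size `b`, and only then the order `M` of `H`.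

private variable
  A A′ : Set
  m n j dim : ℕ

-- Truth values as numbers

⟦_⟧ : Bool → ℕ
⟦ true  ⟧ = 1
⟦ false ⟧ = 0

⟦⟧≤1 : ∀ b → ⟦ b ⟧ ≤ 1
⟦⟧≤1 true  = ≤-refl
⟦⟧≤1 false = z≤n

⟦⟧-∧ : ∀ a b → ⟦ a ∧ b ⟧ ≡ ⟦ a ⟧ * ⟦ b ⟧
⟦⟧-∧ true  b = sym (+-identityʳ ⟦ b ⟧)
⟦⟧-∧ false b = refl

⟦⟧-mono : ∀ {a b} → (a ≡ true → b ≡ true) → ⟦ a ⟧ ≤ ⟦ b ⟧
⟦⟧-mono {false}         _ = z≤n
⟦⟧-mono {true}  {true}  _ = ≤-refl
⟦⟧-mono {true}  {false} f with () ← f refl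

∧-elim : ∀ {a b} → a ∧ b ≡ true → a ≡ true × b ≡ true
∧-elim {true} {true} _ = refl , refl

∧-intro : ∀ {a b} → a ≡ true → b ≡ true → a ∧ b ≡ true
∧-intro refl refl = refl

does⇒ : ∀ {X : Set} (d : Dec X) → does d ≡ true → X
does⇒ (yes x) _ = x

-- Finite sums

∑ : List A → (A → ℕ) → ℕ
∑ []       f = 0
∑ (x ∷ xs) f = f x + ∑ xs f

∑-cong : ∀ (xs : List A) {f g : A → ℕ} → (∀ x → f x ≡ g x) → ∑ xs f ≡ ∑ xs g
∑-cong []       e = refl
∑-cong (x ∷ xs) e = cong₂ _+_ (e x) (∑-cong xs e)

∑-mono-∈ : ∀ (xs : List A) {f g : A → ℕ} → (∀ {x} → x ∈ xs → f x ≤ g x) → ∑ xs f ≤ ∑ xs g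
∑-mono-∈ []       e = z≤n
∑-mono-∈ (x ∷ xs) e = +-mono-≤ (e (here refl)) (∑-mono-∈ xs (e ∘ there))

∑-mono : ∀ (xs : List A) {f g : A → ℕ} → (∀ x → f x ≤ g x) → ∑ xs f ≤ ∑ xs g
∑-mono xs e = ∑-mono-∈ xs (λ {x} _ → e x)

∑-+ : ∀ (xs : List A) (f g : A → ℕ) → ∑ xs (λ x → f x + g x) ≡ ∑ xs f + ∑ xs g
∑-+ []       f g = refl
∑-+ (x ∷ xs) f g = trans (cong (f x + g x +_) (∑-+ xs f g)) (lem (f x) (g x) _ _)
  where
  lem : ∀ a b c d → a + b + (c + d) ≡ a + c + (b + d)
  lem = solve-∀

∑-*ˡ : ∀ (xs : List A) c (f : A → ℕ) → ∑ xs (λ x → c * f x) ≡ c * ∑ xs f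
∑-*ˡ []       c f = sym (*-zeroʳ c)
∑-*ˡ (x ∷ xs) c f = trans (cong (c * f x +_) (∑-*ˡ xs c f)) (sym (*-distribˡ-+ c (f x) _))

∑-*ʳ : ∀ (xs : List A) c (f : A → ℕ) → ∑ xs (λ x → f x * c) ≡ ∑ xs f * c
∑-*ʳ xs c f = trans (∑-cong xs (λ x → *-comm (f x) c)) (trans (∑-*ˡ xs c f) (*-comm c _))

∑-const : ∀ (xs : List A) c → ∑ xs (λ _ → c) ≡ length xs * c
∑-const []       c = refl
∑-const (x ∷ xs) c = cong (c +_) (∑-const xs c)

∑-zero : ∀ (xs : List A) → ∑ xs (λ _ → 0) ≡ 0
∑-zero xs = trans (∑-const xs 0) (*-zeroʳ (length xs))

∑-swap : ∀ (xs : List A) (ys : List A′) (f : A → A′ → ℕ) →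
         ∑ xs (λ x → ∑ ys (f x)) ≡ ∑ ys (λ y → ∑ xs (λ x → f x y))
∑-swap []       ys f = sym (∑-zero ys)
∑-swap (x ∷ xs) ys f =
  trans (cong (∑ ys (f x) +_) (∑-swap xs ys f)) (sym (∑-+ ys (f x) _))

∑-++ : ∀ (xs ys : List A) (f : A → ℕ) → ∑ (xs ++ ys) f ≡ ∑ xs f + ∑ ys f
∑-++ []       ys f = refl
∑-++ (x ∷ xs) ys f = trans (cong (f x +_) (∑-++ xs ys f)) (sym (+-assoc (f x) _ _))

∑-map : ∀ (g : A → A′) xs (f : A′ → ℕ) → ∑ (map g xs) f ≡ ∑ xs (f ∘ g)
∑-map g []       f = refl
∑-map g (x ∷ xs) f = cong (f (g x) +_) (∑-map g xs f)

∑-cartesianProductWith : ∀ {C : Set} (g : A → A′ → C) xs ys (f : C → ℕ) →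
  ∑ (cartesianProductWith g xs ys) f ≡ ∑ xs (λ x → ∑ ys (λ y → f (g x y)))
∑-cartesianProductWith g []       ys f = refl
∑-cartesianProductWith g (x ∷ xs) ys f =
  trans (∑-++ (map (g x) ys) _ f)
        (cong₂ _+_ (∑-map (g x) ys f) (∑-cartesianProductWith g xs ys f))

∑-filter : ∀ {p} {P : A → Set p} (P? : ∀ x → Dec (P x)) xs (f : A → ℕ) →
           ∑ (filter P? xs) f ≡ ∑ xs (λ x → ⟦ does (P? x) ⟧ * f x)
∑-filter P? []       f = refl
∑-filter P? (x ∷ xs) f with does (P? x)
... | true  = cong₂ _+_ (sym (+-identityʳ (f x))) (∑-filter P? xs f)
... | false = ∑-filter P? xs f

length-as-∑ : ∀ (xs : List A) → length xs ≡ ∑ xs (λ _ → 1)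
length-as-∑ xs = sym (trans (∑-const xs 1) (*-identityʳ _))

length-filter-∑ : ∀ {p} {P : A → Set p} (P? : ∀ x → Dec (P x)) xs →
                  length (filter P? xs) ≡ ∑ xs (λ x → ⟦ does (P? x) ⟧)
length-filter-∑ P? []       = refl
length-filter-∑ P? (x ∷ xs) with does (P? x)
... | true  = cong suc (length-filter-∑ P? xs)
... | false = length-filter-∑ P? xs

∑-allFin-suc : ∀ n (f : Fin (suc n) → ℕ) →
               ∑ (allFin (suc n)) f ≡ f zero + ∑ (allFin n) (f ∘ suc)
∑-allFin-suc n f = cong (f zero +_)
  (trans (cong (λ l → ∑ l f) (sym (map-tabulate id suc))) (∑-map suc (allFin n) f))

∑-allFin-const : ∀ n c → ∑ (allFin n) (λ _ → c) ≡ n * c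
∑-allFin-const n c = trans (∑-const (allFin n) c) (cong (_* c) (length-tabulate {n = n} id))

∑-allFin-lookup : ∀ (xs : List A) (f : A → ℕ) →
                  ∑ (allFin (length xs)) (f ∘ lookup xs) ≡ ∑ xs f
∑-allFin-lookup []       f = refl
∑-allFin-lookup (x ∷ xs) f =
  trans (∑-allFin-suc (length xs) _) (cong (f x +_) (∑-allFin-lookup xs f))

∑-allFin-+ : ∀ m n (f : Fin (m + n) → ℕ) →
  ∑ (allFin (m + n)) f ≡
  ∑ (allFin m) (f ∘ (_↑ˡ n)) + ∑ (allFin n) (f ∘ (m ↑ʳ_))
∑-allFin-+ zero    n f = refl
∑-allFin-+ (suc m) n f =
  trans (∑-allFin-suc (m + n) f)
  (trans (cong (f zero +_) (∑-allFin-+ m n (f ∘ suc)))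
  (trans (sym (+-assoc (f zero) _ _))
         (cong (_+ ∑ (allFin n) (f ∘ (suc m ↑ʳ_)))
               (sym (∑-allFin-suc m (f ∘ (_↑ˡ n)))))))

∑-combine : ∀ m n (f : Fin (m * n) → ℕ) →
  ∑ (allFin (m * n)) f ≡ ∑ (allFin m) (λ i → ∑ (allFin n) (λ j → f (combine i j)))
∑-combine zero    n f = refl
∑-combine (suc m) n f =
  trans (∑-allFin-+ n (m * n) f)
  (trans (cong (∑ (allFin n) (f ∘ (_↑ˡ (m * n))) +_) (∑-combine m n (f ∘ (n ↑ʳ_))))
         (sym (∑-allFin-suc m _)))

∑>0⇒∃ : ∀ (xs : List A) (P : A → Bool) → 0 < ∑ xs (⟦_⟧ ∘ P) → ∃ λ x → x ∈ xs × P x ≡ true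
∑>0⇒∃ (x ∷ xs) P h with P x in eq
... | true  = x , here refl , eq
... | false with ∑>0⇒∃ xs P h
...   | y , y∈ , Py = y , there y∈ , Py

count≤length : ∀ (xs : List A) (P : A → Bool) → ∑ xs (⟦_⟧ ∘ P) ≤ length xs
count≤length xs P = ≤-trans (∑-mono xs (λ x → ⟦⟧≤1 (P x))) (≤-reflexive (sym (length-as-∑ xs)))

∑-unique≤1 : ∀ n (P : Fin n → Bool) → (∀ i j → P i ≡ true → P j ≡ true → i ≡ j) →
             ∑ (allFin n) (⟦_⟧ ∘ P) ≤ 1
∑-unique≤1 zero    P u = z≤n
∑-unique≤1 (suc n) P u rewrite ∑-allFin-suc n (⟦_⟧ ∘ P) with P zero in eq
... | false = ∑-unique≤1 n (P ∘ suc) (λ i j p q → Fin.suc-injective (u _ _ p q))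
... | true  = ≤-reflexive (cong suc (trans (∑-cong (allFin n) z) (∑-zero (allFin n))))
  where
  z : ∀ i → ⟦ P (suc i) ⟧ ≡ 0
  z i with P (suc i) in e
  ... | false = refl
  ... | true  with () ← u _ _ eq e

-- Vectors over a finite list

vecs : List A → ∀ j → List (Vec A j)
vecs xs zero    = [] ∷ []
vecs xs (suc j) = cartesianProductWith _∷_ xs (vecs xs j)

∑-vecs-suc : ∀ (xs : List A) j (f : Vec A (suc j) → ℕ) →
  ∑ (vecs xs (suc j)) f ≡ ∑ xs (λ x → ∑ (vecs xs j) (λ v → f (x ∷ v)))
∑-vecs-suc xs j f = ∑-cartesianProductWith _∷_ xs (vecs xs j) f

length-vecs : ∀ (xs : List A) j → length (vecs xs j) ≡ length xs ^ j
length-vecs xs zero    = refl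
length-vecs xs (suc j) = trans (length-as-∑ (vecs xs (suc j)))
  (trans (∑-vecs-suc xs j _)
  (trans (∑-cong xs (λ _ → trans (sym (length-as-∑ (vecs xs j))) (length-vecs xs j)))
         (∑-const xs _)))

∑-vecs-const : ∀ (xs : List A) j c → ∑ (vecs xs j) (λ _ → c) ≡ length xs ^ j * c
∑-vecs-const xs j c = trans (∑-const (vecs xs j) c) (cong (_* c) (length-vecs xs j))

length-allFin : ∀ n → length (allFin n) ≡ n
length-allFin n = length-tabulate id

∑-tuples-const : ∀ n j c → ∑ (vecs (allFin n) j) (λ _ → c) ≡ n ^ j * c
∑-tuples-const n j c = trans (∑-vecs-const (allFin n) j c) (cong (λ l → l ^ j * c) (length-allFin n))

-- Each vector arises from `length xs` pairs, one for every discarded value of coordinate `i`. The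
-- lemma isolates one random choice while the others stay fixed.
∑-resample : ∀ (xs : List A) j (i : Fin j) (f : Vec A j → ℕ) →
  ∑ (vecs xs j) (λ v → ∑ xs (λ x → f (v Vec.[ i ]≔ x))) ≡ length xs * ∑ (vecs xs j) f
∑-resample xs (suc j) zero f =
  trans (∑-vecs-suc xs j _)
  (trans (∑-const xs _)
  (cong (length xs *_) (trans (∑-swap (vecs xs j) xs (λ v x → f (x ∷ v))) (sym (∑-vecs-suc xs j f)))))
∑-resample xs (suc j) (suc i) f =
  trans (∑-vecs-suc xs j _)
  (trans (∑-cong xs (λ x → ∑-resample xs j i (f ∘ (x ∷_))))
  (trans (∑-*ˡ xs (length xs) _)
         (cong (length xs *_) (sym (∑-vecs-suc xs j f)))))

-- Uniform distribution

map-update-∉ : ∀ (z : Vec A m) i x (I : List (Fin m)) → All (λ k → i ≢ k) I →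
               map (Vec.lookup (z [ i ]≔ x)) I ≡ map (Vec.lookup z) I
map-update-∉ z i x I i∉I =
  map-cong-local (All.map (λ i≢k → lookup∘update′ (i≢k ∘ sym) z x) i∉I)

-- Independence of distinct coordinates, with the normalising powers moved across so that no
-- division occurs. Coordinate `i` is redrawn; as it does not recur in `I`, the remaining lookups do
-- not change.
∑-lookup-unique : ∀ (xs : List A) (I : List (Fin m)) → Unique I → (F : List A → ℕ) →
  length xs ^ length I * ∑ (vecs xs m) (λ z → F (map (Vec.lookup z) I)) ≡
  length xs ^ m * ∑ (vecs xs (length I)) (F ∘ toList)
∑-lookup-unique {m = m} xs [] [] F =
  trans (*-identityˡ _)
    (trans (∑-vecs-const xs m (F [])) (cong (length xs ^ m *_) (sym (+-identityʳ (F [])))))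
∑-lookup-unique {m = m} xs (i ∷ I) (i∉I ∷ uI) F = begin
  l * l ^ k * ∑ zs f                                        ≡⟨ lem l (l ^ k) (∑ zs f) ⟩
  l ^ k * (l * ∑ zs f)                                      ≡⟨ cong (l ^ k *_) (sym (∑-resample xs m i f)) ⟩
  l ^ k * ∑ zs (λ z → ∑ xs (λ x → f (z [ i ]≔ x)))          ≡⟨ cong (l ^ k *_)
    (∑-cong zs λ z → ∑-cong xs λ x → cong F (cong₂ _∷_ (lookup∘update i z x) (map-update-∉ z i x I i∉I))) ⟩
  l ^ k * ∑ zs (λ z → ∑ xs (λ x → F (x ∷ map (Vec.lookup z) I))) ≡⟨ cong (l ^ k *_) (∑-swap zs xs _) ⟩
  l ^ k * ∑ xs (λ x → ∑ zs (λ z → F (x ∷ map (Vec.lookup z) I))) ≡⟨ sym (∑-*ˡ xs (l ^ k) _) ⟩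
  ∑ xs (λ x → l ^ k * ∑ zs (λ z → F (x ∷ map (Vec.lookup z) I))) ≡⟨ ∑-cong xs
    (λ x → ∑-lookup-unique xs I uI (F ∘ (x ∷_))) ⟩
  ∑ xs (λ x → l ^ m * ∑ (vecs xs k) (λ v → F (x ∷ toList v)))    ≡⟨ ∑-*ˡ xs (l ^ m) _ ⟩
  l ^ m * ∑ xs (λ x → ∑ (vecs xs k) (λ v → F (x ∷ toList v)))    ≡⟨ cong (l ^ m *_)
    (sym (∑-vecs-suc xs k (F ∘ toList))) ⟩
  l ^ m * ∑ (vecs xs (suc k)) (F ∘ toList)                  ∎
  where
  open ≡-Reasoning
  l  = length xs
  k  = length I
  zs = vecs xs m
  f  = λ z → F (Vec.lookup z i ∷ map (Vec.lookup z) I)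
  lem : ∀ a b c → a * b * c ≡ b * (a * c)
  lem = solve-∀

-- The hypothesis says, with denominators cleared, that each `ψ i` carries the uniform distribution
-- to the uniform one. The coordinates are drawn independently, so the property passes to products
-- one factor at a time.
∑-balanced : ∀ (xs : List A) (ys : List A′) j (ψ : Fin j → A → A′) →
  (∀ i (F : A′ → ℕ) → length ys * ∑ xs (F ∘ ψ i) ≡ length xs * ∑ ys F) →
  (F : List A′ → ℕ) →
  length ys ^ j * ∑ (vecs xs j) (λ a → F (tabulate λ i → ψ i (Vec.lookup a i))) ≡
  length xs ^ j * ∑ (vecs ys j) (F ∘ toList)
∑-balanced xs ys zero    ψ bal F = refl
∑-balanced xs ys (suc j) ψ bal F = begin
  q * q ^ j * ∑ (vecs xs (suc j)) _                 ≡⟨ cong (q * q ^ j *_) (∑-vecs-suc xs j _) ⟩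
  q * q ^ j * ∑ xs (λ x → ∑ (vecs xs j) (G x))      ≡⟨ *-assoc q (q ^ j) _ ⟩
  q * (q ^ j * ∑ xs (λ x → ∑ (vecs xs j) (G x)))    ≡⟨ cong (q *_) (sym (∑-*ˡ xs (q ^ j) _)) ⟩
  q * ∑ xs (λ x → q ^ j * ∑ (vecs xs j) (G x))      ≡⟨ cong (q *_)
    (∑-cong xs λ x → ∑-balanced xs ys j (ψ ∘ suc) (bal ∘ suc) (F ∘ (ψ zero x ∷_))) ⟩
  q * ∑ xs (λ x → p ^ j * ∑ (vecs ys j) (λ v → F (ψ zero x ∷ toList v))) ≡⟨ bal zero
    (λ y → p ^ j * ∑ (vecs ys j) (λ v → F (y ∷ toList v))) ⟩
  p * ∑ ys (λ y → p ^ j * ∑ (vecs ys j) (λ v → F (y ∷ toList v)))        ≡⟨ cong (p *_) (∑-*ˡ ys (p ^ j) _) ⟩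
  p * (p ^ j * ∑ ys (λ y → ∑ (vecs ys j) (λ v → F (y ∷ toList v))))      ≡⟨ sym (*-assoc p (p ^ j) _) ⟩
  p * p ^ j * ∑ ys (λ y → ∑ (vecs ys j) (λ v → F (y ∷ toList v)))        ≡⟨ cong (p * p ^ j *_)
    (sym (∑-vecs-suc ys j _)) ⟩
  p * p ^ j * ∑ (vecs ys (suc j)) (F ∘ toList)      ∎
  where
  open ≡-Reasoning
  p = length xs
  q = length ys
  G = λ x a → F (ψ zero x ∷ tabulate (λ i → ψ (suc i) (Vec.lookup a i)))

-- Cyclic shifts

infix 8 _mod′_
_mod′_ : ℕ → (m : ℕ) .{{_ : NonZero m}} → Fin m
x mod′ m = fromℕ< (m%n<n x m)

toℕ-mod′ : ∀ x m .{{_ : NonZero m}} → toℕ (x mod′ m) ≡ x % m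
toℕ-mod′ x m = toℕ-fromℕ< _

mod′-cong : ∀ {x y} m .{{_ : NonZero m}} → x % m ≡ y % m → x mod′ m ≡ y mod′ m
mod′-cong m e = toℕ-injective (trans (toℕ-mod′ _ m) (trans e (sym (toℕ-mod′ _ m))))

mod′-cong⁻ : ∀ {x y} m .{{_ : NonZero m}} → x mod′ m ≡ y mod′ m → x % m ≡ y % m
mod′-cong⁻ m e = trans (sym (toℕ-mod′ _ m)) (trans (cong toℕ e) (toℕ-mod′ _ m))

shift : .{{_ : NonZero m}} → ℕ → Fin m → Fin m
shift {m} x v = (x + toℕ v) mod′ m

-- Both sides sum `G` over the `k + 1` consecutive arguments from `x`. For a function of period `k`
-- the two end terms agree, which gives invariance under a shift by one.
∑-telescope : ∀ k x (G : ℕ → ℕ) →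
  ∑ (allFin k) (λ v → G (x + toℕ v)) + G (x + k) ≡ G x + ∑ (allFin k) (λ v → G (suc x + toℕ v))
∑-telescope zero    x G = trans (cong G (+-identityʳ x)) (sym (+-identityʳ (G x)))
∑-telescope (suc k) x G
  rewrite ∑-allFin-suc k (λ v → G (x + toℕ v))
        | ∑-allFin-suc k (λ v → G (suc x + toℕ v))
        | +-identityʳ x | +-suc x k = begin
  G x + ∑ (allFin k) (λ v → G (x + suc (toℕ v))) + G (suc (x + k))
    ≡⟨ +-assoc (G x) _ _ ⟩
  G x + (∑ (allFin k) (λ v → G (x + suc (toℕ v))) + G (suc x + k))
    ≡⟨ cong (λ s → G x + (s + G (suc x + k))) (∑-cong (allFin k) (λ v → cong G (+-suc x (toℕ v)))) ⟩
  G x + (∑ (allFin k) (λ v → G (suc x + toℕ v)) + G (suc x + k))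
    ≡⟨ cong (G x +_) (∑-telescope k (suc x) G) ⟩
  G x + (G (suc x) + ∑ (allFin k) (λ v → G (suc (suc x) + toℕ v)))
    ≡⟨ cong (λ s → G x + (G (suc x) + s)) (∑-cong (allFin k) (λ v → cong G (sym (+-suc (suc x) (toℕ v))))) ⟩
  G x + (G (suc x) + ∑ (allFin k) (λ v → G (suc x + suc (toℕ v)))) ∎
  where open ≡-Reasoning

∑-shift : ∀ m .{{_ : NonZero m}} x (F : Fin m → ℕ) →
          ∑ (allFin m) (F ∘ shift x) ≡ ∑ (allFin m) F
∑-shift m zero    F = ∑-cong (allFin m) λ v → cong F
  (toℕ-injective (trans (toℕ-mod′ (toℕ v) m) (m<n⇒m%n≡m (toℕ<n v))))
∑-shift m (suc x) F = trans (+-cancelˡ-≡ (G x) _ _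
  (trans (sym (∑-telescope m x G))
  (trans (cong (∑ (allFin m) (λ v → G (x + toℕ v)) +_) (cong F (mod′-cong m ([m+n]%n≡m%n x m))))
         (+-comm _ (G x))))) (∑-shift m x F)
  where G = λ y → F (y mod′ m)

-- Adding `c * pred m` completes `c` to a multiple of `m`, so subtraction is avoided.
%-cancelʳ : ∀ m .{{_ : NonZero m}} a b c → (a + c) % m ≡ (b + c) % m → a % m ≡ b % m
%-cancelʳ m a b c e = trans (sym (back a)) (trans (trans (%-distribˡ-+ (a + c) (c * pred m) m)
  (trans (cong (λ t → (t + (c * pred m) % m) % m) e) (sym (%-distribˡ-+ (b + c) (c * pred m) m)))) (back b))
  where
  lem : ∀ a c p → a + c + c * p ≡ a + c * suc p
  lem = solve-∀
  back : ∀ a → (a + c + c * pred m) % m ≡ a % m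
  back a = trans (cong (_% m) (trans (lem a c (pred m)) (cong (λ t → a + c * t) (suc-pred m))))
    ([m+kn]%n≡m%n a c m)

%-congˡ-+ : ∀ m .{{_ : NonZero m}} {a b} c → a % m ≡ b % m → (a + c) % m ≡ (b + c) % m
%-congˡ-+ m {a} {b} c e = trans (%-distribˡ-+ a c m)
  (trans (cong (λ t → (t + c % m) % m) e) (sym (%-distribˡ-+ b c m)))

%-cancel₂ : ∀ m .{{_ : NonZero m}} a b c d → a % m ≡ b % m → (a + c) % m ≡ (b + d) % m → c % m ≡ d % m
%-cancel₂ m a b c d e f = %-cancelʳ m c d b
  (trans (cong (_% m) (+-comm c b)) (trans (sym (%-congˡ-+ m c e)) (trans f (cong (_% m) (+-comm b d)))))

-- Subsets and tuples

⊤-lookup : ∀ (x : Fin n) → Vec.lookup ⊤ x ≡ true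
⊤-lookup {n} x = lookup-replicate x true

⊥-lookup : ∀ (x : Fin n) → Vec.lookup ⊥ x ≡ false
⊥-lookup {n} x = lookup-replicate x false

subset-ext : ∀ {p q : Subset n} → (∀ x → Vec.lookup p x ≡ true → Vec.lookup q x ≡ true) →
             (∀ x → Vec.lookup q x ≡ true → Vec.lookup p x ≡ true) → p ≡ q
subset-ext {p = p} {q} f g =
  trans (sym (tabulate∘lookup p)) (trans (tabulate-cong (λ x → eq (f x) (g x))) (tabulate∘lookup q))
  where
  eq : ∀ {a b} → (a ≡ true → b ≡ true) → (b ≡ true → a ≡ true) → a ≡ b
  eq {true}          f g = sym (f refl)
  eq {false} {true}  f g = g refl
  eq {false} {false} f g = refl

∣remove∣ : ∀ (s : Subset n) x → Vec.lookup s x ≡ true → suc ∣ s [ x ]≔ false ∣ ≡ ∣ s ∣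
∣remove∣ (true  ∷ s) zero    _ = refl
∣remove∣ (true  ∷ s) (suc x) h = cong suc (∣remove∣ s x h)
∣remove∣ (false ∷ s) (suc x) h = ∣remove∣ s x h

∣insert∣ : ∀ (s : Subset n) x → Vec.lookup s x ≡ false → ∣ s [ x ]≔ true ∣ ≡ suc ∣ s ∣
∣insert∣ (false ∷ s) zero    _ = refl
∣insert∣ (true  ∷ s) (suc x) h = cong suc (∣insert∣ s x h)
∣insert∣ (false ∷ s) (suc x) h = ∣insert∣ s x h

∑-lookup : ∀ (s : Subset n) → ∑ (allFin n) (λ x → ⟦ Vec.lookup s x ⟧) ≡ ∣ s ∣
∑-lookup []      = refl
∑-lookup {suc n} (true  ∷ s) = trans (∑-allFin-suc n (λ x → ⟦ Vec.lookup (true ∷ s) x ⟧))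
  (cong suc (∑-lookup s))
∑-lookup {suc n} (false ∷ s) = trans (∑-allFin-suc n (λ x → ⟦ Vec.lookup (false ∷ s) x ⟧)) (∑-lookup s)

setOf : List (Fin n) → Subset n
setOf []       = ⊥
setOf (x ∷ xs) = setOf xs [ x ]≔ true

∈⇒setOf : ∀ {x} {xs : List (Fin n)} → x ∈ xs → Vec.lookup (setOf xs) x ≡ true
∈⇒setOf {x = x} {y ∷ xs} x∈ with y ≟ᶠ x
... | yes refl = lookup∘update y (setOf xs) true
∈⇒setOf {x = x} {y ∷ xs} (here x≡y) | no y≢x = ⊥-elim (y≢x (sym x≡y))
∈⇒setOf {x = x} {y ∷ xs} (there x∈) | no y≢x =
  trans (lookup∘update′ (y≢x ∘ sym) (setOf xs) true) (∈⇒setOf x∈)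

setOf⇒∈ : ∀ {x} (xs : List (Fin n)) → Vec.lookup (setOf xs) x ≡ true → x ∈ xs
setOf⇒∈ {x = x} []       h with () ← trans (sym (⊥-lookup x)) h
setOf⇒∈ {x = x} (y ∷ xs) h with y ≟ᶠ x
... | yes refl = here refl
... | no y≢x   = there (setOf⇒∈ xs (trans (sym (lookup∘update′ (y≢x ∘ sym) (setOf xs) true)) h))

∉⇒setOf : ∀ {x} (xs : List (Fin n)) → x ∉ xs → Vec.lookup (setOf xs) x ≡ false
∉⇒setOf {x = x} xs x∉ with Vec.lookup (setOf xs) x in eq
... | false = refl
... | true  = ⊥-elim (x∉ (setOf⇒∈ xs eq))

∣setOf∣ : ∀ {xs : List (Fin n)} → Unique xs → ∣ setOf xs ∣ ≡ length xs
∣setOf∣ {n} {[]} [] = ∣⊥∣ n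
  where
  ∣⊥∣ : ∀ n → ∣ ⊥ {n} ∣ ≡ 0
  ∣⊥∣ zero    = refl
  ∣⊥∣ (suc n) = ∣⊥∣ n
∣setOf∣ {xs = x ∷ xs} (x∉ ∷ u) =
  trans (∣insert∣ (setOf xs) x (∉⇒setOf xs (λ x∈ → All.lookup x∉ x∈ refl))) (cong suc (∣setOf∣ u))

∣setOf∣≤ : ∀ (xs : List (Fin n)) → ∣ setOf xs ∣ ≤ length xs
∣setOf∣≤ {n} [] = ≤-reflexive (∣setOf∣ {n} [])
∣setOf∣≤ (x ∷ xs) with Vec.lookup (setOf xs) x in eq
... | false = ≤-trans (≤-reflexive (∣insert∣ (setOf xs) x eq)) (s≤s (∣setOf∣≤ xs))
... | true  = ≤-trans (≤-reflexive (cong ∣_∣ e)) (m≤n⇒m≤1+n (∣setOf∣≤ xs))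
  where
  e : setOf xs [ x ]≔ true ≡ setOf xs
  e = updateAt-id-local x (setOf xs) (sym eq)

∣setOf∣⇒Unique : ∀ (xs : List (Fin n)) → ∣ setOf xs ∣ ≡ length xs → Unique xs
∣setOf∣⇒Unique []       _ = []
∣setOf∣⇒Unique (x ∷ xs) h with Vec.lookup (setOf xs) x in eq
... | true  = ⊥-elim
  (<-irrefl (trans (cong ∣_∣ (sym (updateAt-id-local x (setOf xs) (sym eq)))) h) (s≤s (∣setOf∣≤ xs)))
... | false = All.tabulate (λ y∈ x≡y → case (trans (sym eq) (∈⇒setOf (subst (_∈ xs) (sym x≡y) y∈))))
            ∷ ∣setOf∣⇒Unique xs (suc-injective (trans (sym (∣insert∣ (setOf xs) x eq)) h))
  where
  case : ∀ {X : Set} → false ≡ true → X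
  case ()

setOf-cong : ∀ {xs ys : List (Fin n)} → (∀ {x} → x ∈ xs → x ∈ ys) → (∀ {x} → x ∈ ys → x ∈ xs) → setOf xs ≡
  setOf ys
setOf-cong {xs = xs} {ys} f g =
  subset-ext (λ x h → ∈⇒setOf (f (setOf⇒∈ xs h))) (λ x h → ∈⇒setOf (g (setOf⇒∈ ys h)))

-- Removing each entry from the set lets one recursion test membership and distinctness together,
-- and makes the count a falling factorial.
injectiveIn : Subset n → Vec (Fin n) j → Bool
injectiveIn s []      = true
injectiveIn s (x ∷ R) = Vec.lookup s x ∧ injectiveIn (s [ x ]≔ false) R

remove-⊆ : ∀ (s : Subset n) x {y} → Vec.lookup (s [ x ]≔ false) y ≡ true → x ≢ y × Vec.lookup s y ≡ true
remove-⊆ s x {y} h with x ≟ᶠ y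
... | yes refl with () ← trans (sym (lookup∘update x s false)) h
... | no x≢y = x≢y , trans (sym (lookup∘update′ (x≢y ∘ sym) s false)) h

injectiveIn⇒⊆ : ∀ (s : Subset n) (R : Vec (Fin n) j) → injectiveIn s R ≡ true → All
  (λ x → Vec.lookup s x ≡ true) (toList R)
injectiveIn⇒⊆ s []      h = []
injectiveIn⇒⊆ s (x ∷ R) h with ∧-elim {Vec.lookup s x} h
... | x∈ , h′ = x∈ ∷ All.map (proj₂ ∘ remove-⊆ s x) (injectiveIn⇒⊆ _ R h′)

injectiveIn⇒Unique : ∀ (s : Subset n) (R : Vec (Fin n) j) → injectiveIn s R ≡ true → Unique (toList R)
injectiveIn⇒Unique s []      h = []
injectiveIn⇒Unique s (x ∷ R) h with ∧-elim {Vec.lookup s x} h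
... | x∈ , h′ = All.map (proj₁ ∘ remove-⊆ s x) (injectiveIn⇒⊆ _ R h′) ∷ injectiveIn⇒Unique _ R h′

Unique⇒injectiveIn : ∀ (s : Subset n) (R : Vec (Fin n) j) → Unique (toList R) →
  All (λ x → Vec.lookup s x ≡ true) (toList R) → injectiveIn s R ≡ true
Unique⇒injectiveIn s []      _        _        = refl
Unique⇒injectiveIn s (x ∷ R) (x∉ ∷ u) (x∈ ∷ a) =
  ∧-intro x∈ (Unique⇒injectiveIn _ R u
    (All.tabulate λ y∈ → trans (lookup∘update′ (All.lookup x∉ y∈ ∘ sym) s false) (All.lookup a y∈)))

-- The falling factorial; `pred` stops at zero, so the product vanishes for `j > n`.
fall : ℕ → ℕ → ℕ
fall n zero    = 1
fall n (suc j) = n * fall (pred n) j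

∑-injectiveIn : ∀ j (s : Subset n) → ∑ (vecs (allFin n) j) (⟦_⟧ ∘ injectiveIn s) ≡ fall ∣ s ∣ j
∑-injectiveIn zero    s = refl
∑-injectiveIn {n} (suc j) s =
  trans (∑-vecs-suc (allFin n) j _)
  (trans (∑-cong (allFin n) λ x → trans (∑-cong (vecs (allFin n) j) (λ R → ⟦⟧-∧ (Vec.lookup s x) _))
                                  (trans (∑-*ˡ (vecs (allFin n) j) ⟦ Vec.lookup s x ⟧ _) (step x)))
  (trans (∑-*ʳ (allFin n) (fall (pred ∣ s ∣) j) _) (cong (_* fall (pred ∣ s ∣) j) (∑-lookup s))))
  where
  step : ∀ x → ⟦ Vec.lookup s x ⟧ * ∑ (vecs (allFin n) j) (⟦_⟧ ∘ injectiveIn (s [ x ]≔ false)) ≡ ⟦ Vec.lookup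
    s x ⟧ * fall (pred ∣ s ∣) j
  step x with Vec.lookup s x in eq
  ... | false = refl
  ... | true  = cong (1 *_)
    (trans (∑-injectiveIn j (s [ x ]≔ false)) (cong (λ t → fall t j) (cong pred (∣remove∣ s x eq))))

fall≤^ : ∀ n j → fall n j ≤ n ^ j
fall≤^ n zero    = ≤-refl
fall≤^ n (suc j) = *-monoʳ-≤ n (≤-trans (fall≤^ (pred n) j) (^-monoˡ-≤ j pred[n]≤n))

^≤fall : ∀ n j → (n ∸ j) ^ j ≤ fall n j
^≤fall n zero    = ≤-refl
^≤fall n (suc j) = *-mono-≤ (m∸n≤m n (suc j))
  (≤-trans (≤-reflexive (cong (_^ j) (lem n))) (^≤fall (pred n) j))
  where
  lem : ∀ n → n ∸ suc j ≡ pred n ∸ j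
  lem zero    = sym (0∸n≡0 j)
  lem (suc n) = refl

fall-self : ∀ n → fall n n ≡ n !
fall-self zero    = refl
fall-self (suc n) = cong (suc n *_) (fall-self n)

injectiveIn⇒setOf : ∀ (s : Subset n) (R : Vec (Fin n) j) → ∣ s ∣ ≡ j → injectiveIn s R ≡ true → s ≡ setOf
  (toList R)
injectiveIn⇒setOf s [] h _ = subset-ext (λ x x∈ → case (trans (∣remove∣ s x x∈) h))
  (λ x x∈ → case′ (trans (sym (⊥-lookup x)) x∈))
  where
  case : ∀ {X : Set} {k} → suc k ≡ 0 → X
  case ()
  case′ : ∀ {X : Set} → false ≡ true → X
  case′ ()
injectiveIn⇒setOf s (x ∷ R) h i with ∧-elim {Vec.lookup s x} i
... | x∈ , i′ = trans (sym back)
  (cong (_[ x ]≔ true) (injectiveIn⇒setOf _ R (suc-injective (trans (∣remove∣ s x x∈) h)) i′))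
  where
  back : s [ x ]≔ false [ x ]≔ true ≡ s
  back = trans (updateAt-updateAt x s) (updateAt-id-local x s (sym x∈))

∑-subsets-≡ : ∀ n (t : Subset n) (F : Subset n → ℕ) →
  ∑ (subsets n) (λ s → ⟦ does (≡-dec _≟ᵇ_ s t) ⟧ * F s) ≡ F t
∑-subsets-≡ zero    []      F = trans (+-identityʳ _) (+-identityʳ _)
∑-subsets-≡ (suc n) (true ∷ t)  F =
  trans (∑-++ (map (outside ∷_) (subsets n)) _ _)
  (trans (cong₂ _+_
    (trans (∑-map (outside ∷_) (subsets n) _) (trans (∑-cong (subsets n) (λ s → refl)) (∑-zero (subsets n))))
                    (trans (∑-map (inside ∷_) (subsets n) _) (∑-subsets-≡ n t (F ∘ (true ∷_))))) refl)
∑-subsets-≡ (suc n) (false ∷ t) F =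
  trans (∑-++ (map (outside ∷_) (subsets n)) _ _)
  (trans (cong₂ _+_ (trans (∑-map (outside ∷_) (subsets n) _) (∑-subsets-≡ n t (F ∘ (false ∷_))))
                    (trans (∑-map (inside ∷_) (subsets n) _)
                      (trans (∑-cong (subsets n) (λ s → refl)) (∑-zero (subsets n)))))
   (+-identityʳ _))

-- A set of size `j` is listed by exactly `j !` repetition-free tuples of length `j`. The factor
-- `j !` is expanded into these tuples, and after exchanging the sums only the set
-- `setOf (toList R)` survives for a given `R`.
∑-subsetsOfSize : ∀ n j (F : Subset n → ℕ) →
  ∑ (vecs (allFin n) j) (λ R → ⟦ injectiveIn ⊤ R ⟧ * F (setOf (toList R))) ≡ j ! * ∑ (subsetsOfSize n j) F
∑-subsetsOfSize n j F = sym (begin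
  j ! * ∑ (subsetsOfSize n j) F
    ≡⟨ cong (j ! *_) (∑-filter (λ s → ∣ s ∣ ≟ j) (subsets n) F) ⟩
  j ! * ∑ (subsets n) (λ s → ⟦ does (∣ s ∣ ≟ j) ⟧ * F s)
    ≡⟨ sym (∑-*ˡ (subsets n) (j !) _) ⟩
  ∑ (subsets n) (λ s → j ! * (⟦ does (∣ s ∣ ≟ j) ⟧ * F s))
    ≡⟨ ∑-cong (subsets n) split ⟩
  ∑ (subsets n) (λ s → ∑ Rs (λ R → ⟦ injectiveIn s R ⟧ * (⟦ does (∣ s ∣ ≟ j) ⟧ * F s)))
    ≡⟨ ∑-swap (subsets n) Rs _ ⟩
  ∑ Rs (λ R → ∑ (subsets n) (λ s → ⟦ injectiveIn s R ⟧ * (⟦ does (∣ s ∣ ≟ j) ⟧ * F s)))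
    ≡⟨ ∑-cong Rs (λ R → ∑-cong (subsets n) (point R)) ⟩
  ∑ Rs (λ R → ∑ (subsets n) (λ s → ⟦ does (≡-dec _≟ᵇ_ s (setOf (toList R))) ⟧ * (⟦ injectiveIn ⊤ R ⟧ * F s)))
    ≡⟨ ∑-cong Rs (λ R → ∑-subsets-≡ n (setOf (toList R)) _) ⟩
  ∑ Rs (λ R → ⟦ injectiveIn ⊤ R ⟧ * F (setOf (toList R))) ∎)
  where
  open ≡-Reasoning
  Rs = vecs (allFin n) j
  split : ∀ s → j ! * (⟦ does (∣ s ∣ ≟ j) ⟧ * F s) ≡ ∑ Rs
    (λ R → ⟦ injectiveIn s R ⟧ * (⟦ does (∣ s ∣ ≟ j) ⟧ * F s))
  split s with ∣ s ∣ ≟ j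
  ... | yes refl rewrite dec-true (∣ s ∣ ≟ ∣ s ∣) refl =
    trans (cong (_* (1 * F s)) (sym (trans (∑-injectiveIn ∣ s ∣ s) (fall-self ∣ s ∣))))
          (sym (∑-*ʳ (vecs (allFin n) ∣ s ∣) (1 * F s) _))
  ... | no ne rewrite dec-false (∣ s ∣ ≟ j) ne =
    trans (*-zeroʳ (j !)) (sym (trans (∑-cong Rs (λ R → *-zeroʳ ⟦ injectiveIn s R ⟧)) (∑-zero Rs)))
  point : ∀ R s → ⟦ injectiveIn s R ⟧ * (⟦ does (∣ s ∣ ≟ j) ⟧ * F s) ≡
                  ⟦ does (≡-dec _≟ᵇ_ s (setOf (toList R))) ⟧ * (⟦ injectiveIn ⊤ R ⟧ * F s)
  point R s with ≡-dec _≟ᵇ_ s (setOf (toList R)) | injectiveIn s R in i | ∣ s ∣ ≟ j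
  ... | yes refl | true | yes p rewrite dec-true (∣ s ∣ ≟ j) p | Unique⇒injectiveIn ⊤ R
    (injectiveIn⇒Unique s R i) (All.tabulate λ {x} _ → ⊤-lookup x) = refl
  ... | yes refl | true | no ne = ⊥-elim (ne (trans (∣setOf∣ (injectiveIn⇒Unique s R i)) (length-toList R)))
  ... | yes refl | false | d with injectiveIn ⊤ R in i⊤
  ...   | false = refl
  ...   | true with () ← trans (sym i)
    (Unique⇒injectiveIn s R (injectiveIn⇒Unique ⊤ R i⊤) (All.tabulate ∈⇒setOf))
  point R s | no ne | false | d = refl
  point R s | no ne | true | no q rewrite dec-false (∣ s ∣ ≟ j) q = refl
  point R s | no ne | true | yes p = ⊥-elim (ne (injectiveIn⇒setOf s R p i))

length-subsetsOfSize : ∀ n j → length (subsetsOfSize n j) ≡ n C j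
length-subsetsOfSize zero    zero    = refl
length-subsetsOfSize zero    (suc j) = refl
length-subsetsOfSize (suc n) j = begin
  length (filter (λ s → ∣ s ∣ ≟ j) (map (outside ∷_) (subsets n) ++ map (inside ∷_) (subsets n)))
    ≡⟨ length-filter-∑ (λ s → ∣ s ∣ ≟ j) (map (outside ∷_) (subsets n) ++ map (inside ∷_) (subsets n)) ⟩
  ∑ (map (outside ∷_) (subsets n) ++ map (inside ∷_) (subsets n)) (λ s → ⟦ does (∣ s ∣ ≟ j) ⟧)
    ≡⟨ trans (∑-++ (map (outside ∷_) (subsets n)) _ _)
      (cong₂ _+_ (∑-map (outside ∷_) (subsets n) _) (∑-map (inside ∷_) (subsets n) _)) ⟩
  ∑ (subsets n) (λ s → ⟦ does (∣ s ∣ ≟ j) ⟧) + ∑ (subsets n) (λ s → ⟦ does (suc ∣ s ∣ ≟ j) ⟧)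
    ≡⟨ cong (_+ ∑ (subsets n) (λ s → ⟦ does (suc ∣ s ∣ ≟ j) ⟧)) (count n j) ⟩
  n C j + ∑ (subsets n) (λ s → ⟦ does (suc ∣ s ∣ ≟ j) ⟧)
    ≡⟨ pascal j ⟩
  suc n C j ∎
  where
  open ≡-Reasoning
  count : ∀ n j → ∑ (subsets n) (λ s → ⟦ does (∣ s ∣ ≟ j) ⟧) ≡ n C j
  count n j = trans (sym (length-filter-∑ (λ s → ∣ s ∣ ≟ j) (subsets n))) (length-subsetsOfSize n j)
  pascal : ∀ j → n C j + ∑ (subsets n) (λ s → ⟦ does (suc ∣ s ∣ ≟ j) ⟧) ≡ suc n C j
  pascal zero    = cong (n C 0 +_) (∑-zero (subsets n))
  pascal (suc j) = trans (cong (n C suc j +_) (count n j))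
    (trans (+-comm (n C suc j) (n C j)) (nCk+nC[k+1]≡[n+1]C[k+1] n j))

-- Both sides count repetition-free tuples, once entry by entry and once through their underlying
-- sets.
fall≡!*C : ∀ n j → fall n j ≡ j ! * (n C j)
fall≡!*C n j = begin
  fall n j                                                        ≡⟨ cong (λ t → fall t j) (sym (∣⊤∣ n)) ⟩
  fall ∣ ⊤ {n} ∣ j                                                ≡⟨ sym (∑-injectiveIn j (⊤ {n})) ⟩
  ∑ (vecs (allFin n) j) (⟦_⟧ ∘ injectiveIn ⊤)                     ≡⟨ ∑-cong (vecs (allFin n) j)
    (λ R → sym (*-identityʳ _)) ⟩
  ∑ (vecs (allFin n) j) (λ R → ⟦ injectiveIn ⊤ R ⟧ * 1)           ≡⟨ ∑-subsetsOfSize n j (λ _ → 1) ⟩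
  j ! * ∑ (subsetsOfSize n j) (λ _ → 1)                           ≡⟨ cong (j ! *_)
    (trans (sym (length-as-∑ (subsetsOfSize n j))) (length-subsetsOfSize n j)) ⟩
  j ! * (n C j)                                                   ∎
  where
  open ≡-Reasoning
  ∣⊤∣ : ∀ n → ∣ ⊤ {n} ∣ ≡ n
  ∣⊤∣ zero    = refl
  ∣⊤∣ (suc n) = cong suc (∣⊤∣ n)

unique? : (xs : List (Fin n)) → Dec (Unique xs)
unique? = allPairs? (λ x y → ¬? (x ≟ᶠ y))

-- Powers

n<2^n : ∀ n → n < 2 ^ n
n<2^n zero    = s≤s z≤n
n<2^n (suc n) = begin-strict
  suc n         <⟨ s≤s (n<2^n n) ⟩
  1 + 2 ^ n     ≤⟨ +-monoˡ-≤ (2 ^ n) (m^n>0 2 n) ⟩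
  2 ^ n + 2 ^ n ≡⟨ cong (λ t → 2 ^ n + t) (sym (+-identityʳ (2 ^ n))) ⟩
  2 * 2 ^ n     ∎
  where open ≤-Reasoning

^-distrib-* : ∀ x y e → (x * y) ^ e ≡ x ^ e * y ^ e
^-distrib-* x y zero    = refl
^-distrib-* x y (suc e) = trans (cong (x * y *_) (^-distrib-* x y e)) (r x y (x ^ e) (y ^ e))
  where
  r : ∀ x y a b → x * y * (a * b) ≡ x * a * (y * b)
  r = solve-∀

private
  -- Bernoulli's inequality `(1 - s / n) ^ j ≥ 1 - j s / n` for `n = x + s`, multiplied by
  -- `n ^ (j + 1)`.
  bernoulli : ∀ j x s → (x + s) ^ j * (x + s) ≤ x ^ j * (x + s) + j * s * (x + s) ^ j
  bernoulli zero    x s = ≤-reflexive (sym (+-identityʳ _))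
  bernoulli (suc j) x s = begin
    B * B ^ j * B                                       ≡⟨ *-assoc B (B ^ j) B ⟩
    B * (B ^ j * B)                                     ≤⟨ *-monoʳ-≤ B (bernoulli j x s) ⟩
    B * (x ^ j * B + j * s * B ^ j)                     ≡⟨ e₁ x s (x ^ j) (B ^ j) j ⟩
    x * x ^ j * B + s * (x ^ j * B) + j * s * (B * B ^ j) ≤⟨ +-monoˡ-≤ _
      (+-monoʳ-≤ (x * x ^ j * B) (*-monoʳ-≤ s (*-monoˡ-≤ B (^-monoˡ-≤ j (m≤m+n x s))))) ⟩
    x * x ^ j * B + s * (B ^ j * B) + j * s * (B * B ^ j) ≡⟨ e₂ B s (x * x ^ j * B) (B ^ j) j ⟩
    x * x ^ j * B + suc j * s * (B * B ^ j)             ∎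
    where
    open ≤-Reasoning
    B = x + s
    e₁ : ∀ x s a b j → (x + s) * (a * (x + s) + j * s * b) ≡ x * a * (x + s) + s * (a * (x + s)) + j * s *
      ((x + s) * b)
    e₁ = solve-∀
    e₂ : ∀ B s c b j → c + s * (b * B) + j * s * (B * b) ≡ c + suc j * s * (B * b)
    e₂ = solve-∀

-- Once `n ≥ (p + 1) j s`, Bernoulli's loss `j s / n` is at most `1 / (p + 1)`, which is one unit of
-- the numerator. The further `s + 1` in `N` makes `n ∸ s` a true difference and `n` positive.
^-shrink : ∀ p j s → ∃ λ N → ∀ n → N ≤ n → p * n ^ j ≤ suc p * (n ∸ s) ^ j
^-shrink p j s = suc (s + suc p * (j * s)) , go
  where
  open ≤-Reasoning
  e : ∀ p b a c → b * suc p * (p * a) + c ≡ c + b * suc p * (p * a)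
  e = solve-∀
  go : ∀ n → suc (s + suc p * (j * s)) ≤ n → p * n ^ j ≤ suc p * (n ∸ s) ^ j
  go n h = *-cancelʳ-≤ (p * n ^ j) (suc p * x ^ j) n ⦃ >-nonZero n>0 ⦄ (+-cancelʳ-≤ (n ^ j * n) _ _ (begin
    p * n ^ j * n + n ^ j * n                 ≡⟨ e₁ p (n ^ j) n ⟩
    suc p * (n ^ j * n)                       ≤⟨ *-monoʳ-≤ (suc p)
      (subst (λ t → t ^ j * t ≤ x ^ j * t + j * s * t ^ j) x+s≡n (bernoulli j x s)) ⟩
    suc p * (x ^ j * n + j * s * n ^ j)       ≡⟨ e₂ p (x ^ j) n (j * s) (n ^ j) ⟩
    suc p * x ^ j * n + n ^ j * (suc p * (j * s)) ≤⟨ +-monoʳ-≤ (suc p * x ^ j * n)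
      (*-monoʳ-≤ (n ^ j) (≤-trans (m≤n+m _ (suc s)) h)) ⟩
    suc p * x ^ j * n + n ^ j * n             ∎))
    where
    x = n ∸ s
    n>0 : 0 < n
    n>0 = ≤-trans (s≤s z≤n) h
    x+s≡n : x + s ≡ n
    x+s≡n = m∸n+n≡m (≤-trans (m≤n⇒m≤1+n (m≤m+n s _)) h)
    e₁ : ∀ p a n → p * a * n + a * n ≡ suc p * (a * n)
    e₁ = solve-∀
    e₂ : ∀ p a n c b → suc p * (a * n + c * b) ≡ suc p * a * n + b * (suc p * c)
    e₂ = solve-∀

-- Linear hashing

dot : ∀ {E D} → Vec (Fin E) dim → Vec (Fin D) dim → ℕ
dot []       []       = 0
dot (x ∷ xs) (k ∷ ks) = toℕ x * toℕ k + dot xs ks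

module _ (E D w : ℕ) .⦃ _ : NonZero w ⦄ (w-large : E * D ≤ w) where

  private
    collide : ℕ → Vec (Fin D) dim → ℕ → Vec (Fin D) dim → Vec (Fin E) dim → Bool
    collide α k β k′ x = does ((α + dot x k) % w ≟ (β + dot x k′) % w)

    collide⇒≡ : ∀ {a b} → does (a ≟ b) ≡ true → a ≡ b
    collide⇒≡ {a} {b} = does⇒ (a ≟ b)

    -- Subtracting the two congruences leaves `gap * k ≡ gap * k′` modulo `w`. Both products are
    -- below `E * D ≤ w`, so they are equal as integers and `gap` cancels: smallness replaces a
    -- prime modulus.
    separated : ∀ α s k β s′ k′ (x y : Fin E) → toℕ x < toℕ y → k ≢ k′ →
      (α + (toℕ x * toℕ {D} k + s)) % w ≡ (β + (toℕ x * toℕ {D} k′ + s′)) % w →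
      (α + (toℕ y * toℕ k + s)) % w ≢ (β + (toℕ y * toℕ k′ + s′)) % w
    separated α s k β s′ k′ x y x<y k≢k′ e e′ = k≢k′ (toℕ-injective
      (*-cancelˡ-≡ (toℕ k) (toℕ k′) gap ⦃ >-nonZero (m<n⇒0<n∸m x<y) ⦄
        (trans (sym (m<n⇒m%n≡m (small k))) (trans eq (m<n⇒m%n≡m (small k′))))))
      where
      gap = toℕ y ∸ toℕ x
      small : ∀ (k : Fin D) → gap * toℕ k < w
      small k = <-≤-trans (*-mono-< (≤-<-trans (m∸n≤m (toℕ y) (toℕ x)) (toℕ<n y)) (toℕ<n k)) w-large
      lem : ∀ a x gap k s → a + ((x + gap) * k + s) ≡ a + (x * k + s) + gap * k
      lem = solve-∀
      shiftᵧ : ∀ a k s → a + (toℕ y * k + s) ≡ a + (toℕ x * k + s) + gap * k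
      shiftᵧ a k s = trans (cong (λ t → a + (t * k + s)) (sym (m+[n∸m]≡n (<⇒≤ x<y)))) (lem a (toℕ x) gap k s)
      eq : (gap * toℕ k) % w ≡ (gap * toℕ k′) % w
      eq = %-cancel₂ w (α + (toℕ x * toℕ k + s)) (β + (toℕ x * toℕ k′ + s′)) _ _ e
             (trans (cong (_% w) (sym (shiftᵧ α (toℕ k) s))) (trans e′ (cong (_% w) (shiftᵧ β (toℕ k′) s′))))

  -- At the first coordinate where the keys differ, at most one value of the coefficient collides.
  collisions : ∀ α (k : Vec (Fin D) dim) β k′ → k ≢ k′ →
    E * ∑ (vecs (allFin E) dim) (⟦_⟧ ∘ collide α k β k′) ≤ E ^ dim
  collisions α [] β [] ne = ⊥-elim (ne refl)
  collisions {suc dim} α (k ∷ ks) β (k′ ∷ ks′) ne with k ≟ᶠ k′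
  ... | no k≢k′ = *-monoʳ-≤ E (begin
    ∑ (vecs (allFin E) (suc dim)) (⟦_⟧ ∘ collide α (k ∷ ks) β (k′ ∷ ks′))
      ≡⟨ ∑-vecs-suc (allFin E) dim _ ⟩
    ∑ (allFin E) (λ x → ∑ (vecs (allFin E) dim) (λ xs → ⟦ collide α (k ∷ ks) β (k′ ∷ ks′) (x ∷ xs) ⟧))
      ≡⟨ ∑-swap (allFin E) (vecs (allFin E) dim) _ ⟩
    ∑ (vecs (allFin E) dim) (λ xs → ∑ (allFin E) (λ x → ⟦ collide α (k ∷ ks) β (k′ ∷ ks′) (x ∷ xs) ⟧))
      ≤⟨ ∑-mono (vecs (allFin E) dim) (λ xs → ∑-unique≤1 E _ (once xs)) ⟩
    ∑ (vecs (allFin E) dim) (λ _ → 1)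
      ≡⟨ trans (∑-tuples-const E dim 1) (*-identityʳ _) ⟩
    E ^ dim ∎)
    where
    open ≤-Reasoning
    once : ∀ xs x y → collide α (k ∷ ks) β (k′ ∷ ks′) (x ∷ xs) ≡ true →
           collide α (k ∷ ks) β (k′ ∷ ks′) (y ∷ xs) ≡ true → x ≡ y
    once xs x y e e′ with <-cmp (toℕ x) (toℕ y)
    ... | tri< x<y _ _ = ⊥-elim
      (separated α (dot xs ks) k β (dot xs ks′) k′ x y x<y k≢k′ (collide⇒≡ e) (collide⇒≡ e′))
    ... | tri≈ _ x≡y _ = toℕ-injective x≡y
    ... | tri> _ _ y<x = ⊥-elim
      (separated α (dot xs ks) k β (dot xs ks′) k′ y x y<x k≢k′ (collide⇒≡ e′) (collide⇒≡ e))
  ... | yes refl = begin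
    E * ∑ (vecs (allFin E) (suc dim)) (⟦_⟧ ∘ collide α (k ∷ ks) β (k ∷ ks′))
      ≡⟨ cong (E *_) (∑-vecs-suc (allFin E) dim _) ⟩
    E * ∑ (allFin E) (λ x → ∑ (vecs (allFin E) dim) (λ xs → ⟦ collide α (k ∷ ks) β (k ∷ ks′) (x ∷ xs) ⟧))
      ≡⟨ sym (∑-*ˡ (allFin E) E _) ⟩
    ∑ (allFin E) (λ x → E * ∑ (vecs (allFin E) dim) (λ xs → ⟦ collide α (k ∷ ks) β (k ∷ ks′) (x ∷ xs) ⟧))
      ≤⟨ ∑-mono (allFin E) step ⟩
    ∑ (allFin E) (λ x → E ^ dim)
      ≡⟨ ∑-allFin-const E (E ^ dim) ⟩
    E * E ^ dim ∎
    where
    open ≤-Reasoning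
    step : ∀ x → E * ∑ (vecs (allFin E) dim) (λ xs → ⟦ collide α (k ∷ ks) β (k ∷ ks′) (x ∷ xs) ⟧) ≤ E ^ dim
    step x = ≤-trans (≤-reflexive (cong (E *_) (∑-cong (vecs (allFin E) dim) λ xs →
               cong ⟦_⟧ (cong₂ (λ a b → does (a % w ≟ b % w)) (sym (+-assoc α _ _)) (sym (+-assoc β _ _))))))
             (collisions (α + toℕ x * toℕ k) ks (β + toℕ x * toℕ k) ks′ (λ e → ne (cong (k ∷_) e)))

  hash : Vec (Fin E) dim → Vec (Fin D) dim × ℕ → Fin w
  hash x (k , α) = (α + dot x k) mod′ w

  -- The coefficients contribute equally to equal keys, so there the additive constants alone must
  -- keep the values apart.
  Separated : Vec (Fin D) dim × ℕ → Vec (Fin D) dim × ℕ → Set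
  Separated (k , α) (k′ , α′) = k ≡ k′ → α % w ≢ α′ % w

  private
    pair-collisions : ∀ (p q : Vec (Fin D) dim × ℕ) → Separated p q →
      E * ∑ (vecs (allFin E) dim) (λ x → ⟦ does (hash x p ≟ᶠ hash x q) ⟧) ≤ E ^ dim
    pair-collisions {dim} (k , α) (k′ , α′) sep with ≡-dec _≟ᶠ_ k k′
    ... | no ne = ≤-trans (*-monoʳ-≤ E (∑-mono (vecs (allFin E) dim) (λ x → ⟦⟧-mono (imp x))))
      (collisions α k α′ k′ ne)
      where
      imp : ∀ x → does (hash x (k , α) ≟ᶠ hash x (k′ , α′)) ≡ true → collide α k α′ k′ x ≡ true
      imp x e with hash x (k , α) ≟ᶠ hash x (k′ , α′)
      ... | yes h = dec-true (_ ≟ _) (mod′-cong⁻ w h)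
    ... | yes refl = ≤-trans
      (≤-reflexive (trans
      (cong (E *_) (trans (∑-cong (vecs (allFin E) dim) never) (∑-zero (vecs (allFin E) dim)))) (*-zeroʳ E)))
      z≤n
      where
      never : ∀ x → ⟦ does (hash x (k , α) ≟ᶠ hash x (k , α′)) ⟧ ≡ 0
      never x = cong ⟦_⟧ (dec-false (hash x (k , α) ≟ᶠ hash x (k , α′))
                  (λ h → sep refl (%-cancelʳ w α α′ (dot x k) (mod′-cong⁻ w h))))

    collisionsWith : Fin w → List (Fin w) → ℕ
    collisionsWith p qs = ∑ qs (λ q → ⟦ does (p ≟ᶠ q) ⟧)

    collisionsWith≡0 : ∀ p qs → collisionsWith p qs ≡ 0 → All (p ≢_) qs
    collisionsWith≡0 p []       _ = []
    collisionsWith≡0 p (q ∷ qs) e with p ≟ᶠ q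
    ... | no ne = ne ∷ collisionsWith≡0 p qs e

    unique-or-collision : ∀ p (ps : List (Fin w)) →
      ⟦ does (unique? ps) ⟧ ≤ ⟦ does (unique? (p ∷ ps)) ⟧ + collisionsWith p ps
    unique-or-collision p ps with unique? ps
    ... | no ne = z≤n
    ... | yes u = go (collisionsWith p ps) refl
      where
      go : ∀ c → collisionsWith p ps ≡ c → 1 ≤ ⟦ does (All.all? (λ q → ¬? (p ≟ᶠ q)) ps) ∧ true ⟧ +
        collisionsWith p ps
      go (suc c) eq = ≤-trans (≤-trans (s≤s z≤n) (≤-reflexive (sym eq))) (m≤n+m (collisionsWith p ps) _)
      go zero    eq rewrite dec-true (All.all? (λ q → ¬? (p ≟ᶠ q)) ps) (collisionsWith≡0 p ps eq) = s≤s z≤n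

  -- Union bound over the pairs. The crude count `l * l` of pairs suffices, and
  -- `l + l * l ≤ (l + 1) * (l + 1)` closes the induction.
  hash-injective : ∀ (ps : List (Vec (Fin D) dim × ℕ)) → AllPairs Separated ps →
    E * E ^ dim ≤ E * ∑ (vecs (allFin E) dim) (λ x → ⟦ does (unique? (map (hash x) ps)) ⟧) + length ps *
      length ps * E ^ dim
  hash-injective {dim} [] [] = ≤-trans
    (≤-reflexive (cong (E *_) (sym (trans (∑-tuples-const E dim 1) (*-identityʳ _))))) (m≤m+n _ 0)
  hash-injective {dim} (p ∷ ps) (sp ∷ sps) = begin
    E * E ^ dim ≤⟨ hash-injective ps sps ⟩
    E * ∑ xs U + l * l * E ^ dim
      ≤⟨ +-monoˡ-≤ (l * l * E ^ dim)
        (*-monoʳ-≤ E (≤-trans (∑-mono xs (λ x → unique-or-collision (hash x p) (map (hash x) ps)))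
        (≤-reflexive (∑-+ xs U′ C)))) ⟩
    E * (∑ xs U′ + ∑ xs C) + l * l * E ^ dim
      ≡⟨ cong (_+ l * l * E ^ dim) (*-distribˡ-+ E (∑ xs U′) (∑ xs C)) ⟩
    E * ∑ xs U′ + E * ∑ xs C + l * l * E ^ dim
      ≤⟨ +-monoˡ-≤ (l * l * E ^ dim) (+-monoʳ-≤ (E * ∑ xs U′) (bound ps sp)) ⟩
    E * ∑ xs U′ + l * E ^ dim + l * l * E ^ dim
      ≤⟨ ≤-trans (m≤m+n _ (suc l * E ^ dim)) (≤-reflexive (e (E * ∑ xs U′) l (E ^ dim))) ⟩
    E * ∑ xs U′ + suc l * suc l * E ^ dim ∎
    where
    open ≤-Reasoning
    xs = vecs (allFin E) dim
    l  = length ps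
    U  = λ x → ⟦ does (unique? (map (hash x) ps)) ⟧
    U′ = λ x → ⟦ does (unique? (map (hash x) (p ∷ ps))) ⟧
    C  = λ x → collisionsWith (hash x p) (map (hash x) ps)
    e : ∀ u l b → u + l * b + l * l * b + suc l * b ≡ u + suc l * suc l * b
    e = solve-∀
    bound : ∀ qs → All (Separated p) qs → E * ∑ xs (λ x → collisionsWith (hash x p) (map (hash x) qs)) ≤
      length qs * E ^ dim
    bound []       []         = ≤-reflexive (trans (cong (E *_) (∑-zero xs)) (*-zeroʳ E))
    bound (q ∷ qs) (sq ∷ sqs) = begin
      E * ∑ xs (λ x → ⟦ does (hash x p ≟ᶠ hash x q) ⟧ + collisionsWith (hash x p) (map (hash x) qs))
        ≡⟨ trans (cong (E *_) (∑-+ xs _ _)) (*-distribˡ-+ E (∑ xs (λ x → ⟦ does (hash x p ≟ᶠ hash x q) ⟧)) _)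
          ⟩
      E * ∑ xs (λ x → ⟦ does (hash x p ≟ᶠ hash x q) ⟧) + E * ∑ xs
        (λ x → collisionsWith (hash x p) (map (hash x) qs))
        ≤⟨ +-mono-≤ (pair-collisions p q sq) (bound qs sqs) ⟩
      E ^ dim + length qs * E ^ dim ∎

-- Pigeonhole

-- For each test the majority answer is kept, which at most halves the set. Afterwards all tests are
-- constant on `P`, so a single representative answers for every member.
pigeonhole : ∀ (ys : List A) (ts : List (A → Bool)) (G : A → Bool) → ∃ λ (P : A → Bool) →
  (∀ y → P y ≡ true → G y ≡ true) ×
  (∀ y y′ → P y ≡ true → P y′ ≡ true → ∀ {t} → t ∈ ts → t y ≡ t y′) ×
  ∑ ys (⟦_⟧ ∘ G) ≤ 2 ^ length ts * ∑ ys (⟦_⟧ ∘ P)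
pigeonhole ys []       G = G , (λ _ → id) , (λ _ _ _ _ ()) , ≤-reflexive (sym (*-identityˡ _))
pigeonhole {A} ys (t ∷ ts) G = choose (≤-total (count G₀) (count G₁))
  where
  count : (A → Bool) → ℕ
  count P = ∑ ys (⟦_⟧ ∘ P)
  G₀ G₁ : A → Bool
  G₀ y = G y ∧ not (t y)
  G₁ y = G y ∧ t y
  split : count G ≡ count G₀ + count G₁
  split = trans (∑-cong ys (λ y → s (G y) (t y))) (∑-+ ys (⟦_⟧ ∘ G₀) (⟦_⟧ ∘ G₁))
    where
    s : ∀ a b → ⟦ a ⟧ ≡ ⟦ a ∧ not b ⟧ + ⟦ a ∧ b ⟧
    s true  true  = refl
    s true  false = refl
    s false _     = refl
  Result = ∃ λ (P : A → Bool) →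
    (∀ y → P y ≡ true → G y ≡ true) ×
    (∀ y y′ → P y ≡ true → P y′ ≡ true → ∀ {u} → u ∈ t ∷ ts → u y ≡ u y′) ×
    count G ≤ 2 * 2 ^ length ts * count P
  finish : ∀ (b : Bool) (G′ : A → Bool) → (∀ y → G′ y ≡ true → G y ≡ true × t y ≡ b) → count G ≤ 2 * count G′
    → Result
  finish b G′ sound half with pigeonhole ys ts G′
  ... | P , P⇒G′ , const , bound = P , (λ y → proj₁ ∘ sound y ∘ P⇒G′ y) ,
    (λ { y y′ p p′ (here refl) → trans (proj₂ (sound y (P⇒G′ y p))) (sym (proj₂ (sound y′ (P⇒G′ y′ p′))))
       ; y y′ p p′ (there u∈) → const y y′ p p′ u∈ }) ,
    ≤-trans half (≤-trans (*-monoʳ-≤ 2 bound) (≤-reflexive (sym (*-assoc 2 (2 ^ length ts) (count P)))))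
  double : ∀ {a b} → a ≤ b → a + b ≤ 2 * b
  double {a} {b} a≤b = ≤-trans (+-monoˡ-≤ b a≤b) (≤-reflexive (cong (b +_) (sym (+-identityʳ b))))
  not-true : ∀ {b} → not b ≡ true → b ≡ false
  not-true {false} _ = refl
  choose : count G₀ ≤ count G₁ ⊎ count G₁ ≤ count G₀ → Result
  choose (inj₁ le) = finish true  G₁ (λ y → ∧-elim) (≤-trans (≤-reflexive split) (double le))
  choose (inj₂ le) = finish false G₀ (λ y h → proj₁ (∧-elim h) , not-true (proj₂ (∧-elim {G y} h)))
    (≤-trans (≤-reflexive (trans split (+-comm (count G₀) _))) (double le))

-- Erdős's theorem on complete multipartite subgraphs

lookup-injective : ∀ {xs : List A} → Unique xs → ∀ i j → lookup xs i ≡ lookup xs j → i ≡ j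
lookup-injective (x∉ ∷ u) zero    zero    e = refl
lookup-injective {xs = x ∷ xs} (x∉ ∷ u) zero    (suc j) e = ⊥-elim (All.lookup x∉ (∈-lookup j) e)
lookup-injective {xs = x ∷ xs} (x∉ ∷ u) (suc i) zero    e = ⊥-elim (All.lookup x∉ (∈-lookup i) (sym e))
lookup-injective (x∉ ∷ u) (suc i) (suc j) e = cong suc (lookup-injective u i j e)

∑-*-≤ : ∀ (xs : List A) c {f g : A → ℕ} → (∀ x → c * f x ≤ g x) → c * ∑ xs f ≤ ∑ xs g
∑-*-≤ xs c h = ≤-trans (≤-reflexive (sym (∑-*ˡ xs c _))) (∑-mono xs h)

≤-indicator : ∀ {X : Set} (d : Dec X) {a b c} → a ≤ c → (¬ X → a ≤ b) → a ≤ b + c * ⟦ does d ⟧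
≤-indicator (yes _) {b = b} {c} a≤c _ = ≤-trans a≤c (≤-trans (≤-reflexive (sym (*-identityʳ c))) (m≤n+m _ b))
≤-indicator (no ¬x) {b = b} _ a≤b = ≤-trans (a≤b ¬x) (m≤m+n b _)

-- Each part is an `n`-set, but the record does not ask that different parts be disjoint: `P` on all
-- transversals is the only relation between coordinates.
record Box (n : ℕ) {M m : ℕ} (P : Vec (Fin M) m → Bool) : Set where
  field
    part      : Fin m → Fin n → Fin M
    injective : ∀ i → Injective _≡_ _≡_ (part i)
    homogeneous : ∀ (t : Fin m → Fin n) → P (Vec.tabulate λ i → part i (t i)) ≡ true

-- A share `1 / (2 K)` of the vertices is heavy, so `2 K (4 K n)` vertices supply the `4 K n` that
-- one step uses. In the step the density `1 / K` drops by the factor 4 for rich tuples and by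
-- `2 ^ (4 K n)` for the pigeonhole.
boxSize : ℕ → ℕ → ℕ → ℕ
boxSize zero    n K = 0
boxSize (suc m) n K = suc (2 * K * (4 * K * n)) + boxSize m n (4 * K * 2 ^ (4 * K * n))

module Step (m n K : ℕ) .⦃ _ : NonZero n ⦄ .⦃ _ : NonZero K ⦄ (M : ℕ) .⦃ _ : NonZero M ⦄
  (P : Vec (Fin M) (suc m) → Bool) where

  open ≤-Reasoning
  Y : ℕ
  Y = M ^ m
  ys : List (Vec (Fin M) m)
  ys = vecs (allFin M) m
  instance
    Y≢0 : NonZero Y
    Y≢0 = m^n≢0 M m

  D : Fin M → ℕ
  D x = ∑ ys (λ y → ⟦ P (x ∷ y) ⟧)

  -- Light vertices carry at most half of the guaranteed `M Y / K` tuples, and a heavy one at most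
  -- `Y`, so at least `M / (2 K)` vertices are heavy.
  heavyVertices : ∀ a → 2 * K * a ≤ M → M * Y ≤ K * ∑ (vecs (allFin M) (suc m)) (⟦_⟧ ∘ P) →
    ∃ λ xs → length xs ≡ a × Unique xs × All (λ x → Y ≤ 2 * K * D x) xs
  heavyVertices a large dense = take a heavies ,
    trans (length-take a heavies) (m≤n⇒m⊓n≡m (*-cancelˡ-≤ (2 * K) ⦃ m*n≢0 2 K ⦄ (≤-trans large M≤))) ,
    Unique.take⁺ a (Unique.filter⁺ heavy? (Unique.allFin⁺ M)) ,
    All.take⁺ a (All.tabulate (λ x∈ → proj₂ (∈-filter⁻ heavy? {xs = allFin M} x∈)))
    where
    heavy? : ∀ x → Dec (Y ≤ 2 * K * D x)
    heavy? x = Y ≤? 2 * K * D x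
    heavies = filter heavy? (allFin M)
    H = length heavies
    D≤Y : ∀ x → D x ≤ Y
    D≤Y x = ≤-trans (∑-mono ys (λ y → ⟦⟧≤1 (P (x ∷ y))))
      (≤-reflexive (trans (∑-tuples-const M m 1) (*-identityʳ Y)))
    D-split : ∀ x → 2 * K * D x ≤ Y + 2 * K * Y * ⟦ does (heavy? x) ⟧
    D-split x = ≤-indicator (heavy? x) (*-monoʳ-≤ (2 * K) (D≤Y x)) (λ lt → <⇒≤ (≰⇒> lt))
    e : ∀ K Y H → 2 * K * Y * H ≡ 2 * K * H * Y
    e = solve-∀
    M≤ : M ≤ 2 * K * H
    M≤ = *-cancelʳ-≤ M (2 * K * H) Y (+-cancelˡ-≤ (M * Y) _ _ (begin
      M * Y + M * Y                                      ≡⟨ cong (M * Y +_) (sym (+-identityʳ _)) ⟩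
      2 * (M * Y)                                        ≤⟨ *-monoʳ-≤ 2 dense ⟩
      2 * (K * ∑ (vecs (allFin M) (suc m)) (⟦_⟧ ∘ P))    ≡⟨ trans (sym (*-assoc 2 K _))
        (cong (2 * K *_) (∑-vecs-suc (allFin M) m _)) ⟩
      2 * K * ∑ (allFin M) D                             ≤⟨ ∑-*-≤ (allFin M) (2 * K) D-split ⟩
      ∑ (allFin M) (λ x → Y + 2 * K * Y * ⟦ does (heavy? x) ⟧)
        ≡⟨ trans (∑-+ (allFin M) (λ _ → Y) _) (cong₂ _+_ (∑-allFin-const M Y) (∑-*ˡ (allFin M) (2 * K * Y) _))
          ⟩
      M * Y + 2 * K * Y * ∑ (allFin M) (λ x → ⟦ does (heavy? x) ⟧)
        ≡⟨ cong (λ h → M * Y + 2 * K * Y * h) (sym (length-filter-∑ heavy? (allFin M))) ⟩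
      M * Y + 2 * K * Y * H                              ≡⟨ cong (M * Y +_) (e K Y H) ⟩
      M * Y + 2 * K * H * Y                              ∎))

  module _ (xs : List (Fin M)) (|xs| : length xs ≡ 4 * K * n) (xs-unique : Unique xs)
           (xs-heavy : All (λ x → Y ≤ 2 * K * D x) xs) where

    E : Vec (Fin M) m → ℕ
    E y = ∑ xs (λ x → ⟦ P (x ∷ y) ⟧)
    rich? : ∀ y → Dec (n ≤ E y)
    rich? y = n ≤? E y
    rich : Vec (Fin M) m → Bool
    rich y = does (rich? y)

    -- Double counting: a tuple extends on average to at least `2 n` of the `4 K n` heavy vertices.
    -- Tuples with fewer than `n` extensions account for at most half of this, so a share
    -- `1 / (4 K)` is rich.
    rich-dense : Y ≤ 4 * K * ∑ ys (⟦_⟧ ∘ rich)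
    rich-dense = *-cancelˡ-≤ (2 * K * n) ⦃ m*n≢0 (2 * K) n ⦃ m*n≢0 2 K ⦄ ⦄
      (+-cancelˡ-≤ (2 * K * (Y * n)) _ _ (begin
      2 * K * (Y * n) + 2 * K * n * Y          ≡⟨ e₁ K n Y ⟩
      4 * K * n * Y                            ≡⟨ cong (_* Y) (sym |xs|) ⟩
      a * Y                                    ≤⟨ sum-heavy xs-heavy ⟩
      2 * K * ∑ xs D                           ≡⟨ cong (2 * K *_) (∑-swap xs ys _) ⟩
      2 * K * ∑ ys E                           ≤⟨ *-monoʳ-≤ (2 * K) (∑-mono ys E-split) ⟩
      2 * K * ∑ ys (λ y → n + a * ⟦ rich y ⟧)
        ≡⟨ cong (2 * K *_) (trans (∑-+ ys _ _) (cong₂ _+_ (∑-tuples-const M m n) (∑-*ˡ ys a _))) ⟩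
      2 * K * (Y * n + a * C)                  ≡⟨ cong (λ t → 2 * K * (Y * n + t * C)) |xs| ⟩
      2 * K * (Y * n + 4 * K * n * C)          ≡⟨ e₂ K Y n C ⟩
      2 * K * (Y * n) + 2 * K * n * (4 * K * C) ∎))
      where
      a = length xs
      C = ∑ ys (⟦_⟧ ∘ rich)
      E-split : ∀ y → E y ≤ n + a * ⟦ rich y ⟧
      E-split y = ≤-indicator (rich? y) (count≤length xs (λ x → P (x ∷ y))) (λ lt → <⇒≤ (≰⇒> lt))
      sum-heavy : ∀ {xs} → All (λ x → Y ≤ 2 * K * D x) xs → length xs * Y ≤ 2 * K * ∑ xs D
      sum-heavy []       = z≤n
      sum-heavy {x ∷ xs} (h ∷ hs) = ≤-trans (+-mono-≤ h (sum-heavy hs))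
        (≤-reflexive (sym (*-distribˡ-+ (2 * K) (D x) (∑ xs D))))
      e₁ : ∀ K n Y → 2 * K * (Y * n) + 2 * K * n * Y ≡ 4 * K * n * Y
      e₁ = solve-∀
      e₂ : ∀ K Y n c → 2 * K * (Y * n + 4 * K * n * c) ≡ 2 * K * (Y * n) + 2 * K * n * (4 * K * c)
      e₂ = solve-∀

    tests : List (Vec (Fin M) m → Bool)
    tests = map (λ x y → P (x ∷ y)) xs

    -- The tests make all tuples of `P′` extend by the same members of `xs`, those of `y*`. Since
    -- `y*` is rich there are `n` of them, and they form the new part.
    extend : (P′ : Vec (Fin M) m → Bool) → (∀ y → P′ y ≡ true → rich y ≡ true) →
      (∀ y y′ → P′ y ≡ true → P′ y′ ≡ true → ∀ {t} → t ∈ tests → t y ≡ t y′) →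
      Box n P′ → Box n P
    extend P′ P′⇒rich P′-const Q = record { part = part ; injective = injective ; homogeneous = homogeneous }
      where
      module Q = Box Q
      zeroₙ : Fin n
      zeroₙ = fromℕ< (>-nonZero⁻¹ n)
      y* : Vec (Fin M) m
      y* = Vec.tabulate (λ i → Q.part i zeroₙ)
      Py* : P′ y* ≡ true
      Py* = Q.homogeneous (λ _ → zeroₙ)
      good? : ∀ x → Dec (P (x ∷ y*) ≡ true)
      good? x = P (x ∷ y*) ≟ᵇ true
      firsts = filter good? xs
      n≤firsts : n ≤ length firsts
      n≤firsts = ≤-trans (does⇒ (rich? y*) (P′⇒rich y* Py*))
        (≤-reflexive (trans (∑-cong xs (λ x → cong ⟦_⟧ (b (P (x ∷ y*))))) (sym (length-filter-∑ good? xs))))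
        where
        b : ∀ c → c ≡ does (c ≟ᵇ true)
        b true  = refl
        b false = refl
      part : Fin (suc m) → Fin n → Fin M
      part zero    t = lookup firsts (inject≤ t n≤firsts)
      part (suc i) t = Q.part i t
      injective : ∀ i → Injective _≡_ _≡_ (part i)
      injective zero    {s} {t} e = inject≤-injective n≤firsts n≤firsts s t
        (lookup-injective (Unique.filter⁺ good? xs-unique) _ _ e)
      injective (suc i) e = Q.injective i e
      homogeneous : ∀ (t : Fin (suc m) → Fin n) → P (Vec.tabulate λ i → part i (t i)) ≡ true
      homogeneous t with ∈-filter⁻ good? {xs = xs} (∈-lookup {xs = firsts} (inject≤ (t zero) n≤firsts))
      ... | x∈ , Px = trans (P′-const _ y* (Q.homogeneous (t ∘ suc)) Py* (∈-map⁺ (λ x y → P (x ∷ y)) x∈)) Px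

    step : (∀ P′ → Y ≤ 4 * K * 2 ^ (4 * K * n) * ∑ ys (⟦_⟧ ∘ P′) → Box n P′) → Box n P
    step rec with pigeonhole ys tests rich
    ... | P′ , P′⇒rich , P′-const , bound = extend P′ P′⇒rich P′-const (rec P′ (begin
      Y                                                  ≤⟨ rich-dense ⟩
      4 * K * ∑ ys (⟦_⟧ ∘ rich)                          ≤⟨ *-monoʳ-≤ (4 * K) bound ⟩
      4 * K * (2 ^ length tests * ∑ ys (⟦_⟧ ∘ P′))       ≡⟨ sym
        (*-assoc (4 * K) (2 ^ length tests) (∑ ys (⟦_⟧ ∘ P′))) ⟩
      4 * K * 2 ^ length tests * ∑ ys (⟦_⟧ ∘ P′)         ≡⟨ cong (λ l → 4 * K * 2 ^ l * ∑ ys (⟦_⟧ ∘ P′))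
        (trans (length-map _ xs) |xs|) ⟩
      4 * K * 2 ^ (4 * K * n) * ∑ ys (⟦_⟧ ∘ P′)          ∎))

box : ∀ m n K .⦃ _ : NonZero n ⦄ .⦃ _ : NonZero K ⦄ M → boxSize m n K ≤ M → (P : Vec (Fin M) m → Bool) →
      M ^ m ≤ K * ∑ (vecs (allFin M) m) (⟦_⟧ ∘ P) → Box n P
box zero n K M large P dense = record
  { part = λ (); injective = λ (); homogeneous = λ _ → ok (P []) dense }
  where
  ok : ∀ b → 1 ≤ K * (⟦ b ⟧ + 0) → b ≡ true
  ok true  _ = refl
  ok false h with () ← ≤-trans h (≤-reflexive (*-zeroʳ K))
box (suc m) n K M large P dense =
  let xs , |xs| , unique , heavy = Step.heavyVertices m n K M P (4 * K * n) (<⇒≤ large₁) dense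
  in Step.step m n K M P xs |xs| unique heavy
       (box m n (4 * K * 2 ^ (4 * K * n)) ⦃ it ⦄
         ⦃ m*n≢0 (4 * K) (2 ^ (4 * K * n)) ⦃ m*n≢0 4 K ⦄ ⦃ m^n≢0 2 (4 * K * n) ⦄ ⦄ M
         (m+n≤o⇒n≤o (suc (2 * K * (4 * K * n))) large))
  where
  large₁ : suc (2 * K * (4 * K * n)) ≤ M
  large₁ = m+n≤o⇒m≤o _ large
  instance
    M≢0 : NonZero M
    M≢0 = >-nonZero (<-≤-trans (s≤s z≤n) large₁)

-- Passing to large minimum degree

Symmetric : (List A → Bool) → Set
Symmetric W = ∀ {xs ys} → xs ↭ ys → W xs ≡ W ys

-- Tuples with repetitions are included, so that densities are taken relative to powers `m ^ j`.
edgeSum : ∀ {m} j → (List (Fin m) → Bool) → ℕ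
edgeSum {m} j W = ∑ (vecs (allFin m) j) (⟦_⟧ ∘ W ∘ toList)

degree : ∀ {m} j → (List (Fin m) → Bool) → Fin m → ℕ
degree j W v = edgeSum j (W ∘ (v ∷_))

edgeSum-suc : ∀ {m} j (W : List (Fin m) → Bool) → edgeSum (suc j) W ≡ ∑ (allFin m) (degree j W)
edgeSum-suc {m} j W = ∑-vecs-suc (allFin m) j _

∑-punchIn : ∀ m v (f : Fin (suc m) → ℕ) → ∑ (allFin (suc m)) f ≡ f v + ∑ (allFin m) (f ∘ punchIn v)
∑-punchIn m       zero    f = ∑-allFin-suc m f
∑-punchIn (suc m) (suc v) f =
  trans (∑-allFin-suc (suc m) f)
  (trans (cong (f zero +_) (∑-punchIn m v (f ∘ suc)))
  (trans (e (f zero) (f (suc v)) (∑ (allFin m) (f ∘ suc ∘ punchIn v)))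
    (cong (f (suc v) +_) (sym (∑-allFin-suc m (f ∘ punchIn (suc v)))))))
  where
  e : ∀ a b c → a + (b + c) ≡ b + (a + c)
  e = solve-∀

-- A tuple lost with `v` has `v` in one of its `suc j` positions, and by symmetry each position
-- accounts for `degree j W v` tuples. Repeated occurrences of `v` make this an overcount.
edgeSum-delete : ∀ {m} j (W : List (Fin (suc m)) → Bool) → Symmetric W → ∀ v →
  edgeSum (suc j) W ≤ edgeSum (suc j) (W ∘ map (punchIn v)) + suc j * degree j W v
edgeSum-delete {m} zero W sym-W v = ≤-reflexive
  (trans (edgeSum-suc 0 W) (trans (∑-punchIn m v (degree 0 W))
  (trans (+-comm (degree 0 W v) _)
    (cong₂ _+_ (sym (edgeSum-suc 0 (W ∘ map (punchIn v)))) (sym (+-identityʳ _))))))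
edgeSum-delete {m} (suc j) W sym-W v = begin
  edgeSum (suc (suc j)) W
    ≡⟨ trans (edgeSum-suc (suc j) W) (∑-punchIn m v (degree (suc j) W)) ⟩
  d + ∑ (allFin m) (λ x → edgeSum (suc j) (W ∘ (punchIn v x ∷_)))
    ≤⟨ +-monoʳ-≤ d (∑-mono (allFin m) (λ x → edgeSum-delete j (W ∘ (punchIn v x ∷_)) (sym-W ∘ ↭.prep _) v)) ⟩
  d + ∑ (allFin m)
    (λ x → edgeSum (suc j) (W ∘ map (punchIn v) ∘ (x ∷_)) + suc j * edgeSum j (W ∘ (punchIn v x ∷_) ∘ (v ∷_)))
    ≡⟨ cong (d +_) (trans (∑-+ (allFin m) _ _)
      (cong₂ _+_ (sym (edgeSum-suc (suc j) (W ∘ map (punchIn v)))) (∑-*ˡ (allFin m) (suc j) _))) ⟩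
  d + (e′ + suc j * ∑ (allFin m) (λ x → edgeSum j (W ∘ (punchIn v x ∷_) ∘ (v ∷_))))
    ≤⟨ +-monoʳ-≤ d (+-monoʳ-≤ e′ (*-monoʳ-≤ (suc j) le)) ⟩
  d + (e′ + suc j * d)
    ≡⟨ r d e′ (suc j * d) ⟩
  e′ + suc (suc j) * d ∎
  where
  open ≤-Reasoning
  d  = degree (suc j) W v
  e′ = edgeSum (suc (suc j)) (W ∘ map (punchIn v))
  r : ∀ a b c → a + (b + c) ≡ b + (a + c)
  r = solve-∀
  le : ∑ (allFin m) (λ x → edgeSum j (W ∘ (punchIn v x ∷_) ∘ (v ∷_))) ≤ d
  le = begin
    ∑ (allFin m) (λ x → edgeSum j (W ∘ (punchIn v x ∷_) ∘ (v ∷_)))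
      ≡⟨ ∑-cong (allFin m)
        (λ x → ∑-cong (vecs (allFin (suc m)) j) (λ u → cong ⟦_⟧ (sym-W (↭.swap _ _ ↭-refl)))) ⟩
    ∑ (allFin m) (λ x → degree j (W ∘ (v ∷_)) (punchIn v x))
      ≤⟨ m≤n+m _ (degree j (W ∘ (v ∷_)) v) ⟩
    degree j (W ∘ (v ∷_)) v + ∑ (allFin m) (λ x → degree j (W ∘ (v ∷_)) (punchIn v x))
      ≡⟨ sym (trans (edgeSum-suc j (W ∘ (v ∷_))) (∑-punchIn m v _)) ⟩
    d ∎

-- The first two terms of the binomial expansion of `(m + 1) ^ (j + 1)`.
bernoulli′ : ∀ j m → m ^ suc j + suc j * m ^ j ≤ suc m ^ suc j
bernoulli′ zero    m = ≤-reflexive (e m)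
  where
  e : ∀ m → m * 1 + 1 ≡ suc m * 1
  e = solve-∀
bernoulli′ (suc j) m = begin
  m * (m * m ^ j) + suc (suc j) * (m * m ^ j)                       ≡⟨ e j m (m ^ j) ⟩
  m * (m * m ^ j + suc j * m ^ j) + m * m ^ j                       ≤⟨ +-mono-≤ (*-monoʳ-≤ m (bernoulli′ j m))
    (^-monoˡ-≤ (suc j) (n≤1+n m)) ⟩
  m * suc m ^ suc j + suc m ^ suc j                                 ≡⟨ +-comm (m * suc m ^ suc j) _ ⟩
  suc m ^ suc (suc j) ∎
  where
  open ≤-Reasoning
  e : ∀ j m a → m * (m * a) + suc (suc j) * (m * a) ≡ m * (m * a + suc j * a) + m * a
  e = solve-∀

-- `X` is a reserve that survives all deletions and finally bounds `size` from below. The minimum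
-- degree is relative to `pred size`, since going from `m + 1` vertices to `m` lowers
-- `p m ^ (j + 1)` by at least `p (j + 1) m ^ j`.
record MinDegree (j p d X : ℕ) {m : ℕ} (W : List (Fin m) → Bool) : Set where
  field
    size      : ℕ
    size≤     : size ≤ m
    ι         : Fin size → Fin m
    injective : Injective _≡_ _≡_ ι
    dense     : p * size ^ suc j + X ≤ d * edgeSum (suc j) (W ∘ map ι)
    minDegree : ∀ v → p * pred size ^ j ≤ d * degree j (W ∘ map ι) v

-- Deleting a vertex of small degree does not decrease d e(W) ∸ p mʳ.
largeMinDegree : ∀ j p d X m (W : List (Fin m) → Bool) → Symmetric W →
  p * m ^ suc j + X ≤ d * edgeSum (suc j) W → MinDegree j p d X W
largeMinDegree j p d X zero W sym-W dense = record
  { size = 0 ; size≤ = z≤n ; ι = id ; injective = id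
  ; dense = ≤-trans dense (≤-reflexive (cong (d *_) (edgeSum-id {j = suc j} W))) ; minDegree = λ () }
  where
  edgeSum-id : ∀ {m j} (W : List (Fin m) → Bool) → edgeSum j W ≡ edgeSum j (W ∘ map id)
  edgeSum-id {m} {j} W = ∑-cong (vecs (allFin m) j) (λ u → cong (⟦_⟧ ∘ W) (sym (map-id (toList u))))
largeMinDegree j p d X (suc m) W sym-W dense with all? (λ v → p * m ^ j ≤? d * degree j W v)
... | yes h = record
  { size = suc m ; size≤ = ≤-refl ; ι = id ; injective = id
  ; dense = ≤-trans dense
    (≤-reflexive (cong (d *_)
    (∑-cong (vecs (allFin (suc m)) (suc j)) (λ u → cong (⟦_⟧ ∘ W) (sym (map-id (toList u)))))))
  ; minDegree = λ v → ≤-trans (h v)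
    (≤-reflexive (cong (d *_)
    (∑-cong (vecs (allFin (suc m)) j) (λ u → cong (⟦_⟧ ∘ W ∘ (v ∷_)) (sym (map-id (toList u))))))) }
... | no ¬h with ¬∀⟶∃¬ (suc m) _ (λ v → p * m ^ j ≤? d * degree j W v) ¬h
...   | v , low = record
  { size = R.size ; size≤ = m≤n⇒m≤1+n R.size≤ ; ι = punchIn v ∘ R.ι
  ; injective = λ e → R.injective (punchIn-injective v _ _ e)
  ; dense = ≤-trans R.dense
    (≤-reflexive (cong (d *_)
    (∑-cong (vecs (allFin R.size) (suc j)) (λ u → cong (⟦_⟧ ∘ W) (sym (map-∘ (toList u)))))))
  ; minDegree = λ x → ≤-trans (R.minDegree x)
    (≤-reflexive (cong (d *_)
    (∑-cong (vecs (allFin R.size) j)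
    (λ u → cong (⟦_⟧ ∘ W ∘ (punchIn v (R.ι x) ∷_)) (sym (map-∘ (toList u))))))) }
  where
  open ≤-Reasoning
  W′ = W ∘ map (punchIn v)
  dense′ : p * m ^ suc j + X ≤ d * edgeSum (suc j) W′
  dense′ = +-cancelʳ-≤ (p * (suc j * m ^ j)) _ _ (begin
    p * m ^ suc j + X + p * (suc j * m ^ j)          ≡⟨ e₁ p (m ^ suc j) X (suc j * m ^ j) ⟩
    p * (m ^ suc j + suc j * m ^ j) + X              ≤⟨ +-monoˡ-≤ X (*-monoʳ-≤ p (bernoulli′ j m)) ⟩
    p * suc m ^ suc j + X                            ≤⟨ dense ⟩
    d * edgeSum (suc j) W                            ≤⟨ *-monoʳ-≤ d (edgeSum-delete j W sym-W v) ⟩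
    d * (edgeSum (suc j) W′ + suc j * degree j W v)  ≡⟨ e₂ d (edgeSum (suc j) W′) (suc j) (degree j W v) ⟩
    d * edgeSum (suc j) W′ + suc j * (d * degree j W v) ≤⟨ +-monoʳ-≤ (d * edgeSum (suc j) W′)
      (*-monoʳ-≤ (suc j) (<⇒≤ (≰⇒> low))) ⟩
    d * edgeSum (suc j) W′ + suc j * (p * m ^ j)     ≡⟨ cong (d * edgeSum (suc j) W′ +_)
      (e₃ (suc j) p (m ^ j)) ⟩
    d * edgeSum (suc j) W′ + p * (suc j * m ^ j)     ∎)
    where
    e₁ : ∀ p a X b → p * a + X + p * b ≡ p * (a + b) + X
    e₁ = solve-∀
    e₂ : ∀ d a k b → d * (a + k * b) ≡ d * a + k * (d * b)
    e₂ = solve-∀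
    e₃ : ∀ k p a → k * (p * a) ≡ p * (k * a)
    e₃ = solve-∀
  module R = MinDegree (largeMinDegree j p d X m W′ (λ p → sym-W (↭-map⁺ (punchIn v) p)) dense′)

-- A dense graph with a large blow-up in H

∈-vecs : ∀ {xs : List A} → (∀ x → x ∈ xs) → ∀ {j} (v : Vec A j) → v ∈ vecs xs j
∈-vecs all []      = here refl
∈-vecs all (x ∷ v) = ∈-cartesianProductWith⁺ _∷_ (all x) (∈-vecs all v)

asVec : ∀ (xs : List A) {k} → length xs ≡ k → ∃ λ (v : Vec A k) → toList v ≡ xs
asVec xs refl = Vec.fromList xs , toList∘fromList xs

∑-lookup-uniqueᵛ : ∀ {k} M (I : Vec (Fin m) k) → Unique (toList I) → (F : List (Fin M) → ℕ) →
  M ^ k * ∑ (vecs (allFin M) m) (λ z → F (map (Vec.lookup z) (toList I))) ≡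
  M ^ m * ∑ (vecs (allFin M) k) (F ∘ toList)
∑-lookup-uniqueᵛ {m} {k} M I u F = go (toList I) u (length-toList I)
  where
  go : ∀ (L : List (Fin m)) → Unique L → ∀ {k} → length L ≡ k →
    M ^ k * ∑ (vecs (allFin M) m) (λ z → F (map (Vec.lookup z) L)) ≡ M ^ m * ∑ (vecs (allFin M) k)
      (F ∘ toList)
  go L u refl = subst
    (λ l → l ^ length L * ∑ (vecs (allFin M) m) (λ z → F (map (Vec.lookup z) L)) ≡ l ^ m * ∑
    (vecs (allFin M) (length L)) (F ∘ toList))
    (length-allFin M) (∑-lookup-unique (allFin M) L u F)

lookup-∈ : ∀ (z : Vec A m) i → Vec.lookup z i ∈ toList z
lookup-∈ (x ∷ z) zero    = here refl
lookup-∈ (x ∷ z) (suc i) = there (lookup-∈ z i)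

lookup-injectiveᵛ : ∀ (z : Vec A m) → Unique (toList z) → ∀ i j → Vec.lookup z i ≡ Vec.lookup z j → i ≡ j
lookup-injectiveᵛ (x ∷ z) (x∉ ∷ u) zero    zero    e = refl
lookup-injectiveᵛ (x ∷ z) (x∉ ∷ u) zero    (suc j) e = ⊥-elim (All.lookup x∉ (lookup-∈ z j) e)
lookup-injectiveᵛ (x ∷ z) (x∉ ∷ u) (suc i) zero    e = ⊥-elim (All.lookup x∉ (lookup-∈ z i) (sym e))
lookup-injectiveᵛ (x ∷ z) (x∉ ∷ u) (suc i) (suc j) e = cong suc (lookup-injectiveᵛ z u i j e)

≡true⇒T : ∀ {b} → b ≡ true → T b
≡true⇒T refl = tt

edgeOf : ∀ {r M} → Hypergraph r M → List (Fin M) → Bool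
edgeOf H us = edge H (setOf us)

edgeOf-unique : ∀ {r M} (H : Hypergraph r M) us → length us ≡ r → edgeOf H us ≡ true → Unique us
edgeOf-unique H us l e = ∣setOf∣⇒Unique us (trans (uniform H _ (≡true⇒T e)) (sym l))

edgeOf-symmetric : ∀ {r M} (H : Hypergraph r M) → Symmetric (edgeOf H)
edgeOf-symmetric H p = cong (edge H) (setOf-cong (∈-resp-↭ p) (∈-resp-↭ (↭-sym p)))

sizeEdges : ∀ {r M} → Hypergraph r M → ℕ
sizeEdges {r} {M} H = ∑ (subsetsOfSize M r) (⟦_⟧ ∘ edge H)

edgeSum-edgeOf : ∀ {r M} (H : Hypergraph r M) → r ! * sizeEdges H ≤ edgeSum r (edgeOf H)
edgeSum-edgeOf {r} {M} H = ≤-trans (≤-reflexive (sym (∑-subsetsOfSize M r (⟦_⟧ ∘ edge H))))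
  (∑-mono (vecs (allFin M) r)
    (λ R → ≤-trans (*-monoˡ-≤ _ (⟦⟧≤1 (injectiveIn ⊤ R))) (≤-reflexive (*-identityˡ _))))

edgeSum≤ : ∀ {m} j (W : List (Fin m) → Bool) → edgeSum j W ≤ m ^ j
edgeSum≤ {m} j W = ≤-trans (∑-mono (vecs (allFin m) j) (λ u → ⟦⟧≤1 (W (toList u))))
  (≤-reflexive (trans (∑-tuples-const m j 1) (*-identityʳ _)))

-- `ψ-injective` recovers the position and not the part: when every vertex is its own position, the
-- map into `H` is injective whatever the colours are. Of `size` only bounds are known in advance,
-- so later choices must serve all values up to `m`.
record BlowUp (j p d n mmin m : ℕ) {M : ℕ} (H : Hypergraph (suc j) M) : Set where
  field
    size        : ℕ
    mmin≤size   : mmin ≤ size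
    size≤       : size ≤ m
    W           : List (Fin size) → Bool
    symmetric   : Symmetric W
    minDegree   : ∀ v → p * size ^ j ≤ d * degree j W v
    ψ           : Fin size → Fin n → Fin M
    ψ-injective : ∀ {i i′ x x′} → ψ i x ≡ ψ i′ x′ → x ≡ x′
    W⇒edge      : ∀ (L : List (Fin size × Fin n)) → length L ≡ suc j →
                  W (map proj₁ L) ≡ true → edgeOf H (map (uncurry ψ) L) ≡ true

module Sampling {j M : ℕ} (H : Hypergraph (suc j) M) (m : ℕ) where
  open ≤-Reasoning
  r : ℕ
  r = suc j
  w : List (Fin M) → Bool
  w = edgeOf H
  zs : List (Vec (Fin M) m)
  zs = vecs (allFin M) m
  Is : List (Vec (Fin m) r)
  Is = vecs (allFin m) r
  e : Vec (Fin M) m → ℕ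
  e z = edgeSum r (w ∘ map (Vec.lookup z))

  -- For a repetition-free index tuple the sampled tuple is uniform, so its chance of being an edge
  -- is the density of `H`. The other index tuples are dropped, which leaves `fall m r`.
  average : fall m r * (M ^ m * edgeSum r w) ≤ M ^ r * ∑ zs e
  average = begin
    fall m r * (M ^ m * edgeSum r w)
      ≡⟨ cong (λ t → fall t r * (M ^ m * edgeSum r w)) (sym (∣⊤∣≡n m)) ⟩
    fall ∣ ⊤ {m} ∣ r * (M ^ m * edgeSum r w)
      ≡⟨ cong (_* (M ^ m * edgeSum r w)) (sym (∑-injectiveIn r (⊤ {m}))) ⟩
    ∑ Is (⟦_⟧ ∘ injectiveIn ⊤) * (M ^ m * edgeSum r w)
      ≡⟨ sym (∑-*ʳ Is (M ^ m * edgeSum r w) _) ⟩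
    ∑ Is (λ I → ⟦ injectiveIn ⊤ I ⟧ * (M ^ m * edgeSum r w))
      ≤⟨ ∑-mono Is point ⟩
    ∑ Is (λ I → M ^ r * ∑ zs (λ z → ⟦ w (map (Vec.lookup z) (toList I)) ⟧))
      ≡⟨ trans (∑-*ˡ Is (M ^ r) _) (cong (M ^ r *_) (∑-swap Is zs _)) ⟩
    M ^ r * ∑ zs e ∎
    where
    point : ∀ I → ⟦ injectiveIn ⊤ I ⟧ * (M ^ m * edgeSum r w) ≤ M ^ r * ∑ zs
      (λ z → ⟦ w (map (Vec.lookup z) (toList I)) ⟧)
    point I with injectiveIn ⊤ I in eq
    ... | false = z≤n
    ... | true  = ≤-reflexive
      (trans (*-identityˡ _) (sym (∑-lookup-uniqueᵛ M I (injectiveIn⇒Unique ⊤ I eq) (⟦_⟧ ∘ w))))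

  module _ (p d : ℕ) .⦃ _ : NonZero m ⦄ .⦃ _ : NonZero M ⦄
    (dense : (5 + p) * M ^ r ≤ suc d * edgeSum r w)
    (m-large : (4 + p) * m ^ r ≤ (5 + p) * (m ∸ r) ^ r)
    (M-large : d * M ^ m ≤ suc d * (M ∸ m) ^ m) where

    good? : ∀ z → Dec ((2 + p) * m ^ r ≤ suc d * e z)
    good? z = (2 + p) * m ^ r ≤? suc d * e z
    G : Vec (Fin M) m → Bool
    G z = injectiveIn ⊤ z ∧ does (good? z)

    average′ : (4 + p) * m ^ r * M ^ m ≤ suc d * ∑ zs e
    average′ = *-cancelˡ-≤ (M ^ r) ⦃ m^n≢0 M r ⦄ (begin
      M ^ r * ((4 + p) * m ^ r * M ^ m)           ≤⟨ *-monoʳ-≤ (M ^ r)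
        (*-monoˡ-≤ (M ^ m) (≤-trans m-large (*-monoʳ-≤ (5 + p) (^≤fall m r)))) ⟩
      M ^ r * ((5 + p) * fall m r * M ^ m)        ≡⟨ e₁ (M ^ r) (5 + p) (fall m r) (M ^ m) ⟩
      fall m r * (M ^ m * ((5 + p) * M ^ r))      ≤⟨ *-monoʳ-≤ (fall m r) (*-monoʳ-≤ (M ^ m) dense) ⟩
      fall m r * (M ^ m * (suc d * edgeSum r w))  ≡⟨ e₂ (fall m r) (M ^ m) (suc d) (edgeSum r w) ⟩
      suc d * (fall m r * (M ^ m * edgeSum r w))  ≤⟨ *-monoʳ-≤ (suc d) average ⟩
      suc d * (M ^ r * ∑ zs e)                    ≡⟨ e₃ (suc d) (M ^ r) (∑ zs e) ⟩
      M ^ r * (suc d * ∑ zs e)                    ∎)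
      where
      e₁ : ∀ a b c d → a * (b * c * d) ≡ c * (d * (b * a))
      e₁ = solve-∀
      e₂ : ∀ a b c d → a * (b * (c * d)) ≡ c * (a * (b * d))
      e₂ = solve-∀
      e₃ : ∀ a b c → a * (b * c) ≡ b * (a * c)
      e₃ = solve-∀

    nonInjective : ℕ
    nonInjective = ∑ zs (λ z → ⟦ not (injectiveIn ⊤ z) ⟧)

    -- At least `(M ∸ m) ^ m` samples are repetition-free, and `M-large` makes these all but a share
    -- `1 / (d + 1)`.
    nonInjective≤ : suc d * nonInjective ≤ M ^ m
    nonInjective≤ = +-cancelʳ-≤ (suc d * fall M m) _ _ (begin
      suc d * nonInjective + suc d * fall M m   ≡⟨ sym (*-distribˡ-+ (suc d) nonInjective (fall M m)) ⟩
      suc d * (nonInjective + fall M m)         ≡⟨ cong (suc d *_) total ⟩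
      suc d * M ^ m                             ≤⟨ +-monoʳ-≤ (M ^ m) M-large ⟩
      M ^ m + suc d * (M ∸ m) ^ m               ≤⟨ +-monoʳ-≤ (M ^ m) (*-monoʳ-≤ (suc d) (^≤fall M m)) ⟩
      M ^ m + suc d * fall M m                  ∎)
      where
      b : ∀ c → ⟦ not c ⟧ + ⟦ c ⟧ ≡ 1
      b true  = refl
      b false = refl
      total : nonInjective + fall M m ≡ M ^ m
      total = trans (cong (nonInjective +_)
        (trans (cong (λ t → fall t m) (sym (∣⊤∣≡n M))) (sym (∑-injectiveIn m (⊤ {M})))))
        (trans (sym (∑-+ zs _ _))
          (trans (∑-cong zs (λ z → b (injectiveIn ⊤ z))) (trans (∑-tuples-const M m 1) (*-identityʳ _))))

    -- The average of `suc d * e z` exceeds the threshold by two units of `m ^ r`. One pays for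
    -- samples with repeated entries; as `e z ≤ m ^ r`, the other forces a share `1 / (d + 1)` of
    -- good samples.
    G-dense : M ^ m ≤ suc d * ∑ zs (⟦_⟧ ∘ G)
    G-dense = *-cancelˡ-≤ (m ^ r) ⦃ m^n≢0 m r ⦄ (+-cancelˡ-≤ ((3 + p) * m ^ r * M ^ m) _ _ (begin
      (3 + p) * m ^ r * M ^ m + m ^ r * M ^ m    ≡⟨ e₁ p (m ^ r) (M ^ m) ⟩
      (4 + p) * m ^ r * M ^ m                    ≤⟨ average′ ⟩
      suc d * ∑ zs e                             ≤⟨ ∑-*-≤ zs (suc d) point ⟩
      ∑ zs (λ z → (2 + p) * m ^ r + (suc d * m ^ r * ⟦ G z ⟧ + suc d * m ^ r * ⟦ not (injectiveIn ⊤ z) ⟧))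
        ≡⟨ trans (∑-+ zs _ _)
          (cong₂ _+_ (∑-tuples-const M m _)
          (trans (∑-+ zs _ _) (cong₂ _+_ (∑-*ˡ zs (suc d * m ^ r) _) (∑-*ˡ zs (suc d * m ^ r) _)))) ⟩
      M ^ m * ((2 + p) * m ^ r) + (suc d * m ^ r * g + suc d * m ^ r * nonInjective)
        ≡⟨ e₂ (M ^ m) (2 + p) (m ^ r) (suc d) g nonInjective ⟩
      (2 + p) * m ^ r * M ^ m + m ^ r * (suc d * g) + m ^ r * (suc d * nonInjective)
        ≤⟨ +-monoʳ-≤ ((2 + p) * m ^ r * M ^ m + m ^ r * (suc d * g)) (*-monoʳ-≤ (m ^ r) nonInjective≤) ⟩
      (2 + p) * m ^ r * M ^ m + m ^ r * (suc d * g) + m ^ r * M ^ m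
        ≡⟨ e₃ p (m ^ r) (M ^ m) (suc d * g) ⟩
      (3 + p) * m ^ r * M ^ m + m ^ r * (suc d * g) ∎))
      where
      g = ∑ zs (⟦_⟧ ∘ G)
      e₁ : ∀ p a b → (3 + p) * a * b + a * b ≡ (4 + p) * a * b
      e₁ = solve-∀
      e₂ : ∀ a b c d g h → a * (b * c) + (d * c * g + d * c * h) ≡ b * c * a + c * (d * g) + c * (d * h)
      e₂ = solve-∀
      e₃ : ∀ p a b c → (2 + p) * a * b + a * c + a * b ≡ (3 + p) * a * b + a * c
      e₃ = solve-∀
      cases : ∀ {X : Set} (i : Bool) (dec : Dec X) {a b c} → a ≤ c → (¬ X → a ≤ b) →
        a ≤ b + (c * ⟦ i ∧ does dec ⟧ + c * ⟦ not i ⟧)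
      cases true  dec {b = b} {c} h k = ≤-trans (≤-indicator dec h k) (+-monoʳ-≤ b (m≤m+n _ _))
      cases false dec {b = b} {c} h k = ≤-trans h
        (≤-trans (≤-reflexive (sym (*-identityʳ c))) (≤-trans (m≤n+m _ (c * 0)) (m≤n+m _ b)))
      point : ∀ z → suc d * e z ≤ (2 + p) * m ^ r +
        (suc d * m ^ r * ⟦ G z ⟧ + suc d * m ^ r * ⟦ not (injectiveIn ⊤ z) ⟧)
      point z = cases (injectiveIn ⊤ z) (good? z) (*-monoʳ-≤ (suc d) (edgeSum≤ r (w ∘ map (Vec.lookup z))))
        (λ lt → <⇒≤ (≰⇒> lt))

    -- The answers describe the labelled graph spanned by the sample, so all samples kept by the
    -- pigeonhole span the same one, that of `z*` below.
    tests : List (Vec (Fin M) m → Bool)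
    tests = map (λ I z → w (map (Vec.lookup z) (toList I))) Is

    fromBox : ∀ n .⦃ _ : NonZero n ⦄ mmin → (∀ k → mmin ≤ k → p * k ^ j ≤ suc p * pred k ^ j) → suc d * mmin <
      m →
      (P : Vec (Fin M) m → Bool) → (∀ z → P z ≡ true → G z ≡ true) →
      (∀ z z′ → P z ≡ true → P z′ ≡ true → ∀ {t} → t ∈ tests → t z ≡ t z′) →
      Box n P → BlowUp j p (suc d) n mmin m H
    fromBox n mmin shrink mmin<m P P⇒G P-const Q = record
      { size = size ; mmin≤size = ≮⇒≥ too-small ; size≤ = size≤ ; W = W
      ; symmetric = λ p → W*-symmetric (↭-map⁺ ι p)
      ; minDegree = λ v → ≤-trans (shrink size (≮⇒≥ too-small)) (minDegree v)
      ; ψ = λ i → part (ι i) ; ψ-injective = λ {i} {i′} → ψ-inj i i′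
      ; W⇒edge = W⇒edge
      }
      where
      open Box Q renaming (injective to part-injective)
      zeroₙ : Fin n
      zeroₙ = fromℕ< (>-nonZero⁻¹ n)
      z* : Vec (Fin M) m
      z* = Vec.tabulate (λ i → part i zeroₙ)
      Pz* : P z* ≡ true
      Pz* = homogeneous (λ _ → zeroₙ)
      W* : List (Fin m) → Bool
      W* = w ∘ map (Vec.lookup z*)
      W*-symmetric : Symmetric W*
      W*-symmetric p = edgeOf-symmetric H (↭-map⁺ (Vec.lookup z*) p)
      ez* : (2 + p) * m ^ r ≤ suc d * e z*
      ez* = does⇒ (good? z*) (proj₂ (∧-elim {injectiveIn ⊤ z*} (P⇒G z* Pz*)))
      R : MinDegree j (suc p) (suc d) (m ^ r) W*
      R = largeMinDegree j (suc p) (suc d) (m ^ r) m W* W*-symmetric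
        (≤-trans (≤-reflexive (+-comm (suc p * m ^ r) (m ^ r))) ez*)
      open MinDegree R
      W : List (Fin size) → Bool
      W = W* ∘ map ι
      -- The deletions preserve the reserve `m ^ r`, but `size` vertices provide at most
      -- `suc d * size ^ r`, which is below `m ^ r` when `size < mmin`, as `suc d * mmin < m`.
      too-small : ¬ size < mmin
      too-small lt = <-irrefl refl (begin-strict
        m ^ r                              ≤⟨ m≤n+m (m ^ r) (suc p * size ^ r) ⟩
        suc p * size ^ r + m ^ r           ≤⟨ dense′ ⟩
        suc d * edgeSum r W                ≤⟨ *-monoʳ-≤ (suc d) (edgeSum≤ r W) ⟩
        suc d * size ^ r                   ≡⟨ sym (*-assoc (suc d) size (size ^ j)) ⟩
        suc d * size * size ^ j            ≤⟨ *-mono-≤ (*-monoʳ-≤ (suc d) (<⇒≤ lt)) (^-monoˡ-≤ j size≤) ⟩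
        suc d * mmin * m ^ j               <⟨ *-monoˡ-< (m ^ j) ⦃ m^n≢0 m j ⦄ mmin<m ⟩
        m * m ^ j                          ∎)
        where
        dense′ = MinDegree.dense R
      pick : List (Fin size × Fin n) → Fin m → Fin n
      pick []            i = zeroₙ
      pick ((v , x) ∷ L) i with ι v ≟ᶠ i
      ... | yes _ = x
      ... | no  _ = pick L i
      pick-∈ : ∀ L → Unique (map (ι ∘ proj₁) L) → ∀ {v x} → (v , x) ∈ L → pick L (ι v) ≡ x
      pick-∈ ((v , x) ∷ L) (v∉ ∷ u) {v′} v∈ with ι v ≟ᶠ ι v′ | v∈
      ... | yes _  | here refl = refl
      ... | yes eq | there v∈L = ⊥-elim (All.lookup v∉ (∈-map⁺ (ι ∘ proj₁) v∈L) eq)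
      ... | no ne  | here refl = ⊥-elim (ne refl)
      ... | no ne  | there v∈L = pick-∈ L u v∈L
      -- Being an edge of `W` forces the parts in `L` to be distinct, so `pick` extends `L` to a
      -- transversal of the box, with `zeroₙ` elsewhere. By the tests it spans the same graph as
      -- `z*`.
      W⇒edge : ∀ (L : List (Fin size × Fin n)) → length L ≡ r →
               W (map proj₁ L) ≡ true → edgeOf H (map (uncurry (λ i → part (ι i))) L) ≡ true
      W⇒edge L l h = trans (cong w (trans (map-cong-local {xs = L} (All.tabulate λ {x} → point x)) (map-∘ L)))
        (trans same (trans (cong (w ∘ map (Vec.lookup z*)) (map-∘ L)) h))
        where
        I = asVec (map (ι ∘ proj₁) L) (trans (length-map _ L) l)
        z : Vec (Fin M) m
        z = Vec.tabulate (λ i → part i (pick L i))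
        same : w (map (Vec.lookup z) (map (ι ∘ proj₁) L)) ≡ w (map (Vec.lookup z*) (map (ι ∘ proj₁) L))
        same = subst (λ I → w (map (Vec.lookup z) I) ≡ w (map (Vec.lookup z*) I)) (proj₂ I)
          (P-const z z* (homogeneous (pick L)) Pz*
            (∈-map⁺ (λ I z → w (map (Vec.lookup z) (toList I))) (∈-vecs ∈-allFin (proj₁ I))))
        unique : Unique (map (ι ∘ proj₁) L)
        unique = subst Unique (sym (map-∘ L))
          (Unique.map⁻ {f = Vec.lookup z*}
          (edgeOf-unique H _
          (trans (length-map _ (map ι (map proj₁ L)))
          (trans (length-map _ (map proj₁ L)) (trans (length-map _ L) l))) h))
        point : ∀ (x : Fin size × Fin n) → x ∈ L → part (ι (proj₁ x)) (proj₂ x) ≡ Vec.lookup z (ι (proj₁ x))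
        point (v , x) v∈ = trans (cong (part (ι v)) (sym (pick-∈ L unique v∈)))
          (sym (lookup∘tabulate _ (ι v)))
      -- For different parts some transversal passes through both `x` and `x′`. It satisfies `G`,
      -- hence has distinct entries, so the two images cannot coincide.
      ψ-inj : ∀ i i′ {x x′} → part (ι i) x ≡ part (ι i′) x′ → x ≡ x′
      ψ-inj i i′ {x} {x′} eq with ι i ≟ᶠ ι i′
      ... | yes ι≡ = part-injective (ι i′) (subst (λ k → part k x ≡ part (ι i′) x′) ι≡ eq)
      ... | no ι≢  = ⊥-elim
        (ι≢ (lookup-injectiveᵛ z (injectiveIn⇒Unique ⊤ z (proj₁ (∧-elim (P⇒G z (homogeneous t))))) (ι i)
        (ι i′)
                       (trans (lookup∘tabulate _ (ι i))
                         (trans at-i (trans eq (trans (sym at-i′) (sym (lookup∘tabulate _ (ι i′)))))))))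
        where
        t : Fin m → Fin n
        t k with k ≟ᶠ ι i
        ... | yes _ = x
        ... | no  _ = x′
        z : Vec (Fin M) m
        z = Vec.tabulate (λ k → part k (t k))
        at-i : part (ι i) (t (ι i)) ≡ part (ι i) x
        at-i with ι i ≟ᶠ ι i
        ... | yes _ = refl
        ... | no ne = ⊥-elim (ne refl)
        at-i′ : part (ι i′) (t (ι i′)) ≡ part (ι i′) x′
        at-i′ with ι i′ ≟ᶠ ι i
        ... | yes e = ⊥-elim (ι≢ (sym e))
        ... | no _  = refl

    sample : ∀ n .⦃ _ : NonZero n ⦄ mmin → (∀ k → mmin ≤ k → p * k ^ j ≤ suc p * pred k ^ j) → suc d * mmin <
      m →
      boxSize m n (suc d * 2 ^ m ^ r) ≤ M → BlowUp j p (suc d) n mmin m H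
    sample n mmin shrink mmin<m large with pigeonhole zs tests G
    ... | P , P⇒G , P-const , bound = fromBox n mmin shrink mmin<m P P⇒G P-const
      (box m n (suc d * 2 ^ m ^ r) ⦃ it ⦄ ⦃ m*n≢0 (suc d) (2 ^ m ^ r) ⦃ it ⦄ ⦃ m^n≢0 2 (m ^ r) ⦄ ⦄ M large P
        (begin
        M ^ m                                         ≤⟨ G-dense ⟩
        suc d * ∑ zs (⟦_⟧ ∘ G)                        ≤⟨ *-monoʳ-≤ (suc d) bound ⟩
        suc d * (2 ^ length tests * ∑ zs (⟦_⟧ ∘ P))   ≡⟨ sym
          (*-assoc (suc d) (2 ^ length tests) (∑ zs (⟦_⟧ ∘ P))) ⟩
        suc d * 2 ^ length tests * ∑ zs (⟦_⟧ ∘ P)     ≡⟨ cong (λ l → suc d * 2 ^ l * ∑ zs (⟦_⟧ ∘ P)) |tests| ⟩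
        suc d * 2 ^ m ^ r * ∑ zs (⟦_⟧ ∘ P)            ∎))
      where
      |tests| : length tests ≡ m ^ r
      |tests| = trans (length-map _ Is) (trans (length-vecs (allFin m) r) (cong (_^ r) (length-allFin m)))

-- The colouring

∑-cartesianProduct : ∀ (xs : List A) (ys : List A′) (f : A × A′ → ℕ) →
  ∑ (cartesianProduct xs ys) f ≡ ∑ xs (λ x → ∑ ys (λ y → f (x , y)))
∑-cartesianProduct xs ys f = ∑-cartesianProductWith _,_ xs ys f

∑-zipWith-shift : ∀ {m} .⦃ _ : NonZero m ⦄ (κ : A → ℕ) (us : List A) (F : List (Fin m) → ℕ) →
  ∑ (vecs (allFin m) (length us)) (λ v → F (zipWith (λ u → shift (κ u)) us (toList v))) ≡
  ∑ (vecs (allFin m) (length us)) (F ∘ toList)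
∑-zipWith-shift κ []       F = refl
∑-zipWith-shift {m = m} κ (u ∷ us) F =
  trans (∑-vecs-suc (allFin m) (length us) _)
  (trans (∑-cong (allFin m) (λ x → ∑-zipWith-shift κ us (F ∘ (shift (κ u) x ∷_))))
  (trans (∑-shift m (κ u) (λ y → ∑ (vecs (allFin m) (length us)) (λ v → F (y ∷ toList v))))
         (sym (∑-vecs-suc (allFin m) (length us) _))))

map-zipWith : ∀ {A B C : Set} (f : A → B → C) (g : A → B) us → map (λ u → f u (g u)) us ≡ zipWith f us
  (map g us)
map-zipWith f g []       = refl
map-zipWith f g (u ∷ us) = cong (f u (g u) ∷_) (map-zipWith f g us)

finToFun-injective : ∀ {D} e (i j : Fin (D ^ e)) → (∀ x → finToFun i x ≡ finToFun j x) → i ≡ j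
finToFun-injective {D} e i j h = trans (sym (funToFin-finToFin {e} {D} i))
  (trans (fin-cong e (finToFun i) (finToFun j) h) (funToFin-finToFin {e} {D} j))
  where
  fin-cong : ∀ e (f g : Fin e → Fin D) → (∀ x → f x ≡ g x) → funToFin f ≡ funToFin g
  fin-cong zero    f g h = refl
  fin-cong (suc e) f g h = cong₂ combine (h zero) (fin-cong e (f ∘ suc) (g ∘ suc) (h ∘ suc))

Data : (m E e w : ℕ) → Set
Data m E e w = Vec (Fin E) e × Vec (Fin m) w × Fin m

allData : ∀ m E e w → List (Data m E e w)
allData m E e w = cartesianProduct (vecs (allFin E) e) (cartesianProduct (vecs (allFin m) w) (allFin m))

∑-allData : ∀ m E e w (f : Data m E e w → ℕ) →
  ∑ (allData m E e w) f ≡ ∑ (vecs (allFin E) e)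
    (λ x → ∑ (vecs (allFin m) w) (λ g → ∑ (allFin m) (λ s → f (x , g , s))))
∑-allData m E e w f = trans (∑-cartesianProduct (vecs (allFin E) e) _ f)
  (∑-cong (vecs (allFin E) e) (λ x → ∑-cartesianProduct (vecs (allFin m) w) (allFin m) _))

length-allData : ∀ m E e w → length (allData m E e w) ≡ E ^ e * (m ^ w * m)
length-allData m E e w = trans (length-as-∑ (allData m E e w)) (trans (∑-allData m E e w _)
  (trans (∑-cong (vecs (allFin E) e)
    (λ x → trans (∑-cong (vecs (allFin m) w) (λ g → trans (∑-allFin-const m 1) (*-identityʳ m)))
    (∑-tuples-const m w m)))
    (∑-tuples-const E e (m ^ w * m))))

module Colouring (m E D e w B : ℕ) .⦃ _ : NonZero m ⦄ .⦃ _ : NonZero E ⦄ .⦃ _ : NonZero w ⦄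
  (w-large : E * D ≤ w) (fits : B * length (allData m E e w) ≤ D ^ e) where

  -- The key of a vertex omits its offset: two vertices with the same key never share a slot, and the
  -- slot of a random vertex of a block is uniform.
  Y Q N : ℕ
  Y = length (allData m E e w)
  Q = Y * w
  N = B * Q

  Vertex : Set
  Vertex = Fin N

  block : Vertex → Fin B
  block u = proj₁ (remQuot Q u)

  index : Vertex → Fin Y
  index u = proj₁ (remQuot w (proj₂ (remQuot {B} Q u)))

  offset : Vertex → Fin w
  offset u = proj₂ (remQuot {Y} w (proj₂ (remQuot {B} Q u)))

  vertex : Fin B → Fin Y → Fin w → Vertex
  vertex b y c = combine b (combine y c)

  block-combine : ∀ b x → block (combine b x) ≡ b
  block-combine b x = cong proj₁ (remQuot-combine b x)
  index-vertex : ∀ b y c → index (vertex b y c) ≡ y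
  index-vertex b y c = trans (cong (λ t → proj₁ (remQuot {Y} w (proj₂ t))) (remQuot-combine b (combine y c)))
    (cong proj₁ (remQuot-combine y c))
  offset-vertex : ∀ b y c → offset (vertex b y c) ≡ c
  offset-vertex b y c = trans (cong (λ t → proj₂ (remQuot {Y} w (proj₂ t))) (remQuot-combine b (combine y c)))
    (cong proj₂ (remQuot-combine y c))
  vertex-η : ∀ u → vertex (block u) (index u) (offset u) ≡ u
  vertex-η u = trans (cong (combine (block u)) (combine-remQuot {Y} w (proj₂ (remQuot {B} Q u))))
    (combine-remQuot {B} Q u)

  datum : Fin Y → Data m E e w
  datum = lookup (allData m E e w)
  coefficients : Vertex → Vec (Fin E) e
  coefficients u = proj₁ (datum (index u))
  table : Vertex → Vec (Fin m) w
  table u = proj₁ (proj₂ (datum (index u)))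
  start : Vertex → Fin m
  start u = proj₂ (proj₂ (datum (index u)))

  -- The `e` digits in base `D` of the pair of block and index; `fits` ensures that `e` digits
  -- suffice, so the key determines the pair.
  keyOf : Fin B → Fin Y → Vec (Fin D) e
  keyOf b y = Vec.tabulate (finToFun (inject≤ (combine b y) fits))
  key : Vertex → Vec (Fin D) e
  key u = keyOf (block u) (index u)

  lookup-keyOf : ∀ b y b′ y′ → keyOf b y ≡ keyOf b′ y′ → b ≡ b′ × y ≡ y′
  lookup-keyOf b y b′ y′ eq = combine-injective b y b′ y′
    (inject≤-injective fits fits (combine b y) (combine b′ y′)
    (finToFun-injective e _ _
      (λ x → trans (sym (lookup∘tabulate _ x))
      (trans (cong (λ v → Vec.lookup v x) eq) (lookup∘tabulate _ x)))))

  -- The contributions of `S` are summed, here and in `turn`, so that one member with random data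
  -- randomises the total whatever the others contribute.
  mix : List Vertex → Vec (Fin D) e → ℕ
  mix S k = ∑ S (λ s → dot (coefficients s) k)
  slot : List Vertex → Vertex → Fin w
  slot S u = (toℕ (offset u) + mix S (key u)) mod′ w
  turn : List Vertex → Fin w → ℕ
  turn S o = ∑ S (λ s → toℕ (Vec.lookup (table s) o))
  φ : List Vertex → Vertex → Fin m
  φ S u = shift (turn S (slot S u)) (start u)

  ∑-block : ∀ (f : Fin Q → ℕ) → ∑ (allFin Q) f ≡ ∑ (allFin Y) (λ y → ∑ (allFin w) (λ c → f (combine y c)))
  ∑-block = ∑-combine Y w

  ∑-datum : ∀ (f : Data m E e w → ℕ) → ∑ (allFin Y) (f ∘ datum) ≡ ∑ (allData m E e w) f
  ∑-datum = ∑-allFin-lookup (allData m E e w)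

  private
    Es : List (Vec (Fin E) e)
    Es = vecs (allFin E) e
    Gs : List (Vec (Fin m) w)
    Gs = vecs (allFin m) w

  -- The slot depends on the key, which depends on the index and thus on the start colour. Summing
  -- over the offset first makes the slot uniform for every key; only then is the start colour
  -- summed, and it runs through all colours.
  φ-balanced : ∀ S b (F : Fin m → ℕ) → m * ∑ (allFin Q) (λ x → F (φ S (combine b x))) ≡ Q * ∑ (allFin m) F
  φ-balanced S b F = trans (cong (m *_) eq)
    (trans (r m (E ^ e) (m ^ w) w (∑ (allFin m) F))
    (cong (λ y → y * w * ∑ (allFin m) F) (sym (length-allData m E e w))))
    where
    open ≡-Reasoning
    r : ∀ m x g w s → m * (x * (g * (w * s))) ≡ x * (g * m) * w * s
    r = solve-∀
    colour : ∀ y c → φ S (vertex b y c) ≡ shift (turn S (shift (mix S (keyOf b y)) c))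
      (proj₂ (proj₂ (datum y)))
    colour y c = cong₂ shift (cong (turn S) (trans
        (cong₂ (λ o k → (toℕ o + mix S k) mod′ w) (offset-vertex b y c)
          (cong₂ keyOf (block-combine b (combine y c)) (index-vertex b y c)))
        (cong (λ t → t mod′ w) (+-comm (toℕ c) (mix S (keyOf b y))))))
      (cong (λ y → proj₂ (proj₂ (datum y))) (index-vertex b y c))
    eq : ∑ (allFin Q) (λ x → F (φ S (combine b x))) ≡ E ^ e * (m ^ w * (w * ∑ (allFin m) F))
    eq = begin
      ∑ (allFin Q) (λ x → F (φ S (combine b x)))
        ≡⟨ ∑-block _ ⟩
      ∑ (allFin Y) (λ y → ∑ (allFin w) (λ c → F (φ S (vertex b y c))))
        ≡⟨ ∑-cong (allFin Y) (λ y → trans (∑-cong (allFin w) (λ c → cong F (colour y c)))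
             (∑-shift w (mix S (keyOf b y)) (λ o → F (shift (turn S o) (proj₂ (proj₂ (datum y))))))) ⟩
      ∑ (allFin Y) (λ y → ∑ (allFin w) (λ o → F (shift (turn S o) (proj₂ (proj₂ (datum y))))))
        ≡⟨ ∑-datum (λ t → ∑ (allFin w) (λ o → F (shift (turn S o) (proj₂ (proj₂ t))))) ⟩
      ∑ (allData m E e w) (λ t → ∑ (allFin w) (λ o → F (shift (turn S o) (proj₂ (proj₂ t)))))
        ≡⟨ ∑-allData m E e w _ ⟩
      ∑ Es (λ x → ∑ Gs (λ g → ∑ (allFin m) (λ s → ∑ (allFin w) (λ o → F (shift (turn S o) s)))))
        ≡⟨ ∑-cong Es (λ x → ∑-cong Gs (λ g → trans (∑-swap (allFin m) (allFin w) _)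
             (trans (∑-cong (allFin w) (λ o → ∑-shift m (turn S o) F)) (∑-allFin-const w _)))) ⟩
      ∑ Es (λ x → ∑ Gs (λ g → w * ∑ (allFin m) F))
        ≡⟨ trans (∑-cong Es (λ x → ∑-tuples-const m w _)) (∑-tuples-const E e _) ⟩
      E ^ e * (m ^ w * (w * ∑ (allFin m) F)) ∎

  module _ (S₁ S₂ : List Vertex) (us : List Vertex) (us-unique : Unique us) where

    point : Vertex → Vec (Fin D) e × ℕ
    point u = key u , toℕ (offset u) + (mix S₁ (key u) + mix S₂ (key u))

    points-separated : AllPairs (Separated E D w w-large) (map point us)
    points-separated = AllPairs.map⁺ (AllPairs.map (λ {u} {u′} → sep u u′) us-unique)
      where
      sep : ∀ u u′ → u ≢ u′ → Separated E D w w-large (point u) (point u′)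
      sep u u′ u≢u′ k≡k′ α≡α′ = u≢u′ (trans (sym (vertex-η u)) (trans
        (cong₂ (λ by c → vertex (proj₁ by) (proj₂ by) c) (cong₂ _,_ (proj₁ same) (proj₂ same)) c≡c′)
          (vertex-η u′)))
        where
        same = lookup-keyOf (block u) (index u) (block u′) (index u′) k≡k′
        c%≡ : toℕ (offset u) % w ≡ toℕ (offset u′) % w
        c%≡ = %-cancelʳ w (toℕ (offset u)) (toℕ (offset u′)) (mix S₁ (key u) + mix S₂ (key u))
          (trans α≡α′ (cong (λ k → (toℕ (offset u′) + (mix S₁ k + mix S₂ k)) % w) (sym k≡k′)))
        c≡c′ : offset u ≡ offset u′
        c≡c′ = toℕ-injective
          (trans (sym (m<n⇒m%n≡m (toℕ<n (offset u)))) (trans c%≡ (m<n⇒m%n≡m (toℕ<n (offset u′)))))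

    hashed : Vec (Fin E) e → Vertex → Fin w
    hashed x u = hash E D w w-large x (point u)

    twist : Vec (Fin E) e → Vertex → ℕ
    twist x u = turn S₁ (hashed x u) + turn S₂ (hashed x u) + toℕ (start u)

    -- Members of `S` act through coefficients and tables. The inserted coefficients determine the
    -- slot, the inserted table adds its entry there, and all the rest is collected in `twist`.
    φ-insert : ∀ b y c u → φ (S₁ ++ vertex b y c ∷ S₂) u ≡
      shift (twist (proj₁ (datum y)) u) (Vec.lookup (proj₁ (proj₂ (datum y))) (hashed (proj₁ (datum y)) u))
    φ-insert b y c u = trans (cong (λ o → shift (turn S o) (start u)) slot≡)
      (cong (λ t → t mod′ m)
        (trans (cong (_+ toℕ (start u)) (turn≡ o))
        (r₂ (turn S₁ o) (toℕ (Vec.lookup (proj₁ (proj₂ (datum y))) o)) (turn S₂ o) (toℕ (start u)))))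
      where
      S = S₁ ++ vertex b y c ∷ S₂
      o = hashed (proj₁ (datum y)) u
      r₁ : ∀ c a x b → c + (a + (x + b)) ≡ c + (a + b) + x
      r₁ = solve-∀
      r₂ : ∀ a g b s → a + (g + b) + s ≡ a + b + s + g
      r₂ = solve-∀
      turn≡ : ∀ o → turn S o ≡ turn S₁ o + (toℕ (Vec.lookup (proj₁ (proj₂ (datum y))) o) + turn S₂ o)
      turn≡ o = trans (∑-++ S₁ (vertex b y c ∷ S₂) _)
        (cong (λ z → turn S₁ o + (toℕ (Vec.lookup (proj₁ (proj₂ (datum z))) o) + turn S₂ o))
        (index-vertex b y c))
      slot≡ : slot S u ≡ o
      slot≡ = cong (λ t → t mod′ w) (trans (cong (toℕ (offset u) +_) (trans (∑-++ S₁ (vertex b y c ∷ S₂) _)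
        (cong (λ z → mix S₁ (key u) + (dot (proj₁ (datum z)) (key u) + mix S₂ (key u)))
          (index-vertex b y c))))
        (r₁ (toℕ (offset u)) (mix S₁ (key u)) (dot (proj₁ (datum y)) (key u)) (mix S₂ (key u))))

    module _ (p d : ℕ) (W : List (Fin m) → Bool) (j : ℕ) (|us| : length us ≡ suc j)
      (dense : (2 + p) * m ^ suc j ≤ d * edgeSum (suc j) W) (E-large : (2 + p) * (suc j * suc j) ≤ E) where

      private
        r : ℕ
        r = suc j
        value : Vec (Fin E) e → Vec (Fin m) w → ℕ
        value x g = ⟦ W (map (λ u → shift (twist x u) (Vec.lookup g (hashed x u))) us) ⟧
        good? : ∀ x → Dec (Unique (map (hash E D w w-large x) (map point us)))
        good? x = unique? (map (hash E D w w-large x) (map point us))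
        good : ℕ
        good = ∑ Es (λ x → ⟦ does (good? x) ⟧)
        total : ℕ
        total = ∑ Es (λ x → ∑ Gs (value x))

        -- At distinct slots the table entries are independent and uniform, and the cyclic shifts by
        -- `twist x`, which are fixed with `x`, preserve this. The colours thus form a uniform
        -- tuple.
        value-good : ∀ x → Unique (map (hash E D w w-large x) (map point us)) → (2 + p) * m ^ w ≤ d * ∑ Gs
          (value x)
        value-good x u = *-cancelˡ-≤ (m ^ r) ⦃ m^n≢0 m r ⦄ (begin
          m ^ r * ((2 + p) * m ^ w)        ≡⟨ e₁ (m ^ r) (2 + p) (m ^ w) ⟩
          m ^ w * ((2 + p) * m ^ r)        ≤⟨ *-monoʳ-≤ (m ^ w) dense ⟩
          m ^ w * (d * edgeSum r W)        ≡⟨ e₂ (m ^ w) d (edgeSum r W) ⟩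
          d * (m ^ w * edgeSum r W)        ≡⟨ cong (d *_) (sym eq) ⟩
          d * (m ^ r * ∑ Gs (value x))     ≡⟨ e₂ d (m ^ r) (∑ Gs (value x)) ⟩
          m ^ r * (d * ∑ Gs (value x))     ∎)
          where
          open ≤-Reasoning
          e₁ : ∀ a b c → a * (b * c) ≡ c * (b * a)
          e₁ = solve-∀
          e₂ : ∀ a b c → a * (b * c) ≡ b * (a * c)
          e₂ = solve-∀
          I : List (Fin w)
          I = map (hash E D w w-large x) (map point us)
          |I| : length I ≡ length us
          |I| = trans (length-map _ (map point us)) (length-map point us)
          F : List (Fin m) → ℕ
          F vs = ⟦ W (zipWith (λ u → shift (twist x u)) us vs) ⟧
          value≡ : ∀ g → value x g ≡ F (map (Vec.lookup g) I)
          value≡ g = cong (⟦_⟧ ∘ W)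
            (trans (map-zipWith (λ u → shift (twist x u)) (λ u → Vec.lookup g (hashed x u)) us)
            (cong (zipWith (λ u → shift (twist x u)) us) (trans (map-∘ us) (map-∘ (map point us)))))
          core : ∀ l k → l ≡ m → k ≡ length us →
            (u : l ^ length I * ∑ Gs (λ g → F (map (Vec.lookup g) I)) ≡ l ^ w * ∑ (vecs (allFin m) (length I))
            (F ∘ toList)) →
            m ^ k * ∑ Gs (λ g → F (map (Vec.lookup g) I)) ≡ m ^ w * ∑ (vecs (allFin m) (length us))
              (F ∘ toList)
          core l k refl refl u = subst
            (λ i → m ^ i * ∑ Gs (λ g → F (map (Vec.lookup g) I)) ≡ m ^ w * ∑ (vecs (allFin m) i)
            (F ∘ toList)) |I| u
          eq : m ^ r * ∑ Gs (value x) ≡ m ^ w * edgeSum r W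
          eq = trans (cong (m ^ r *_) (∑-cong Gs value≡))
            (trans (core (length (allFin m)) r (length-allFin m) (sym |us|)
              (∑-lookup-unique (allFin m) I u F))
            (cong (m ^ w *_)
              (trans (∑-zipWith-shift (twist x) us (⟦_⟧ ∘ W)) (cong (λ l → edgeSum l W) |us|))))

        total-large : (2 + p) * m ^ w * good ≤ d * total
        total-large = ≤-trans (≤-reflexive (sym (∑-*ˡ Es ((2 + p) * m ^ w) _)))
          (≤-trans (∑-mono Es point-wise) (≤-reflexive (∑-*ˡ Es d _)))
          where
          weigh : ∀ {X : Set} (dec : Dec X) {a b} → (X → a ≤ b) → a * ⟦ does dec ⟧ ≤ b
          weigh (yes x) {a} f = ≤-trans (≤-reflexive (*-identityʳ a)) (f x)
          weigh (no _)  {a} f = ≤-trans (≤-reflexive (*-zeroʳ a)) z≤n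
          point-wise : ∀ x → (2 + p) * m ^ w * ⟦ does (good? x) ⟧ ≤ d * ∑ Gs (value x)
          point-wise x = weigh (good? x) (value-good x)

        -- By `E-large` the union bound `r * r / E` for a collision is at most `1 / (2 + p)`, one
        -- unit of the numerator `2 + p`.
        good-many : (1 + p) * E ^ e ≤ (2 + p) * good
        good-many = *-cancelˡ-≤ E (+-cancelʳ-≤ (E * E ^ e) _ _ (begin
          E * ((1 + p) * E ^ e) + E * E ^ e                     ≡⟨ e₁ E p (E ^ e) ⟩
          (2 + p) * (E * E ^ e)                                 ≤⟨ *-monoʳ-≤ (2 + p)
            (hash-injective E D w w-large (map point us) points-separated) ⟩
          (2 + p) * (E * good + l * l * E ^ e)                  ≡⟨ cong
            (λ t → (2 + p) * (E * good + t * t * E ^ e)) (trans (length-map point us) |us|) ⟩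
          (2 + p) * (E * good + r * r * E ^ e)                  ≡⟨ e₂ (2 + p) E good (r * r) (E ^ e) ⟩
          E * ((2 + p) * good) + (2 + p) * (r * r) * E ^ e      ≤⟨ +-monoʳ-≤ (E * ((2 + p) * good))
            (*-monoˡ-≤ (E ^ e) E-large) ⟩
          E * ((2 + p) * good) + E * E ^ e                      ∎))
          where
          open ≤-Reasoning
          l = length (map point us)
          e₁ : ∀ E p a → E * ((1 + p) * a) + E * a ≡ (2 + p) * (E * a)
          e₁ = solve-∀
          e₂ : ∀ q E g r a → q * (E * g + r * a) ≡ E * (q * g) + q * r * a
          e₂ = solve-∀

      -- The sum runs over all data of the inserted vertex: most coefficients separate the slots of
      -- `us`, and then the table gives a uniform tuple of colours. The factor `m * w` counts its
      -- start colours and offsets.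
      φ-insert-dense : ∀ b → (1 + p) * Q ≤ d * ∑ (allFin Q)
        (λ x → ⟦ W (map (φ (S₁ ++ combine b x ∷ S₂)) us) ⟧)
      φ-insert-dense b = begin
        (1 + p) * Q                                     ≡⟨ cong (λ y → (1 + p) * (y * w))
          (length-allData m E e w) ⟩
        (1 + p) * (E ^ e * (m ^ w * m) * w)             ≡⟨ e₁ (1 + p) (E ^ e) (m ^ w) m w ⟩
        (1 + p) * E ^ e * (m ^ w * (m * w))             ≤⟨ *-monoˡ-≤ _ good-many ⟩
        (2 + p) * good * (m ^ w * (m * w))              ≡⟨ e₂ (2 + p) good (m ^ w) (m * w) ⟩
        (2 + p) * m ^ w * good * (m * w)                ≤⟨ *-monoˡ-≤ (m * w) total-large ⟩
        d * total * (m * w)                             ≡⟨ trans (*-assoc d total (m * w))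
          (cong (d *_) (sym eq)) ⟩
        d * ∑ (allFin Q) (λ x → ⟦ W (map (φ (S₁ ++ combine b x ∷ S₂)) us) ⟧) ∎
        where
        open ≤-Reasoning
        e₁ : ∀ q a b c d → q * (a * (b * c) * d) ≡ q * a * (b * (c * d))
        e₁ = solve-∀
        e₂ : ∀ q g a b → q * g * (a * b) ≡ q * a * g * b
        e₂ = solve-∀
        e₃ : ∀ t m w → w * (m * t) ≡ t * (m * w)
        e₃ = solve-∀
        eq : ∑ (allFin Q) (λ x → ⟦ W (map (φ (S₁ ++ combine b x ∷ S₂)) us) ⟧) ≡ total * (m * w)
        eq = trans (∑-block _)
          (trans (∑-cong (allFin Y)
            (λ y → trans (∑-cong (allFin w) (λ c → cong (⟦_⟧ ∘ W) (map-cong (φ-insert b y c) us)))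
                                                 (∑-allFin-const w
                                                   (value (proj₁ (datum y)) (proj₁ (proj₂ (datum y)))))))
          (trans (∑-datum (λ t → w * value (proj₁ t) (proj₁ (proj₂ t))))
          (trans (∑-*ˡ (allData m E e w) w _)
          (trans (cong (w *_) (trans (∑-allData m E e w _)
             (trans (∑-cong Es
               (λ x → trans (∑-cong Gs (λ g → ∑-allFin-const m (value x g))) (∑-*ˡ Gs m (value x))))
               (∑-*ˡ Es m _))))
           (e₃ total m w)))))

-- Ordered sets of vertices

elems : Subset n → List (Fin n)
elems []          = []
elems (true  ∷ s) = zero ∷ map suc (elems s)
elems (false ∷ s) = map suc (elems s)

∈⇒elems : ∀ (s : Subset n) {x} → Vec.lookup s x ≡ true → x ∈ elems s
∈⇒elems (true  ∷ s) {zero}  _ = here refl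
∈⇒elems (true  ∷ s) {suc x} h = there (∈-map⁺ suc (∈⇒elems s h))
∈⇒elems (false ∷ s) {suc x} h = ∈-map⁺ suc (∈⇒elems s h)

elems⇒∈ : ∀ (s : Subset n) {x} → x ∈ elems s → Vec.lookup s x ≡ true
elems⇒∈ (true ∷ s) (here refl) = refl
elems⇒∈ (true ∷ s) (there x∈) with ∈-map⁻ suc x∈
... | y , y∈ , refl = elems⇒∈ s y∈
elems⇒∈ (false ∷ s) x∈ with ∈-map⁻ suc x∈
... | y , y∈ , refl = elems⇒∈ s y∈

length-elems : ∀ (s : Subset n) → length (elems s) ≡ ∣ s ∣
length-elems []          = refl
length-elems (true  ∷ s) = cong suc (trans (length-map suc (elems s)) (length-elems s))
length-elems (false ∷ s) = trans (length-map suc (elems s)) (length-elems s)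

elems-sorted : ∀ (s : Subset n) → AllPairs Fin._<_ (elems s)
elems-sorted []          = []
elems-sorted (true  ∷ s) = All.map⁺ (All.tabulate (λ _ → s≤s z≤n)) ∷ AllPairs.map⁺
  (AllPairs.map s≤s (elems-sorted s))
elems-sorted (false ∷ s) = AllPairs.map⁺ (AllPairs.map s≤s (elems-sorted s))

sorted⇒Unique : ∀ {xs : List (Fin n)} → AllPairs Fin._<_ xs → Unique xs
sorted⇒Unique = AllPairs.map (λ x<y x≡y → Fin.<-irrefl x≡y x<y)

sorted-≡ : ∀ {xs ys : List (Fin n)} → AllPairs Fin._<_ xs → AllPairs Fin._<_ ys →
  (∀ {x} → x ∈ xs → x ∈ ys) → (∀ {x} → x ∈ ys → x ∈ xs) → xs ≡ ys
sorted-≡ []       []       f g = refl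
sorted-≡ []       (_ ∷ _)  f g with () ← g (here refl)
sorted-≡ (_ ∷ _)  []       f g with () ← f (here refl)
sorted-≡ {xs = x ∷ xs} {y ∷ ys} (x< ∷ sx) (y< ∷ sy) f g with Fin.<-cmp x y
... | tri< x<y _ _ = ⊥-elim (case (f (here refl)))
  where
  case : ¬ x ∈ y ∷ ys
  case (here refl) = Fin.<-irrefl refl x<y
  case (there x∈)  = Fin.<-asym x<y (All.lookup y< x∈)
... | tri> _ _ y<x = ⊥-elim (case (g (here refl)))
  where
  case : ¬ y ∈ x ∷ xs
  case (here refl) = Fin.<-irrefl refl y<x
  case (there y∈)  = Fin.<-asym y<x (All.lookup x< y∈)
... | tri≈ _ refl _ = cong (x ∷_)
  (sorted-≡ sx sy (λ z∈ → tail (All.lookup x< z∈) (f (there z∈)))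
  (λ z∈ → tail (All.lookup y< z∈) (g (there z∈))))
  where
  tail : ∀ {z zs} → x Fin.< z → z ∈ x ∷ zs → z ∈ zs
  tail x<z (here refl) = ⊥-elim (Fin.<-irrefl refl x<z)
  tail x<z (there z∈)  = z∈

Unique-resp-↭ : ∀ {xs ys : List A} → xs ↭ ys → Unique xs → Unique ys
Unique-resp-↭ p = ↭ₛ.Unique-resp-↭ (setoid _) (↭⇒↭ₛ p)

lefts : List (A ⊎ A′) → List A
lefts []            = []
lefts (inj₁ a ∷ xs) = a ∷ lefts xs
lefts (inj₂ _ ∷ xs) = lefts xs

rights : List (A ⊎ A′) → List A′
rights []            = []
rights (inj₁ _ ∷ xs) = rights xs
rights (inj₂ b ∷ xs) = b ∷ rights xs

↭-lefts-rights : ∀ (xs : List (A ⊎ A′)) → xs ↭ map inj₁ (lefts xs) ++ map inj₂ (rights xs)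
↭-lefts-rights []            = ↭-refl
↭-lefts-rights (inj₁ a ∷ xs) = ↭.prep (inj₁ a) (↭-lefts-rights xs)
↭-lefts-rights (inj₂ b ∷ xs) = ↭-trans (↭.prep (inj₂ b) (↭-lefts-rights xs))
  (↭-sym (↭-shift (inj₂ b) (map inj₁ (lefts xs)) (map inj₂ (rights xs))))

rights-↭ : ∀ {xs ys : List (A ⊎ A′)} → xs ↭ ys → rights xs ↭ rights ys
rights-↭ ↭.refl                        = ↭.refl
rights-↭ (↭.prep (inj₁ _) p)           = rights-↭ p
rights-↭ (↭.prep (inj₂ b) p)           = ↭.prep b (rights-↭ p)
rights-↭ (↭.swap (inj₁ _) (inj₁ _) p)  = rights-↭ p
rights-↭ (↭.swap (inj₁ _) (inj₂ b) p)  = ↭.prep b (rights-↭ p)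
rights-↭ (↭.swap (inj₂ b) (inj₁ _) p)  = ↭.prep b (rights-↭ p)
rights-↭ (↭.swap (inj₂ b) (inj₂ c) p)  = ↭.swap b c (rights-↭ p)
rights-↭ (↭.trans p q)                 = ↭.trans (rights-↭ p) (rights-↭ q)

rights-map-inj₁-++ : ∀ (as : List A) (xs : List (A ⊎ A′)) → rights (map inj₁ as ++ xs) ≡ rights xs
rights-map-inj₁-++ []       xs = refl
rights-map-inj₁-++ (a ∷ as) xs = rights-map-inj₁-++ as xs

rights-map-inj₂ : ∀ (bs : List A′) → rights {A = A} (map inj₂ bs) ≡ bs
rights-map-inj₂ []       = refl
rights-map-inj₂ (b ∷ bs) = cong (b ∷_) (rights-map-inj₂ bs)

findRight : ∀ (xs : List (A ⊎ A′)) →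
  (∃ λ as → xs ≡ map inj₁ as) ⊎ (∃ λ ys → ∃₂ λ b zs → xs ≡ ys ++ inj₂ b ∷ zs)
findRight []            = inj₁ ([] , refl)
findRight (inj₂ b ∷ xs) = inj₂ ([] , b , xs , refl)
findRight (inj₁ a ∷ xs) with findRight xs
... | inj₁ (as , refl)          = inj₁ (a ∷ as , refl)
... | inj₂ (ys , b , zs , refl) = inj₂ (inj₁ a ∷ ys , b , zs , refl)

∑-zipWith-combine : ∀ B Q j (f : Vec (Fin (B * Q)) j → ℕ) →
  ∑ (vecs (allFin (B * Q)) j) f ≡ ∑ (vecs (allFin B) j)
    (λ b → ∑ (vecs (allFin Q) j) (λ a → f (Vec.zipWith combine b a)))
∑-zipWith-combine B Q zero    f = cong (_+ 0) (sym (+-identityʳ (f [])))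
∑-zipWith-combine B Q (suc j) f = begin
  ∑ (vecs (allFin (B * Q)) (suc j)) f
    ≡⟨ trans (∑-vecs-suc (allFin (B * Q)) j f) (∑-combine B Q _) ⟩
  ∑ (allFin B) (λ β → ∑ (allFin Q) (λ x → ∑ (vecs (allFin (B * Q)) j) (λ R → f (combine β x ∷ R))))
    ≡⟨ ∑-cong (allFin B)
      (λ β → trans (∑-cong (allFin Q) (λ x → ∑-zipWith-combine B Q j (f ∘ (combine β x ∷_))))
      (∑-swap (allFin Q) (vecs (allFin B) j) _)) ⟩
  ∑ (allFin B) (λ β → ∑ (vecs (allFin B) j)
    (λ b → ∑ (allFin Q) (λ x → ∑ (vecs (allFin Q) j) (λ a → f (combine β x ∷ Vec.zipWith combine b a)))))
    ≡⟨ ∑-cong (allFin B) (λ β → ∑-cong (vecs (allFin B) j) (λ b → sym (∑-vecs-suc (allFin Q) j _))) ⟩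
  ∑ (allFin B) (λ β → ∑ (vecs (allFin B) j)
    (λ b → ∑ (vecs (allFin Q) (suc j)) (λ a → f (Vec.zipWith combine (β ∷ b) a))))
    ≡⟨ sym (∑-vecs-suc (allFin B) j _) ⟩
  ∑ (vecs (allFin B) (suc j)) (λ b → ∑ (vecs (allFin Q) (suc j)) (λ a → f (Vec.zipWith combine b a))) ∎
  where open ≡-Reasoning

∈-toList⁻ : ∀ {j} (v : Vec A j) {x} → x ∈ toList v → ∃ λ i → x ≡ Vec.lookup v i
∈-toList⁻ (y ∷ v) (here refl) = zero , refl
∈-toList⁻ (y ∷ v) (there x∈) with ∈-toList⁻ v x∈
... | i , e = suc i , e

Unique-toList : ∀ {j} (v : Vec A j) → (∀ i i′ → Vec.lookup v i ≡ Vec.lookup v i′ → i ≡ i′) → Unique (toList v)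
Unique-toList []      inj = []
Unique-toList (x ∷ v) inj = All.tabulate fresh ∷ Unique-toList v (λ i i′ e → Fin.suc-injective (inj _ _ e))
  where
  fresh : ∀ {y} → y ∈ toList v → x ≢ y
  fresh y∈ x≡y with ∈-toList⁻ v y∈
  ... | i , e with () ← inj zero (suc i) (trans x≡y e)

allPairs-map-All : ∀ {P : A → Set} {R S : A → A → Set} → (∀ {x y} → P x → P y → R x y → S x y) →
  ∀ {xs} → All P xs → AllPairs R xs → AllPairs S xs
allPairs-map-All f []       []       = []
allPairs-map-All f (p ∷ ps) (r ∷ rs) = All.zipWith (λ (q , s) → f p q s) (ps , r) ∷ allPairs-map-All f ps rs

combine-<⁻ : ∀ {B Q} {b b′ : Fin B} (x x′ : Fin Q) → b ≢ b′ → combine b x Fin.≤ combine b′ x′ → b Fin.< b′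
combine-<⁻ {b = b} {b′} x x′ b≢b′ le with Fin.<-cmp b b′
... | tri< lt _ _ = lt
... | tri≈ _ eq _ = ⊥-elim (b≢b′ eq)
... | tri> _ _ gt = ⊥-elim (<⇒≱ (combine-monoˡ-< x′ x gt) le)

∑-balancedᶠ : ∀ {Q m} j (ψ : Fin j → Fin Q → Fin m) →
  (∀ i (F : Fin m → ℕ) → m * ∑ (allFin Q) (F ∘ ψ i) ≡ Q * ∑ (allFin m) F) →
  (F : List (Fin m) → ℕ) →
  m ^ j * ∑ (vecs (allFin Q) j) (λ a → F (tabulate λ i → ψ i (Vec.lookup a i))) ≡
  Q ^ j * ∑ (vecs (allFin m) j) (F ∘ toList)
∑-balancedᶠ {Q} {m} j ψ bal F = go (length-allFin Q) (length-allFin m) (∑-balanced (allFin Q) (allFin m) j ψ)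
  where
  go : ∀ {q l} → q ≡ Q → l ≡ m →
    ((∀ i (F : Fin m → ℕ) → l * ∑ (allFin Q) (F ∘ ψ i) ≡ q * ∑ (allFin m) F) → (F : List (Fin m) → ℕ) →
      l ^ j * ∑ (vecs (allFin Q) j) (λ a → F (tabulate λ i → ψ i (Vec.lookup a i))) ≡ q ^ j * ∑
        (vecs (allFin m) j) (F ∘ toList)) →
    m ^ j * ∑ (vecs (allFin Q) j) (λ a → F (tabulate λ i → ψ i (Vec.lookup a i))) ≡ Q ^ j * ∑
      (vecs (allFin m) j) (F ∘ toList)
  go refl refl rec = rec bal F

-- The rooted graph and its degrees

module Construction (m E D e w B : ℕ) .⦃ m≢0 : NonZero m ⦄ .⦃ E≢0 : NonZero E ⦄ .⦃ w≢0 : NonZero w ⦄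
  (w-large : E * D ≤ w) (fits : B * length (allData m E e w) ≤ D ^ e)
  (h j : ℕ) (W : List (Fin m) → Bool) where

  open Colouring m E D e w B w-large fits public

  k : ℕ
  k = suc h + j

  coloured : List Vertex → Bool
  coloured L = W (map (φ (take h L)) (drop h L))

  G : Hypergraph k N
  edge    G s = does (∣ s ∣ ≟ k) ∧ coloured (elems s)
  uniform G s t with ∣ s ∣ ≟ k | does (∣ s ∣ ≟ k) in eq
  ... | yes p | _     = p
  ... | no  _ | false = ⊥-elim t
  ... | no ne | true  with () ← trans (sym eq) (dec-false (∣ s ∣ ≟ k) ne)

  instance
    Q≢0 : NonZero Q
    Q≢0 = m*n≢0 Y w ⦃ subst NonZero (sym (length-allData m E e w))
      (m*n≢0 (E ^ e) (m ^ w * m) ⦃ m^n≢0 E e ⦄ ⦃ m*n≢0 (m ^ w) m ⦃ m^n≢0 m w ⦄ ⦄) ⦄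

  module _ (symmetric : Symmetric W) (p d : ℕ) (minDegree : ∀ v → (2 + p) * m ^ j ≤ d * degree j W v)
    (E-large : (2 + p) * (suc j * suc j) ≤ E) (t : Subset N) (|t| : ∣ t ∣ ≡ suc h) where

    dense : (2 + p) * m ^ suc j ≤ d * edgeSum (suc j) W
    dense = begin
      (2 + p) * (m * m ^ j)              ≡⟨ r (2 + p) m (m ^ j) ⟩
      m * ((2 + p) * m ^ j)              ≡⟨ sym (∑-allFin-const m _) ⟩
      ∑ (allFin m) (λ _ → (2 + p) * m ^ j) ≤⟨ ∑-mono (allFin m) minDegree ⟩
      ∑ (allFin m) (λ v → d * degree j W v) ≡⟨ trans (∑-*ˡ (allFin m) d _)
        (cong (d *_) (sym (edgeSum-suc j W))) ⟩
      d * edgeSum (suc j) W              ∎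
      where
      open ≤-Reasoning
      r : ∀ a b c → a * (b * c) ≡ b * (a * c)
      r = solve-∀

    -- The vertices of an edge containing `t`, with the `j` random ones kept symbolic. Their order
    -- is settled by the blocks, so the edge is split into `lo` and `hi` before the positions are
    -- drawn.
    Slot : Set
    Slot = Vertex ⊎ Fin j

    slots : List Slot
    slots = map inj₁ (elems t) ++ map inj₂ (allFin j)

    module _ (b : Vec (Fin B) j) (b-injective : ∀ i i′ → Vec.lookup b i ≡ Vec.lookup b i′ → i ≡ i′)
      (b-fresh : ∀ i {u} → u ∈ elems t → Vec.lookup b i ≢ block u) where

      place : Vec (Fin Q) j → Slot → Vertex
      place a (inj₁ u) = u
      place a (inj₂ i) = combine (Vec.lookup b i) (Vec.lookup a i)

      Valid : Slot → Set
      Valid (inj₁ u) = u ∈ elems t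
      Valid (inj₂ _) = Unit

      -- Positions chosen in distinct blocks are ordered by the blocks alone.
      place-order : ∀ a a′ {x y} → Valid x → Valid y → x ≢ y × place a x Fin.≤ place a y → place a′ x Fin.<
        place a′ y
      place-order a a′ {inj₁ u} {inj₁ v} _ _ (x≢y , le) = Fin.≤∧≢⇒< le (x≢y ∘ cong inj₁)
      place-order a a′ {inj₁ u} {inj₂ i} u∈ _ (_ , le) =
        subst (Fin._< _) (Fin.combine-remQuot {B} Q u)
          (combine-monoˡ-< _ _
            (combine-<⁻ _ _ (b-fresh i u∈ ∘ sym) (subst (Fin._≤ _) (sym (Fin.combine-remQuot {B} Q u)) le)))
      place-order a a′ {inj₂ i} {inj₁ u} _ u∈ (_ , le) =
        subst (_ Fin.<_) (Fin.combine-remQuot {B} Q u)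
          (combine-monoˡ-< _ _
            (combine-<⁻ _ _ (b-fresh i u∈) (subst (_ Fin.≤_) (sym (Fin.combine-remQuot {B} Q u)) le)))
      place-order a a′ {inj₂ i} {inj₂ i′} _ _ (x≢y , le) =
        combine-monoˡ-< _ _ (combine-<⁻ _ _ (λ eq → x≢y (cong inj₂ (b-injective i i′ eq))) le)

      -- A default for sorting; by `place-order` all choices of positions give the same order.
      a₀ : Vec (Fin Q) j
      a₀ = Vec.replicate j (fromℕ< (>-nonZero⁻¹ Q))

      open Sort (On.decTotalOrder (Fin.≤-decTotalOrder N) (place a₀)) using (sort; sort-↭; sort-↗)

      σ : List Slot
      σ = sort slots
      σ↭slots : σ ↭ slots
      σ↭slots = sort-↭ slots

      slots-unique : Unique slots
      slots-unique = Unique.++⁺ (Unique.map⁺ inj₁-injective (sorted⇒Unique (elems-sorted t)))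
        (Unique.map⁺ inj₂-injective (Unique.allFin⁺ j)) disjoint
        where
        disjoint : ∀ {x} → ¬ (x ∈ map inj₁ (elems t) × x ∈ map inj₂ (allFin j))
        disjoint (x∈₁ , x∈₂) with ∈-map⁻ inj₁ x∈₁ | ∈-map⁻ inj₂ x∈₂
        ... | _ , _ , refl | _ , _ , ()

      σ-unique : Unique σ
      σ-unique = Unique-resp-↭ (↭-sym σ↭slots) slots-unique

      slots⇒Valid : ∀ {x} → x ∈ slots → Valid x
      slots⇒Valid {inj₂ _} _ = tt
      slots⇒Valid {inj₁ u} x∈ with ∈-++⁻ (map inj₁ (elems t)) x∈
      ... | inj₁ x∈₁ with ∈-map⁻ inj₁ x∈₁
      ...   | _ , u∈ , refl = u∈
      slots⇒Valid {inj₁ u} x∈ | inj₂ x∈₂ with ∈-map⁻ inj₂ x∈₂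
      ... | _ , _ , ()

      σ-sorted : ∀ a → AllPairs Fin._<_ (map (place a) σ)
      σ-sorted a = AllPairs.map⁺
        (allPairs-map-All (place-order a₀ a) (All.tabulate (slots⇒Valid ∘ ∈-resp-↭ σ↭slots))
        (AllPairs.zip (σ-unique , Linked.Linked⇒AllPairs Fin.≤-trans (sort-↗ slots))))

      |σ| : length σ ≡ k
      |σ| = trans (↭-length σ↭slots) (trans (length-++ (map inj₁ (elems t)))
        (cong₂ _+_ (trans (length-map inj₁ (elems t)) (trans (length-elems t) |t|))
          (trans (length-map inj₂ (allFin j)) (length-allFin j))))

      R : Vec (Fin Q) j → Vec Vertex j
      R a = Vec.zipWith combine b a

      lookup-R : ∀ a i → Vec.lookup (R a) i ≡ place a (inj₂ i)
      lookup-R a i = lookup-zipWith combine i b a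

      elems-R : ∀ a → elems (setOf (toList (R a)) ∪ t) ≡ map (place a) σ
      elems-R a = sorted-≡ (elems-sorted (setOf (toList (R a)) ∪ t)) (σ-sorted a) to from
        where
        lookup-∪ : ∀ x → Vec.lookup (setOf (toList (R a)) ∪ t) x ≡ Vec.lookup (setOf (toList (R a))) x ∨
          Vec.lookup t x
        lookup-∪ x = lookup-zipWith _∨_ x (setOf (toList (R a))) t
        ∨-elim : ∀ p q → p ∨ q ≡ true → p ≡ true ⊎ q ≡ true
        ∨-elim true  q h = inj₁ refl
        ∨-elim false q h = inj₂ h
        ∨-introʳ : ∀ p {q} → q ≡ true → p ∨ q ≡ true
        ∨-introʳ true  _ = refl
        ∨-introʳ false h = h
        to : ∀ {x} → x ∈ elems (setOf (toList (R a)) ∪ t) → x ∈ map (place a) σ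
        to {x} x∈ with ∨-elim (Vec.lookup (setOf (toList (R a))) x) _
          (trans (sym (lookup-∪ x)) (elems⇒∈ (setOf (toList (R a)) ∪ t) x∈))
        ... | inj₂ x∈t = ∈-map⁺ (place a) (∈-resp-↭ (↭-sym σ↭slots) (∈-++⁺ˡ (∈-map⁺ inj₁ (∈⇒elems t x∈t))))
        ... | inj₁ x∈R with ∈-toList⁻ (R a) (setOf⇒∈ (toList (R a)) x∈R)
        ...   | i , e = subst (_∈ map (place a) σ) (sym (trans e (lookup-R a i)))
                  (∈-map⁺ (place a)
                    (∈-resp-↭ (↭-sym σ↭slots) (∈-++⁺ʳ (map inj₁ (elems t)) (∈-map⁺ inj₂ (∈-allFin i)))))
        from : ∀ {x} → x ∈ map (place a) σ → x ∈ elems (setOf (toList (R a)) ∪ t)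
        from {x} x∈ with ∈-map⁻ (place a) x∈
        ... | inj₂ i , _ , refl = ∈⇒elems (setOf (toList (R a)) ∪ t) (trans (lookup-∪ _)
          (cong (_∨ Vec.lookup t (place a (inj₂ i)))
            (∈⇒setOf (subst (_∈ toList (R a)) (lookup-R a i) (lookup-∈ (R a) i)))))
        ... | inj₁ u , u∈ , refl = ∈⇒elems (setOf (toList (R a)) ∪ t)
          (trans (lookup-∪ u)
          (∨-introʳ (Vec.lookup (setOf (toList (R a))) u) (elems⇒∈ t (slots⇒Valid (∈-resp-↭ σ↭slots u∈)))))

      lo hi : List Slot
      lo = take h σ
      hi = drop h σ
      lo++hi : lo ++ hi ≡ σ
      lo++hi = take++drop≡id h σ
      |hi| : length hi ≡ suc j
      |hi| = trans (length-drop h σ) (trans (cong (_∸ h) (trans |σ| (sym (+-suc h j)))) (m+n∸m≡n h (suc j)))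

      Ψ : Vec (Fin Q) j → ℕ
      Ψ a = ⟦ W (map (φ (map (place a) lo)) (map (place a) hi)) ⟧

      Ψ≤ : ∀ a → Ψ a ≤ ⟦ injectiveIn ⊤ (R a) ⟧ * ⟦ edge G (setOf (toList (R a)) ∪ t) ⟧
      Ψ≤ a = ≤-trans (≤-reflexive (sym (trans (*-identityˡ _) (cong ⟦_⟧ edge≡))))
        (≤-reflexive (cong (λ c → ⟦ c ⟧ * ⟦ edge G s ⟧) (sym R-injective)))
        where
        s = setOf (toList (R a)) ∪ t
        |s| : ∣ s ∣ ≡ k
        |s| = trans (sym (length-elems s))
          (trans (cong length (elems-R a)) (trans (length-map (place a) σ) |σ|))
        edge≡ : edge G s ≡ W (map (φ (map (place a) lo)) (map (place a) hi))
        edge≡ = trans (cong (_∧ coloured (elems s)) (dec-true (∣ s ∣ ≟ k) |s|))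
          (trans (cong coloured (elems-R a)) (cong₂ (λ L M → W (map (φ L) M)) (take-map h σ) (drop-map h σ)))
        R-injective : injectiveIn ⊤ (R a) ≡ true
        R-injective = Unique⇒injectiveIn ⊤ (R a) (Unique-toList (R a) (λ i i′ eq → b-injective i i′
          (Fin.combine-injectiveˡ _ _ _ _ (trans (sym (lookup-R a i)) (trans eq (lookup-R a i′))))))
          (All.tabulate (λ {x} _ → ⊤-lookup x))

      Ψ-dense : (1 + p) * Q ^ j ≤ d * ∑ (vecs (allFin Q) j) Ψ
      Ψ-dense with findRight lo
      -- Some random vertex `i` is among the `h` smallest. Its position is redrawn with all others
      -- fixed, `φ-insert-dense` bounds the average over it, and the extra factor `Q` cancels.
      ... | inj₂ (ys , i , zs , lo≡) = *-cancelˡ-≤ Q (begin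
        Q * ((1 + p) * Q ^ j)                                     ≡⟨ r₁ Q (1 + p) (Q ^ j) ⟩
        Q ^ j * ((1 + p) * Q)                                     ≡⟨ sym (∑-tuples-const Q j _) ⟩
        ∑ As (λ _ → (1 + p) * Q)                                  ≤⟨ ∑-mono As each ⟩
        ∑ As (λ a → d * ∑ (allFin Q) (λ x → Ψ (a Vec.[ i ]≔ x)))  ≡⟨ ∑-*ˡ As d _ ⟩
        d * ∑ As (λ a → ∑ (allFin Q) (λ x → Ψ (a Vec.[ i ]≔ x)))  ≡⟨ cong (d *_)
          (trans (∑-resample (allFin Q) j i Ψ) (cong (_* ∑ As Ψ) (length-allFin Q))) ⟩
        d * (Q * ∑ As Ψ)                                          ≡⟨ r₂ d Q (∑ As Ψ) ⟩
        Q * (d * ∑ As Ψ)                                          ∎)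
        where
        open ≤-Reasoning
        As = vecs (allFin Q) j
        r₁ : ∀ a b c → a * (b * c) ≡ c * (b * a)
        r₁ = solve-∀
        r₂ : ∀ a b c → a * (b * c) ≡ b * (a * c)
        r₂ = solve-∀
        σ≡ : σ ≡ ys ++ inj₂ i ∷ zs ++ hi
        σ≡ = trans (sym lo++hi) (trans (cong (_++ hi) lo≡) (++-assoc ys (inj₂ i ∷ zs) hi))
        i-fresh : All (λ s → inj₂ i ≢ s) (ys ++ zs ++ hi)
        i-fresh = AllPairs.head (Unique-resp-↭ (↭-shift (inj₂ i) ys (zs ++ hi)) (subst Unique σ≡ σ-unique))
        place-fresh : ∀ a x {L} → All (λ s → inj₂ i ≢ s) L → map (place (a Vec.[ i ]≔ x)) L ≡ map (place a) L
        place-fresh a x fresh = map-cong-local (All.map (λ {s} → same s) fresh)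
          where
          same : ∀ s → inj₂ i ≢ s → place (a Vec.[ i ]≔ x) s ≡ place a s
          same (inj₁ u)  _  = refl
          same (inj₂ i′) ne = cong (combine (Vec.lookup b i′))
            (lookup∘update′ (λ eq → ne (cong inj₂ (sym eq))) a x)
        each : ∀ a → (1 + p) * Q ≤ d * ∑ (allFin Q) (λ x → Ψ (a Vec.[ i ]≔ x))
        each a = ≤-trans
          (φ-insert-dense (map (place a) ys) (map (place a) zs) (map (place a) hi) hi-unique p d W j
            (trans (length-map (place a) hi) |hi|) dense E-large (Vec.lookup b i))
          (≤-reflexive (cong (d *_)
            (∑-cong (allFin Q)
            (λ x → cong (⟦_⟧ ∘ W)
            (sym (cong₂ (λ S us → map (φ S) us) (lo-place x)
            (place-fresh a x (All.++⁻ʳ zs (All.++⁻ʳ ys i-fresh)))))))))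
          where
          hi-unique : Unique (map (place a) hi)
          hi-unique = subst Unique (drop-map h σ) (Unique.drop⁺ h (sorted⇒Unique (σ-sorted a)))
          lo-place : ∀ x → map (place (a Vec.[ i ]≔ x)) lo ≡ map (place a) ys ++ combine (Vec.lookup b i) x ∷
            map (place a) zs
          lo-place x = trans (cong (map (place (a Vec.[ i ]≔ x))) lo≡)
            (trans (map-++ (place (a Vec.[ i ]≔ x)) ys (inj₂ i ∷ zs))
            (cong₂ _++_ (place-fresh a x (All.++⁻ˡ ys i-fresh))
              (cong₂ _∷_ (cong (combine (Vec.lookup b i)) (lookup∘update i a x))
                (place-fresh a x (All.++⁻ˡ zs (All.++⁻ʳ ys i-fresh))))))
      -- Here `lo` uses `h` of the `h + 1` vertices of `t`, so `hi` has exactly one fixed vertex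
      -- `v`. Its colour `φ S v` is arbitrary but does not vary with the positions, because `S` does
      -- not.
      ... | inj₁ (S , lo≡) = ≤-trans (*-monoˡ-≤ (Q ^ j) (n≤1+n (1 + p))) (fixed (lefts hi) refl)
        where
        As = vecs (allFin Q) j
        rights-hi : rights hi ↭ allFin j
        rights-hi = ↭-trans
          (↭-reflexive (trans (sym (rights-map-inj₁-++ S hi))
          (cong rights (trans (cong (_++ hi) (sym lo≡)) lo++hi))))
          (↭-trans (rights-↭ σ↭slots)
            (↭-reflexive (trans (rights-map-inj₁-++ (elems t) (map inj₂ (allFin j)))
            (rights-map-inj₂ (allFin j)))))
        |lefts| : length (lefts hi) ≡ 1
        |lefts| = +-cancelʳ-≡ j _ _
          (trans (sym (trans (↭-length (↭-lefts-rights hi)) (trans (length-++ (map inj₁ (lefts hi)))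
          (cong₂ _+_ (length-map inj₁ (lefts hi))
            (trans (length-map inj₂ (rights hi)) (trans (↭-length rights-hi) (length-allFin j))))))) |hi|)
        fixed : ∀ L → L ≡ lefts hi → (2 + p) * Q ^ j ≤ d * ∑ As Ψ
        fixed []           eq with () ← trans (cong length eq) |lefts|
        fixed (_ ∷ _ ∷ _)  eq with () ← trans (cong length eq) |lefts|
        fixed (v ∷ [])     eq = *-cancelˡ-≤ (m ^ j) ⦃ m^n≢0 m j ⦄ (begin
          m ^ j * ((2 + p) * Q ^ j)               ≡⟨ r₁ (m ^ j) (2 + p) (Q ^ j) ⟩
          Q ^ j * ((2 + p) * m ^ j)               ≤⟨ *-monoʳ-≤ (Q ^ j) (minDegree (φ S v)) ⟩
          Q ^ j * (d * degree j W (φ S v))        ≡⟨ r₂ (Q ^ j) d _ ⟩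
          d * (Q ^ j * degree j W (φ S v))        ≡⟨ cong (d *_) (sym balanced) ⟩
          d * (m ^ j * ∑ As Ψ)                    ≡⟨ r₂ d (m ^ j) (∑ As Ψ) ⟩
          m ^ j * (d * ∑ As Ψ)                    ∎)
          where
          open ≤-Reasoning
          r₁ : ∀ a b c → a * (b * c) ≡ c * (b * a)
          r₁ = solve-∀
          r₂ : ∀ a b c → a * (b * c) ≡ b * (a * c)
          r₂ = solve-∀
          hi↭ : hi ↭ inj₁ v ∷ map inj₂ (allFin j)
          hi↭ = ↭-trans (↭-lefts-rights hi)
            (↭-trans (↭-reflexive (cong (λ L → map inj₁ L ++ map inj₂ (rights hi)) (sym eq)))
            (↭.prep (inj₁ v) (↭-map⁺ inj₂ rights-hi)))
          lo-place : ∀ a → map (place a) lo ≡ S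
          lo-place a = trans (cong (map (place a)) lo≡) (trans (sym (map-∘ S)) (map-id S))
          Ψ≡ : ∀ a → Ψ a ≡ ⟦ W (φ S v ∷ tabulate (λ i → φ S (combine (Vec.lookup b i) (Vec.lookup a i)))) ⟧
          Ψ≡ a = cong ⟦_⟧ (trans (cong (λ L → W (map (φ L) (map (place a) hi))) (lo-place a))
            (trans (symmetric (↭-map⁺ (φ S) (↭-map⁺ (place a) hi↭)))
              (cong (λ L → W (φ S v ∷ L))
                (trans (sym (map-∘ (map inj₂ (allFin j))))
                (trans (sym (map-∘ (allFin j))) (map-tabulate id _))))))
          balanced : m ^ j * ∑ As Ψ ≡ Q ^ j * degree j W (φ S v)
          balanced = trans (cong (m ^ j *_) (∑-cong As Ψ≡))
            (∑-balancedᶠ j (λ i x → φ S (combine (Vec.lookup b i) x))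
            (λ i F → φ-balanced S (Vec.lookup b i) F) (⟦_⟧ ∘ W ∘ (φ S v ∷_)))

    -- Almost every tuple of blocks avoids t and consists of distinct blocks.
    degree-dense : p * B ^ j ≤ suc p * (B ∸ k) ^ j →
      p * N ^ j ≤ d * ∑ (vecs (allFin N) j) (λ R → ⟦ injectiveIn ⊤ R ⟧ * ⟦ edge G (setOf (toList R) ∪ t) ⟧)
    degree-dense B-large = begin
      p * (B * Q) ^ j                              ≡⟨ cong (p *_) (^-distrib-* B Q j) ⟩
      p * (B ^ j * Q ^ j)                          ≡⟨ sym (*-assoc p (B ^ j) (Q ^ j)) ⟩
      p * B ^ j * Q ^ j                            ≤⟨ *-monoˡ-≤ (Q ^ j) B-large ⟩
      suc p * (B ∸ k) ^ j * Q ^ j                  ≤⟨ *-monoˡ-≤ (Q ^ j)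
        (*-monoʳ-≤ (suc p) (≤-trans (^-monoˡ-≤ j room) (^≤fall ∣ free ∣ j))) ⟩
      suc p * fall ∣ free ∣ j * Q ^ j              ≡⟨ cong (λ f → suc p * f * Q ^ j)
        (sym (∑-injectiveIn j free)) ⟩
      suc p * ∑ Bs (⟦_⟧ ∘ injectiveIn free) * Q ^ j ≡⟨ r (suc p) (∑ Bs (⟦_⟧ ∘ injectiveIn free)) (Q ^ j) ⟩
      suc p * Q ^ j * ∑ Bs (⟦_⟧ ∘ injectiveIn free) ≡⟨ sym (∑-*ˡ Bs (suc p * Q ^ j) _) ⟩
      ∑ Bs (λ b → suc p * Q ^ j * ⟦ injectiveIn free b ⟧) ≤⟨ ∑-mono Bs each ⟩
      ∑ Bs (λ b → d * ∑ As (λ a → f (Vec.zipWith combine b a))) ≡⟨ ∑-*ˡ Bs d _ ⟩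
      d * ∑ Bs (λ b → ∑ As (λ a → f (Vec.zipWith combine b a))) ≡⟨ cong (d *_)
        (sym (∑-zipWith-combine B Q j f)) ⟩
      d * ∑ (vecs (allFin N) j) f                  ∎
      where
      open ≤-Reasoning
      f : Vec Vertex j → ℕ
      f R = ⟦ injectiveIn ⊤ R ⟧ * ⟦ edge G (setOf (toList R) ∪ t) ⟧
      Bs = vecs (allFin B) j
      As = vecs (allFin Q) j
      used free : Subset B
      used = setOf (map block (elems t))
      free = ∁ used
      r : ∀ a b c → a * b * c ≡ a * c * b
      r = solve-∀
      room : B ∸ k ≤ ∣ free ∣ ∸ j
      room = ≤-trans (≤-reflexive (sym (∸-+-assoc B (suc h) j))) (∸-monoˡ-≤ j (≤-trans (∸-monoʳ-≤ B
        (≤-trans (∣setOf∣≤ (map block (elems t)))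
          (≤-reflexive (trans (length-map block (elems t)) (trans (length-elems t) |t|)))))
        (≤-reflexive (sym (∣∁p∣≡n∸∣p∣ used)))))
      each : ∀ b → suc p * Q ^ j * ⟦ injectiveIn free b ⟧ ≤ d * ∑ As (λ a → f (Vec.zipWith combine b a))
      each b with injectiveIn free b in eq
      ... | false = ≤-trans (≤-reflexive (*-zeroʳ (suc p * Q ^ j))) z≤n
      ... | true  = ≤-trans (≤-reflexive (*-identityʳ _))
        (≤-trans (Ψ-dense b b-injective b-fresh) (*-monoʳ-≤ d (∑-mono As (Ψ≤ b b-injective b-fresh))))
        where
        b-injective : ∀ i i′ → Vec.lookup b i ≡ Vec.lookup b i′ → i ≡ i′
        b-injective = lookup-injectiveᵛ b (injectiveIn⇒Unique free b eq)
        b-fresh : ∀ i {u} → u ∈ elems t → Vec.lookup b i ≢ block u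
        b-fresh i {u} u∈ e with () ← trans (sym (All.lookup (injectiveIn⇒⊆ free b eq) (lookup-∈ b i)))
          (trans (lookup-map (Vec.lookup b i) not used)
            (cong not (∈⇒setOf (subst (_∈ map block (elems t)) (sym e) (∈-map⁺ block u∈)))))

T⇒≡true : ∀ {b} → T b → b ≡ true
T⇒≡true {true} _ = refl

-- Images and links

∈image⇒ : ∀ (f : Fin m → Fin n) s {y} → Vec.lookup (image f s) y ≡ true → ∃ λ x → Vec.lookup s x ≡ true × f x
  ≡ y
∈image⇒ f s {y} h with any? (λ x → (x ∈? s) ×-dec (f x ≟ᶠ y)) | trans (sym (lookup∘tabulate _ y)) h
... | yes (x , x∈ , fx≡y) | _ = x , []=⇒lookup x∈ , fx≡y

⇒∈image : ∀ (f : Fin m → Fin n) s {x} → Vec.lookup s x ≡ true → Vec.lookup (image f s) (f x) ≡ true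
⇒∈image f s {x} h = trans (lookup∘tabulate _ (f x))
  (dec-true (any? λ x′ → (x′ ∈? s) ×-dec (f x′ ≟ᶠ f x)) (x , lookup⇒[]= x s h , refl))

lookup-∪ : ∀ (p q : Subset n) x → Vec.lookup (p ∪ q) x ≡ Vec.lookup p x ∨ Vec.lookup q x
lookup-∪ p q x = lookup-zipWith _∨_ x p q

∈∪⇒ : ∀ (p q : Subset n) x → Vec.lookup (p ∪ q) x ≡ true → Vec.lookup p x ≡ true ⊎ Vec.lookup q x ≡ true
∈∪⇒ p q x h with Vec.lookup p x in eq | trans (sym (lookup-∪ p q x)) h
... | true  | _ = inj₁ refl
... | false | e = inj₂ e

⇒∈∪ˡ : ∀ (p q : Subset n) x → Vec.lookup p x ≡ true → Vec.lookup (p ∪ q) x ≡ true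
⇒∈∪ˡ p q x h = trans (lookup-∪ p q x) (cong (_∨ Vec.lookup q x) h)

⇒∈∪ʳ : ∀ (p q : Subset n) x → Vec.lookup q x ≡ true → Vec.lookup (p ∪ q) x ≡ true
⇒∈∪ʳ p q x h = trans (lookup-∪ p q x) (trans (cong (Vec.lookup p x ∨_) h) (∨-true (Vec.lookup p x)))
  where
  ∨-true : ∀ b → b ∨ true ≡ true
  ∨-true true  = refl
  ∨-true false = refl

embed : (t : Subset n) → Fin ∣ ∁ t ∣ → Fin n
embed (inside  ∷ t) i       = suc (embed t i)
embed (outside ∷ t) zero    = zero
embed (outside ∷ t) (suc i) = suc (embed t i)

embed-injective : ∀ (t : Subset n) {i i′} → embed t i ≡ embed t i′ → i ≡ i′
embed-injective (inside  ∷ t) e = embed-injective t (Fin.suc-injective e)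
embed-injective (outside ∷ t) {zero}  {zero}   e = refl
embed-injective (outside ∷ t) {suc i} {suc i′} e = cong suc (embed-injective t (Fin.suc-injective e))

embed-∉ : ∀ (t : Subset n) i → Vec.lookup t (embed t i) ≡ false
embed-∉ (inside  ∷ t) i       = embed-∉ t i
embed-∉ (outside ∷ t) zero    = refl
embed-∉ (outside ∷ t) (suc i) = embed-∉ t i

lookup-expand : ∀ (t : Subset n) s i → Vec.lookup (expand t s) (embed t i) ≡ Vec.lookup s i
lookup-expand (inside  ∷ t) s       i       = lookup-expand t s i
lookup-expand (outside ∷ t) (b ∷ s) zero    = refl
lookup-expand (outside ∷ t) (b ∷ s) (suc i) = lookup-expand t s i

∈expand⇒ : ∀ (t : Subset n) s x → Vec.lookup (expand t s) x ≡ true → ∃ λ i → x ≡ embed t i × Vec.lookup s i ≡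
  true
∈expand⇒ (inside  ∷ t) s       (suc x) h with ∈expand⇒ t s x h
... | i , refl , si = i , refl , si
∈expand⇒ (outside ∷ t) (b ∷ s) zero    h = zero , refl , h
∈expand⇒ (outside ∷ t) (b ∷ s) (suc x) h with ∈expand⇒ t s x h
... | i , refl , si = suc i , refl , si

-- Its use explains the choice of `S`: the smallest vertices of a whole copy are also the smallest
-- of each of its edges that contains them, so one colouring `φ S` serves all these edges.
take-elems : ∀ h (U e : Subset n) → (∀ x → Vec.lookup e x ≡ true → Vec.lookup U x ≡ true) →
  (∀ {x} → x ∈ take h (elems U) → Vec.lookup e x ≡ true) → take h (elems e) ≡ take h (elems U)
take-elems zero    U e sub sup = refl
take-elems (suc h) [] [] sub sup = refl
take-elems (suc h) (true ∷ U) (true ∷ e) sub sup = cong (zero ∷_)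
  (trans (take-map h (elems e))
    (trans (cong (map suc)
    (take-elems h U e (sub ∘ suc)
    (λ x∈ → sup (there (subst (_ ∈_) (sym (take-map h (elems U))) (∈-map⁺ suc x∈))))))
    (sym (take-map h (elems U)))))
take-elems (suc h) (true ∷ U) (false ∷ e) sub sup with () ← sup (here refl)
take-elems (suc h) (false ∷ U) (true ∷ e) sub sup with () ← sub zero refl
take-elems (suc h) (false ∷ U) (false ∷ e) sub sup =
  trans (take-map (suc h) (elems e))
    (trans (cong (map suc)
    (take-elems (suc h) U e (sub ∘ suc)
    (λ x∈ → sup (subst (_ ∈_) (sym (take-map (suc h) (elems U))) (∈-map⁺ suc x∈)))))
    (sym (take-map (suc h) (elems U))))

preimages : ∀ {A B : Set} (f : A → B) {xs} → All (λ x → ∃ λ a → x ≡ f a) xs → ∃ λ as → xs ≡ map f as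
preimages f []               = [] , refl
preimages f ((a , refl) ∷ h) with preimages f h
... | as , refl = a ∷ as , refl

-- S consists of the h smallest vertices of the copy f, and t is its preimage.
module Copy {N v : ℕ} (f : Fin v → Fin N) (f-injective : Injective _≡_ _≡_ f) (h : ℕ) (h≤v : h ≤ v) where

  all-f : List (Fin N)
  all-f = map f (allFin v)
  all-f-unique : Unique all-f
  all-f-unique = Unique.map⁺ f-injective (Unique.allFin⁺ v)
  U : Subset N
  U = setOf all-f
  S : List (Fin N)
  S = take h (elems U)
  S-unique : Unique S
  S-unique = Unique.take⁺ h (sorted⇒Unique (elems-sorted U))
  |S| : length S ≡ h
  |S| = trans (length-take h (elems U)) (m≤n⇒m⊓n≡m (≤-trans h≤v (≤-reflexive (sym (trans (length-elems U)
    (trans (∣setOf∣ all-f-unique) (trans (length-map f (allFin v)) (length-allFin v))))))))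
  S⊆U : ∀ {x} → x ∈ S → x ∈ elems U
  S⊆U x∈ = subst (_ ∈_) (take++drop≡id h (elems U)) (∈-++⁺ˡ x∈)
  S-image : All (λ x → ∃ λ y → x ≡ f y) S
  S-image = All.tabulate (λ x∈ → let y , _ , e = ∈-map⁻ f (setOf⇒∈ all-f (elems⇒∈ U (S⊆U x∈))) in y , e)
  S′ : List (Fin v)
  S′ = proj₁ (preimages f S-image)
  S≡ : S ≡ map f S′
  S≡ = proj₂ (preimages f S-image)
  S′-unique : Unique S′
  S′-unique = Unique.map⁻ {f = f} (subst Unique S≡ S-unique)
  t : Subset v
  t = setOf S′
  |t| : ∣ t ∣ ≡ h
  |t| = trans (∣setOf∣ S′-unique) (trans (sym (length-map f S′)) (trans (cong length (sym S≡)) |S|))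
  t⇒S : ∀ {x} → Vec.lookup t x ≡ true → f x ∈ S
  t⇒S x∈ = subst (_ ∈_) (sym S≡) (∈-map⁺ f (setOf⇒∈ S′ x∈))
  S⇒t : ∀ {x} → f x ∈ S → Vec.lookup t x ≡ true
  S⇒t fx∈ with ∈-map⁻ f (subst (_ ∈_) S≡ fx∈)
  ... | y , y∈ , fx≡fy = subst (λ z → Vec.lookup t z ≡ true) (sym (f-injective fx≡fy)) (∈⇒setOf y∈)

  module _ (s : Subset ∣ ∁ t ∣) where
    o : Subset v
    o = expand t s ∪ t
    c : Subset N
    c = image f o
    c⊆U : ∀ x → Vec.lookup c x ≡ true → Vec.lookup U x ≡ true
    c⊆U x x∈ with ∈image⇒ f o x∈
    ... | y , _ , refl = ∈⇒setOf (∈-map⁺ f (∈-allFin y))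
    S⊆c : ∀ {x} → x ∈ S → Vec.lookup c x ≡ true
    S⊆c {x} x∈ with ∈-map⁻ f (subst (x ∈_) S≡ x∈)
    ... | y , y∈ , refl = ⇒∈image f o (⇒∈∪ʳ (expand t s) t y (∈⇒setOf y∈))
    take≡S : take h (elems c) ≡ S
    take≡S = take-elems h U c c⊆U S⊆c
    c-unique : Unique (take h (elems c) ++ drop h (elems c))
    c-unique = subst Unique (sym (take++drop≡id h (elems c))) (sorted⇒Unique (elems-sorted c))
    disjoint : ∀ {A : Set} (xs : List A) {ys x} → Unique (xs ++ ys) → x ∈ xs → ¬ x ∈ ys
    disjoint (x ∷ xs) (x∉ ∷ u) (here refl) x∈ys = All.lookup x∉ (∈-++⁺ʳ xs x∈ys) refl
    disjoint (x ∷ xs) (x∉ ∷ u) (there x∈)  x∈ys = disjoint xs u x∈ x∈ys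

    -- The vertices of `t` are mapped onto `S`, which is the prefix removed by `drop h`; what
    -- remains comes from the link edge `s`.
    drop-image : ∀ {M} (g : Fin N → Fin M) → setOf (map g (drop h (elems c))) ≡ image (g ∘ f ∘ embed t) s
    drop-image g = subset-ext to from
      where
      to : ∀ y → Vec.lookup (setOf (map g (drop h (elems c)))) y ≡ true → Vec.lookup
        (image (g ∘ f ∘ embed t) s) y ≡ true
      to y y∈ with ∈-map⁻ g (setOf⇒∈ (map g (drop h (elems c))) y∈)
      ... | u , u∈ , refl with ∈image⇒ f o
        (elems⇒∈ c (subst (u ∈_) (take++drop≡id h (elems c)) (∈-++⁺ʳ (take h (elems c)) u∈)))
      ...   | x , x∈o , refl with ∈∪⇒ (expand t s) t x x∈o
      ...     | inj₂ x∈t = ⊥-elim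
        (disjoint (take h (elems c)) c-unique (subst (f x ∈_) (sym take≡S) (t⇒S x∈t)) u∈)
      ...     | inj₁ x∈s with ∈expand⇒ t s x x∈s
      ...       | i , refl , i∈ = ⇒∈image (g ∘ f ∘ embed t) s i∈
      from : ∀ y → Vec.lookup (image (g ∘ f ∘ embed t) s) y ≡ true → Vec.lookup
        (setOf (map g (drop h (elems c)))) y ≡ true
      from y y∈ with ∈image⇒ (g ∘ f ∘ embed t) s y∈
      ... | i , i∈ , refl = ∈⇒setOf (∈-map⁺ g u∈drop)
        where
        u = f (embed t i)
        u∈c : u ∈ take h (elems c) ++ drop h (elems c)
        u∈c = subst (u ∈_) (sym (take++drop≡id h (elems c)))
          (∈⇒elems c (⇒∈image f o (⇒∈∪ˡ (expand t s) t (embed t i) (trans (lookup-expand t s i) i∈))))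
        u∈drop : u ∈ drop h (elems c)
        u∈drop with ∈-++⁻ (take h (elems c)) u∈c
        ... | inj₂ u∈ = u∈
        ... | inj₁ u∈ with () ← trans (sym (embed-∉ t i)) (S⇒t (subst (u ∈_) take≡S u∈))

link-embeds : ∀ {N M m b h j} (G : Hypergraph (suc h + j) N) (H : Hypergraph (suc h + j ∸ h) M)
  (W : List (Fin m) → Bool) (φ : List (Fin N) → Fin N → Fin m) →
  (∀ s → T (edge G s) → W (map (φ (take h (elems s))) (drop h (elems s))) ≡ true) →
  (N≤b : N ≤ b) (ψ : Fin m → Fin b → Fin M) → (∀ {i i′ x x′} → ψ i x ≡ ψ i′ x′ → x ≡ x′) →
  (∀ (L : List (Fin m × Fin b)) → length L ≡ suc j → W (map proj₁ L) ≡ true → edge H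
    (setOf (map (uncurry ψ) L)) ≡ true) →
  ∀ {v} (F : Hypergraph (suc h + j) v) → h ≤ v → Contains G F → ∃₂ λ t (p : ∣ t ∣ ≡ h) → Contains H
    (link F t p)
link-embeds {N} {M} {m} {b} {h} {j} G H W φ edge⇒W N≤b ψ ψ-injective W⇒edge F h≤v (f , f-injective , f-edge) =
  t , |t| , g ∘ f ∘ embed t ,
    (λ e → embed-injective t (f-injective (inject≤-injective N≤b N≤b _ _ (ψ-injective e)))) , edges
  where
  open Copy f f-injective h h≤v
  colour : Fin N → Fin m × Fin b
  colour u = φ S u , inject≤ u N≤b
  g : Fin N → Fin M
  g = uncurry ψ ∘ colour
  edges : ∀ s → T (edge F (expand t s ∪ t)) → T (edge H (image (g ∘ f ∘ embed t) s))
  edges s s∈F = ≡true⇒T (trans (cong (edge H) (trans (sym (drop-image s g)) (cong setOf (map-∘ hi))))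
    (W⇒edge (map colour hi) |hi| (trans (cong W (sym (map-∘ hi))) W-hi)))
    where
    hi : List (Fin N)
    hi = drop h (elems (c s))
    c-edge : T (edge G (c s))
    c-edge = f-edge (o s) s∈F
    W-hi : W (map (φ S) hi) ≡ true
    W-hi = trans (cong (λ L → W (map (φ L) hi)) (sym (take≡S s))) (edge⇒W (c s) c-edge)
    |hi| : length (map colour hi) ≡ suc j
    |hi| = trans (length-map colour hi)
      (trans (length-drop h (elems (c s)))
      (trans (cong (_∸ h) (trans (length-elems (c s)) (trans (uniform G (c s) c-edge) (sym (+-suc h j)))))
      (m+n∸m≡n h (suc j))))

-- Choice of the parameters

record Parameters (h j p N₀ m : ℕ) : Set where
  field
    E D w B e : ℕ
    E≢0     : NonZero E
    w≢0     : NonZero w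
    w-large : E * D ≤ w
    E-large : (2 + p) * (suc j * suc j) ≤ E
    N₀≤B    : N₀ ≤ B
    B-large : p * B ^ j ≤ suc p * (B ∸ (suc h + j)) ^ j
    fits    : ∀ {m′} → m′ ≤ m → B * length (allData m′ E e w) ≤ D ^ e

-- `E` is set by the collision bound and `w = E * D` by the modulus. As `w` does not depend on `e`,
-- the exponent can be taken as `B * (m ^ w * m)`: with `D = 2 * E` the condition `fits` reduces to
-- `e ≤ 2 ^ e`.
parametersWith : ∀ h j p N₀ m E → NonZero E → (2 + p) * (suc j * suc j) ≤ E →
  ∀ B → N₀ ≤ B → p * B ^ j ≤ suc p * (B ∸ (suc h + j)) ^ j → ∀ w → E * (2 * E) ≡ w → ∀ e → B * (m ^ w * m) ≡ e
    →
  Parameters h j p N₀ m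
parametersWith h j p N₀ m E E≢0 E-large B N₀≤B B-large w w≡ e e≡ = record
  { E = E ; D = 2 * E ; w = w ; B = B ; e = e ; E≢0 = E≢0
  ; w≢0 = subst NonZero w≡ (m*n≢0 E (2 * E) ⦃ E≢0 ⦄ ⦃ m*n≢0 2 E ⦃ it ⦄ ⦃ E≢0 ⦄ ⦄)
  ; w-large = ≤-reflexive w≡ ; E-large = E-large ; N₀≤B = N₀≤B ; B-large = B-large ; fits = fits }
  where
  fits : ∀ {m′} → m′ ≤ m → B * length (allData m′ E e w) ≤ (2 * E) ^ e
  fits {m′} m′≤m = begin
    B * length (allData m′ E e w)     ≡⟨ cong (B *_) (length-allData m′ E e w) ⟩
    B * (E ^ e * (m′ ^ w * m′))       ≤⟨ *-monoʳ-≤ B (*-monoʳ-≤ (E ^ e) (*-mono-≤ (^-monoˡ-≤ w m′≤m) m′≤m)) ⟩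
    B * (E ^ e * (m ^ w * m))         ≡⟨ r B (E ^ e) (m ^ w * m) ⟩
    B * (m ^ w * m) * E ^ e           ≡⟨ cong (_* E ^ e) e≡ ⟩
    e * E ^ e                         ≤⟨ *-monoˡ-≤ (E ^ e) (<⇒≤ (n<2^n e)) ⟩
    2 ^ e * E ^ e                     ≡⟨ sym (^-distrib-* 2 E e) ⟩
    (2 * E) ^ e                       ∎
    where
    open ≤-Reasoning
    r : ∀ a b c → a * (b * c) ≡ a * c * b
    r = solve-∀

parameters : ∀ h j p N₀ m → Parameters h j p N₀ m
parameters h j p N₀ m = choose (^-shrink p j (suc h + j))
  where
  choose : (∃ λ B₀ → ∀ B → B₀ ≤ B → p * B ^ j ≤ suc p * (B ∸ (suc h + j)) ^ j) → Parameters h j p N₀ m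
  choose (B₀ , shrink) = parametersWith h j p N₀ m _ (m*n≢0 (2 + p) (suc j * suc j)) ≤-refl
    (N₀ + B₀) (m≤m+n N₀ B₀) (shrink (N₀ + B₀) (m≤n+m B₀ N₀)) _ refl _ refl

record Rooted (h j p d N₀ b m : ℕ) (W : List (Fin m) → Bool) : Set where
  field
    N      : ℕ
    N₀≤N   : N₀ ≤ N
    N≤b    : N ≤ b
    G      : Hypergraph (suc h + j) N
    φ      : List (Fin N) → Fin N → Fin m
    edge⇒W : ∀ s → T (edge G s) → W (map (φ (take h (elems s))) (drop h (elems s))) ≡ true
    dense  : ∀ t → ∣ t ∣ ≡ suc h →
             p * N ^ j ≤ d * ∑ (vecs (allFin N) j)
               (λ R → ⟦ injectiveIn ⊤ R ⟧ * ⟦ edge G (setOf (toList R) ∪ t) ⟧)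

rootedWith : ∀ h j p d N₀ m → (P : Parameters h j p N₀ m) → let open Parameters P in
  ∀ b → suc (B * (length (allData m E e w) * w)) ≡ b → ∀ m′ .⦃ _ : NonZero m′ ⦄ → m′ ≤ m →
  (W : List (Fin m′) → Bool) → Symmetric W → (∀ v → (2 + p) * m′ ^ j ≤ d * degree j W v) → Rooted h j p d N₀ b
    m′ W
rootedWith h j p d N₀ m P b b≡ m′ m′≤m W symmetric minDegree = record
  { N = C.N ; N₀≤N = ≤-trans N₀≤B (m≤m*n B C.Q ⦃ C.Q≢0 ⦄)
  ; N≤b = ≤-trans (m≤n⇒m≤1+n (*-monoʳ-≤ B (*-monoˡ-≤ w Y≤))) (≤-reflexive b≡)
  ; G = C.G ; φ = C.φ
  ; edge⇒W = λ s s∈G → proj₂ (∧-elim {does (∣ s ∣ ≟ C.k)} (T⇒≡true s∈G))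
  ; dense = λ t |t| → C.degree-dense symmetric p d minDegree E-large t |t| B-large }
  where
  open Parameters P
  module C = Construction m′ E D e w B ⦃ it ⦄ ⦃ E≢0 ⦄ ⦃ w≢0 ⦄ w-large (fits m′≤m) h j W
  Y≤ : length (allData m′ E e w) ≤ length (allData m E e w)
  Y≤ = ≤-trans (≤-reflexive (length-allData m′ E e w))
    (≤-trans (*-monoʳ-≤ (E ^ e) (*-mono-≤ (^-monoˡ-≤ w m′≤m) m′≤m))
      (≤-reflexive (sym (length-allData m E e w))))

-- `b` bounds `N` for every number of colours `m′ ≤ m` at once: the part size enters the choice of
-- `M`, whereas `m′` and `W` are known only after a graph `H` on `M` vertices is given.
rooted : ∀ h j p d N₀ m → ∃ λ b → NonZero b ×
  (∀ m′ .⦃ _ : NonZero m′ ⦄ → m′ ≤ m → (W : List (Fin m′) → Bool) → Symmetric W →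
  (∀ v → (2 + p) * m′ ^ j ≤ d * degree j W v) → Rooted h j p d N₀ b m′ W)
rooted h j p d N₀ m = _ , _ , rootedWith h j p d N₀ m (parameters h j p N₀ m) _ refl

∑-edges : ∀ {r n} (G : Hypergraph r n) (f : Subset n → Subset n) xs →
  length (filter (λ s → T? (edge G (f s))) xs) ≡ ∑ xs (λ s → ⟦ edge G (f s) ⟧)
∑-edges G f xs = length-filter-∑ (λ s → T? (edge G (f s))) xs

degree-sets : ∀ {h j N p d} (G : Hypergraph (suc h + j) N) t →
  p * N ^ j ≤ d * ∑ (vecs (allFin N) j) (λ R → ⟦ injectiveIn ⊤ R ⟧ * ⟦ edge G (setOf (toList R) ∪ t) ⟧) →
  p * (N C j) ≤ d * deg (suc h) G t
degree-sets {h} {j} {N} {p} {d} G t dense = *-cancelˡ-≤ (j !) ⦃ j !≢0 ⦄ (begin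
  j ! * (p * (N C j))     ≡⟨ r (j !) p (N C j) ⟩
  p * (j ! * (N C j))     ≡⟨ cong (p *_) (sym (fall≡!*C N j)) ⟩
  p * fall N j            ≤⟨ *-monoʳ-≤ p (fall≤^ N j) ⟩
  p * N ^ j               ≤⟨ dense ⟩
  d * ∑ (vecs (allFin N) j) (λ R → ⟦ injectiveIn ⊤ R ⟧ * ⟦ edge G (setOf (toList R) ∪ t) ⟧)
                          ≡⟨ cong (d *_) (∑-subsetsOfSize N j (λ s → ⟦ edge G (s ∪ t) ⟧)) ⟩
  d * (j ! * ∑ (subsetsOfSize N j) (λ s → ⟦ edge G (s ∪ t) ⟧))
                          ≡⟨ cong (λ i → d * (j ! * ∑ (subsetsOfSize N i) (λ s → ⟦ edge G (s ∪ t) ⟧)))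
                            (sym (m+n∸m≡n h j)) ⟩
  d * (j ! * ∑ (subsetsOfSize N (h + j ∸ h)) (λ s → ⟦ edge G (s ∪ t) ⟧))
                          ≡⟨ cong (λ x → d * (j ! * x)) (sym (∑-edges G (_∪ t) (subsetsOfSize N (h + j ∸ h))))
                            ⟩
  d * (j ! * deg (suc h) G t) ≡⟨ r d (j !) (deg (suc h) G t) ⟩
  j ! * (d * deg (suc h) G t) ∎)
  where
  open ≤-Reasoning
  r : ∀ a b c → a * (b * c) ≡ b * (a * c)
  r = solve-∀

blowUpWith : ∀ j p d N₁ → (∀ k → N₁ ≤ k → p * k ^ j ≤ suc p * pred k ^ j) →
  ∀ m → suc d * suc N₁ < m → (4 + p) * m ^ suc j ≤ (5 + p) * (m ∸ suc j) ^ suc j →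
  ∀ n → NonZero n → ∀ M → 0 < M → boxSize m n (suc d * 2 ^ m ^ suc j) ≤ M →
  d * M ^ m ≤ suc d * (M ∸ m) ^ m → (5 + p) * M ^ suc j ≤ (6 + p) * (M ∸ suc j) ^ suc j →
  (H : Hypergraph (suc j) M) → (6 + p) * (M C suc j) ≤ suc d * sizeEdges H → BlowUp j p (suc d) n (suc N₁) m H
blowUpWith j p d N₁ shrink m m-large shrink-m n n≢0 M M>0 large shrink₁ shrink₂ H dense =
  Sampling.sample H m p d ⦃ >-nonZero (<-≤-trans (s≤s z≤n) m-large) ⦄ ⦃ >-nonZero M>0 ⦄ (begin
      (5 + p) * M ^ r             ≤⟨ shrink₂ ⟩
      (6 + p) * (M ∸ r) ^ r       ≤⟨ *-monoʳ-≤ (6 + p) (^≤fall M r) ⟩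
      (6 + p) * fall M r          ≡⟨ trans (cong ((6 + p) *_) (fall≡!*C M r)) (x (6 + p) (r !) (M C r)) ⟩
      r ! * ((6 + p) * (M C r))   ≤⟨ *-monoʳ-≤ (r !) dense ⟩
      r ! * (suc d * sizeEdges H) ≡⟨ x (r !) (suc d) (sizeEdges H) ⟩
      suc d * (r ! * sizeEdges H) ≤⟨ *-monoʳ-≤ (suc d) (edgeSum-edgeOf H) ⟩
      suc d * edgeSum r (edgeOf H) ∎)
    shrink-m shrink₁ n ⦃ n≢0 ⦄ (suc N₁) (λ k N₁<k → shrink k (<⇒≤ N₁<k)) m-large large
  where
  open ≤-Reasoning
  r = suc j
  x : ∀ a b c → a * (b * c) ≡ b * (a * c)
  x = solve-∀

-- `m` is chosen before the part size `n`, because `n` will exceed the order of a graph built from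
-- `m`; only `M₀` may depend on `n`.
blowUp : ∀ j p d → ∃ λ m → ∀ n → NonZero n → ∃ λ M₀ → ∀ M → M₀ ≤ M → (H : Hypergraph (suc j) M) →
  (6 + p) * (M C suc j) ≤ suc d * sizeEdges H → ∃ λ mmin → BlowUp j p (suc d) n (suc mmin) m H
blowUp j p d = step₁ (^-shrink p j 1) (^-shrink (4 + p) (suc j) (suc j)) (^-shrink (5 + p) (suc j) (suc j))
  where
  Goal : ℕ → Set
  Goal m = ∀ n → NonZero n → ∃ λ M₀ → ∀ M → M₀ ≤ M → (H : Hypergraph (suc j) M) →
    (6 + p) * (M C suc j) ≤ suc d * sizeEdges H → ∃ λ mmin → BlowUp j p (suc d) n (suc mmin) m H
  Shrink : ℕ → ℕ → ℕ → Set
  Shrink p j s = ∃ λ N → ∀ n → N ≤ n → p * n ^ j ≤ suc p * (n ∸ s) ^ j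

  step₃ : ∀ N₁ → (∀ k → N₁ ≤ k → p * k ^ j ≤ suc p * pred k ^ j) → Shrink (5 + p) (suc j) (suc j) →
    ∀ m → suc d * suc N₁ < m → (4 + p) * m ^ suc j ≤ (5 + p) * (m ∸ suc j) ^ suc j → Shrink d m m →
    ∀ K → suc d * 2 ^ m ^ suc j ≡ K → Goal m
  step₃ N₁ shrink (N₄ , shrink₂) m m-large shrink-m (N₃ , shrink₁) K K≡ n n≢0 = boxSize m n K + (N₃ + suc N₄)
    , λ M large H dense →
    let large₂ = m+n≤o⇒n≤o (boxSize m n K) large
        large₃ = m+n≤o⇒n≤o N₃ large₂
    in N₁ , blowUpWith j p d N₁ shrink m m-large shrink-m n n≢0 M (<-≤-trans (s≤s z≤n) large₃)
         (subst (λ k → boxSize m n k ≤ M) (sym K≡) (m+n≤o⇒m≤o (boxSize m n K) large))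
         (shrink₁ M (m+n≤o⇒m≤o N₃ large₂)) (shrink₂ M (<⇒≤ large₃)) H dense

  step₂ : ∀ N₁ → (∀ k → N₁ ≤ k → p * k ^ j ≤ suc p * pred k ^ j) → Shrink (5 + p) (suc j) (suc j) →
    ∀ m → suc d * suc N₁ < m → (4 + p) * m ^ suc j ≤ (5 + p) * (m ∸ suc j) ^ suc j → Goal m
  step₂ N₁ shrink s₂ m m-large shrink-m = step₃ N₁ shrink s₂ m m-large shrink-m (^-shrink d m m) _ refl

  step₁ : Shrink p j 1 → Shrink (4 + p) (suc j) (suc j) → Shrink (5 + p) (suc j) (suc j) → ∃ Goal
  step₁ (N₁ , shrink) (N₂ , shrink₀) s₂ = m₀ , step₂ N₁ shrink s₂ m₀ (m≤m+n (suc (suc d * suc N₁)) N₂)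
    (shrink₀ m₀ (m≤n+m N₂ (suc (suc d * suc N₁))))
    where
    m₀ : ℕ
    m₀ = suc (suc d * suc N₁) + N₂

-- From dense link-free graphs to dense free graphs

retype : ∀ {r s} → r ≡ s → Hypergraph r n → Hypergraph s n
edge    (retype eq H)     = edge H
uniform (retype eq H) e t = trans (uniform H e t) eq

link-uniformity : ∀ h j → suc h + j ∸ h ≡ suc j
link-uniformity h j = trans (cong (_∸ h) (sym (+-suc h j))) (m+n∸m≡n h (suc j))

module _ {a : Level} (h j p d : ℕ) (𝓕 : Family (suc h + j) a)
  (h≤ : ∀ {n} (F : Hypergraph (suc h + j) n) → 𝓕 F → h ≤ n) where

  -- Where the `8` goes: six units are spent on the blow-up, for falling factorials against powers
  -- of `M` and of `m`, samples with repetitions, samples below the threshold, the reserve of the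
  -- deletions, and `pred size` against `size`. Two remain for hash collisions and for blocks that
  -- coincide or meet `t`.
  DenseLinkFree : ℕ → Set _
  DenseLinkFree M = Σ (Hypergraph (suc h + j ∸ h) M) λ H → Free (𝓛 h 𝓕) H ×
    (8 + p) * (M C (suc h + j ∸ h)) ≤ suc d * sizeEdges H

  DenseFree : ℕ → Set _
  DenseFree N = Σ (Hypergraph (suc h + j) N) λ G → Free 𝓕 G ×
    (∀ t → ∣ t ∣ ≡ suc h → p * (N C j) ≤ suc d * deg (suc h) G t)

  rooted-dense : ∀ {N₀ b m M mmin} (H : Hypergraph (suc h + j ∸ h) M) → Free (𝓛 h 𝓕) H →
    (J : BlowUp j (2 + p) (suc d) b (suc mmin) m (retype (link-uniformity h j) H)) →
    Rooted h j p (suc d) N₀ b (BlowUp.size J) (BlowUp.W J) → ∃ λ N → N₀ ≤ N × DenseFree N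
  rooted-dense H H-free J R = R.N , R.N₀≤N , R.G , free , λ t |t| → degree-sets {h} {j} {R.N} {p} {suc d} R.G
    t (R.dense t |t|)
    where
    module J = BlowUp J
    module R = Rooted R
    free : Free 𝓕 R.G
    free F F∈𝓕 copy = refute
      (link-embeds R.G H J.W R.φ R.edge⇒W R.N≤b J.ψ J.ψ-injective J.W⇒edge F (h≤ F F∈𝓕) copy)
      where
      refute : ¬ (∃₂ λ t (|t| : ∣ t ∣ ≡ h) → Contains H (link F t |t|))
      refute (t , |t| , copy′) = H-free (link F t |t|) (link∈ F∈𝓕 t |t|) copy′

  transfer : (∀ M₀ → ∃ λ M → M₀ ≤ M × DenseLinkFree M) → ∀ N₀ → ∃ λ N → N₀ ≤ N × DenseFree N
  transfer hyp N₀ = chooseSize (blowUp j (2 + p) d)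
    where
    Goal : Set _
    Goal = ∃ λ N → N₀ ≤ N × DenseFree N
    Roots BlowsUp : ℕ → ℕ → Set
    Roots m b = ∀ m′ .⦃ _ : NonZero m′ ⦄ → m′ ≤ m → (W : List (Fin m′) → Bool) → Symmetric W →
      (∀ v → (2 + p) * m′ ^ j ≤ suc d * degree j W v) → Rooted h j p (suc d) N₀ b m′ W
    BlowsUp m b = ∃ λ M₀ → ∀ M → M₀ ≤ M → (H : Hypergraph (suc j) M) →
      (8 + p) * (M C suc j) ≤ suc d * sizeEdges H → ∃ λ mmin → BlowUp j (2 + p) (suc d) b (suc mmin) m H

    assemble : ∀ {m b} → Roots m b → BlowsUp m b → Goal
    assemble {m} {b} root (M₀ , blow) = useHypothesis (hyp M₀)
      where
      useBlowUp : ∀ {M} (H : Hypergraph (suc h + j ∸ h) M) → Free (𝓛 h 𝓕) H →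
        (∃ λ mmin → BlowUp j (2 + p) (suc d) b (suc mmin) m (retype (link-uniformity h j) H)) → Goal
      useBlowUp H H-free (_ , J) = rooted-dense H H-free J
        (root J.size ⦃ >-nonZero (<-≤-trans (s≤s z≤n) J.mmin≤size) ⦄ J.size≤ J.W J.symmetric J.minDegree)
        where module J = BlowUp J
      useHypothesis : (∃ λ M → M₀ ≤ M × DenseLinkFree M) → Goal
      useHypothesis (M , M₀≤M , H , H-free , H-dense) = useBlowUp H H-free
        (blow M M₀≤M (retype (link-uniformity h j) H)
        (subst (λ r → (8 + p) * (M C r) ≤ suc d * ∑ (subsetsOfSize M r) (⟦_⟧ ∘ edge H)) (link-uniformity h j)
          H-dense))

    chooseBox : ∀ {m} → (∀ b → NonZero b → BlowsUp m b) → (∃ λ b → NonZero b × Roots m b) → Goal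
    chooseBox blow (b , b≢0 , root) = assemble root (blow b b≢0)
    chooseSize : (∃ λ m → ∀ b → NonZero b → BlowsUp m b) → Goal
    chooseSize (m , blow) = chooseBox blow (rooted h j p (suc d) N₀ m)

-- Edgeless graphs and the minimum in `δ`

initial : ∀ {h v} → h ≤ v → ∃ λ (t : Subset v) → ∣ t ∣ ≡ h
initial {h} h≤v = setOf (map (λ i → inject≤ i h≤v) (allFin h)) ,
  trans (∣setOf∣ (Unique.map⁺ (inject≤-injective h≤v h≤v _ _) (Unique.allFin⁺ h)))
    (trans (length-map _ (allFin h)) (length-allFin h))

empty : ∀ r n → Hypergraph r n
empty r n = record { edge = λ _ → false ; uniform = λ _ () }

-- A member of `𝓕` contained in an empty graph is edgeless, and so are its links. An edgeless link
-- is contained in every graph with enough vertices, hence in a link-free graph supplied by the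
-- hypothesis, a contradiction.
empty-free : ∀ {a : Level} h j (𝓕 : Family (suc h + j) a) →
  (∀ {n} (F : Hypergraph (suc h + j) n) → 𝓕 F → h ≤ n) →
  (∀ M₀ → ∃ λ M → M₀ ≤ M × Σ (Hypergraph (suc h + j ∸ h) M) (Free (𝓛 h 𝓕))) →
  ∀ N → Free 𝓕 (empty (suc h + j) N)
empty-free h j 𝓕 h≤ hyp N F F∈𝓕 (f , _ , no-edge) with initial (h≤ F F∈𝓕)
... | t , |t| with hyp ∣ ∁ t ∣
...   | M , large , H , H-free = H-free (link F t |t|) (link∈ F∈𝓕 t |t|)
  ((λ i → inject≤ i large) , (λ {i} {i′} → inject≤-injective large large i i′) , λ s s∈ → ⊥-elim
    (no-edge (expand t s ∪ t) s∈))

∈-subsets : ∀ {n} (s : Subset n) → s ∈ subsets n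
∈-subsets []                = here refl
∈-subsets {suc n} (false ∷ s) = ∈-++⁺ˡ (∈-map⁺ (outside ∷_) (∈-subsets s))
∈-subsets {suc n} (true  ∷ s) = ∈-++⁺ʳ (map (outside ∷_) (subsets n)) (∈-map⁺ (inside ∷_) (∈-subsets s))

∈-subsetsOfSize : ∀ {n i} (s : Subset n) → ∣ s ∣ ≡ i → s ∈ subsetsOfSize n i
∈-subsetsOfSize {i = i} s |s| = ∈-filter⁺ (λ s → ∣ s ∣ ≟ i) (∈-subsets s) |s|

δ₀≤sizeEdges : ∀ {r n} (H : Hypergraph r n) → δ 0 H ≤ sizeEdges H
δ₀≤sizeEdges {r} {n} H = ≤-trans
  (All.lookup (All.map⁻ (f[argmin]≤f[xs] {f = id} _ (map (deg 0 H) (subsetsOfSize n 0))))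
    (∈-subsetsOfSize ⊥ (∣setOf∣ {n} {[]} [])))
  (≤-reflexive (trans (∑-edges H (_∪ ⊥) (subsetsOfSize n r))
    (∑-cong (subsetsOfSize n r) (λ s → cong (λ z → ⟦ edge H z ⟧) (∪-identityʳ s)))))

δ-property : ∀ {r n} j (G : Hypergraph r n) (P : ℕ → Set) → (∀ t → ∣ t ∣ ≡ j → P (deg j G t)) → P
  (length (subsetsOfSize n (r ∸ j))) → P (δ j G)
δ-property {n = n} j G P each default = argmin-all id {P = P} default
  (All.map⁺ (All.tabulate (λ {t} t∈ → each t (proj₂ (∈-filter⁻ (λ s → ∣ s ∣ ≟ j) {xs = subsets n} t∈)))))

-- Rationals

frac-< : ∀ (q : ℚ) x y → toℚᵘ q ℚᵘ.< mkℚᵘ x y → q ℚ.< fromℚᵘ (mkℚᵘ x y)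
frac-< q x y lt = ℚ.toℚᵘ-cancel-< (ℚᵘ.<-respʳ-≃ (ℚᵘ.≃-sym (ℚ.toℚᵘ-fromℚᵘ (mkℚᵘ x y))) lt)

toℚᵘ-fromℕ : ∀ z → toℚᵘ (fromℕ z) ℚᵘ.≃ mkℚᵘ (ℤ.+ z) 0
toℚᵘ-fromℕ z = ℚ.toℚᵘ-fromℚᵘ (mkℚᵘ (ℤ.+ z) 0)

frac-*-< : ∀ x y c z → (x ℤ.* ℤ.+ c) ℤ.* ℤ.+ 1 ℤ.< ℤ.+ z ℤ.* ℤ.+ suc (y + 0) → fromℚᵘ (mkℚᵘ x y) ℚ.* fromℕ c
  ℚ.< fromℕ z
frac-*-< x y c z lt = ℚ.toℚᵘ-cancel-<
  (ℚᵘ.<-respˡ-≃ (ℚᵘ.≃-sym product)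
  (ℚᵘ.<-respʳ-≃ (ℚᵘ.≃-sym (toℚᵘ-fromℕ z))
  (ℚᵘ.*<* (subst (λ t → (x ℤ.* ℤ.+ c) ℤ.* ℤ.+ 1 ℤ.< ℤ.+ z ℤ.* ℤ.+ suc t)
  (trans (+-identityʳ y) (sym (*-identityʳ y))) lt))))
  where
  product : toℚᵘ (fromℚᵘ (mkℚᵘ x y) ℚ.* fromℕ c) ℚᵘ.≃ mkℚᵘ x y ℚᵘ.* mkℚᵘ (ℤ.+ c) 0
  product = ℚᵘ.≃-trans (ℚ.toℚᵘ-homo-* (fromℚᵘ (mkℚᵘ x y)) (fromℕ c))
    (ℚᵘ.*-cong (ℚ.toℚᵘ-fromℚᵘ (mkℚᵘ x y)) (toℚᵘ-fromℕ c))

ℤ-< : ∀ {x y z w} → x * y < z * w → ℤ.+ x ℤ.* ℤ.+ y ℤ.< ℤ.+ z ℤ.* ℤ.+ w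
ℤ-< {x} {y} {z} {w} lt = subst₂ ℤ._<_ (ℤ.pos-* x y) (ℤ.pos-* z w) (ℤ.+<+ lt)

ℤ-<⁻ : ∀ {x y z w} → ℤ.+ x ℤ.* ℤ.+ y ℤ.< ℤ.+ z ℤ.* ℤ.+ w → x * y < z * w
ℤ-<⁻ {x} {y} {z} {w} lt = ℤ.drop‿+<+ (subst₂ ℤ._<_ (sym (ℤ.pos-* x y)) (sym (ℤ.pos-* z w)) lt)

+≮- : ∀ {n b c} → ¬ (ℤ.+ n ℤ.< -[1+ b ] ℤ.* ℤ.+ suc c)
+≮- ()

frac-*-<⁻ : ∀ q x y c z → toℚᵘ q ≡ mkℚᵘ (ℤ.+ x) y → q ℚ.* fromℕ c ℚ.< fromℕ z → x * c < z * suc y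
frac-*-<⁻ q x y c z q≡ lt = subst₂ _<_ (*-identityʳ (x * c)) (cong (λ t → z * suc t) (*-identityʳ y))
  (ℤ-<⁻ {x * c} {1} {z}
    (subst (λ t → t ℤ.* ℤ.+ 1 ℤ.< ℤ.+ z ℤ.* ℤ.+ suc (y * 1)) (sym (ℤ.pos-* x c)) (ℚᵘ.drop-*<* unnormalised)))
  where
  product : toℚᵘ (q ℚ.* fromℕ c) ℚᵘ.≃ mkℚᵘ (ℤ.+ x) y ℚᵘ.* mkℚᵘ (ℤ.+ c) 0
  product = ℚᵘ.≃-trans (ℚ.toℚᵘ-homo-* q (fromℕ c)) (ℚᵘ.*-cong (ℚᵘ.≃-reflexive q≡) (toℚᵘ-fromℕ c))
  unnormalised : mkℚᵘ (ℤ.+ x) y ℚᵘ.* mkℚᵘ (ℤ.+ c) 0 ℚᵘ.< mkℚᵘ (ℤ.+ z) 0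
  unnormalised = ℚᵘ.<-respˡ-≃ product (ℚᵘ.<-respʳ-≃ (toℚᵘ-fromℕ z) (ℚ.toℚᵘ-mono-< lt))

frac-*-<⁺ : ∀ x y c z → x * c < z * suc y → fromℚᵘ (mkℚᵘ (ℤ.+ x) y) ℚ.* fromℕ c ℚ.< fromℕ z
frac-*-<⁺ x y c z lt = frac-*-< (ℤ.+ x) y c z
  (subst (λ t → t ℤ.* ℤ.+ 1 ℤ.< ℤ.+ z ℤ.* ℤ.+ suc (y + 0)) (ℤ.pos-* x c)
  (ℤ-< {x * c} {1} {z}
    (subst₂ _<_ (sym (*-identityʳ (x * c))) (cong (λ t → z * suc t) (sym (+-identityʳ y))) lt)))

C>0 : ∀ n j → j < n → 0 < n C j
C>0 n j j<n with n C j in eq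
... | suc _ = s≤s z≤n
... | zero  = ⊥-elim (<-irrefl refl (<-≤-trans (m^n>0 (n ∸ j) ⦃ >-nonZero (m<n⇒0<n∸m j<n) ⦄ j)
  (≤-trans (^≤fall n j) (≤-reflexive (trans (fall≡!*C n j) (trans (cong (j ! *_) eq) (*-zeroʳ (j !))))))))

-- Comparison of the two densities

module _ {a : Level} (h j : ℕ) (𝓕 : Family (suc h + j) a)
  (h≤ : ∀ {n} (F : Hypergraph (suc h + j) n) → 𝓕 F → h ≤ n) where

  j≡ : h + j ∸ h ≡ j
  j≡ = m+n∸m≡n h j

  ex-bound : ∀ q N →
    (∃ λ n → N ≤ n × Σ (Hypergraph (suc h + j) n) λ G → Free 𝓕 G × q ℚ.* fromℕ (n C j) ℚ.< fromℕ
    (δ (suc h) G)) →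
    ∃ λ n → N ≤ n × ((ex (suc h) n 𝓕) ÷ (n C (h + j ∸ h))) q
  ex-bound q N (n , N≤n , G , free , lt) = n , N≤n , G , free , subst
    (λ i → q ℚ.* fromℕ (n C i) ℚ.< fromℕ (δ (suc h) G)) (sym j≡) lt

  -- Below zero the mere existence of free graphs suffices, since degrees are nonnegative. For `q`
  -- with denominator `c + 1`, the value `-1 / (c + 2)` lies strictly between `q` and zero.
  negative : ∀ x c → ∀ q → toℚᵘ q ≡ mkℚᵘ -[1+ x ] c →
    (∀ M₀ → ∃ λ M → M₀ ≤ M × Σ (Hypergraph (suc h + j ∸ h) M) (Free (𝓛 h 𝓕))) → π (suc h) 𝓕 q
  negative x c q q≡ hyp = q″ , frac-< q -[1+ 0 ] (suc c)
    (subst (ℚᵘ._< mkℚᵘ -[1+ 0 ] (suc c)) (sym q≡) (ℚᵘ.*<* (ℤ.-<- lt))) ,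
    λ N → ex-bound q″ N
      -- The order `suc (N + j)` makes the binomial coefficient positive, so that `q″` times it is
      -- still negative.
      (suc (N + j) , m≤n⇒m≤1+n (m≤m+n N j) , empty (suc h + j) (suc (N + j)) , empty-free h j 𝓕 h≤ hyp
      (suc (N + j)) ,
      below (suc (N + j) C j) (C>0 (suc (N + j)) j (s≤s (m≤n+m j N)))
        (δ (suc h) (empty (suc h + j) (suc (N + j)))))
    where
    q″ : ℚ
    q″ = fromℚᵘ (mkℚᵘ -[1+ 0 ] (suc c))
    lt : c + 0 < suc c + x * suc (suc c)
    lt = s≤s (≤-trans (≤-reflexive (+-identityʳ c)) (m≤m+n c _))
    below : ∀ C → 0 < C → ∀ z → q″ ℚ.* fromℕ C ℚ.< fromℕ z
    below (suc C) _ z = frac-*-< -[1+ 0 ] (suc c) (suc C) z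
      (subst (ℤ._<_ _) (ℤ.pos-* z (suc (suc c + 0))) ℤ.-<+)

  DenseBelow : ℚ → Set _
  DenseBelow q′ = ∀ M₀ → ∃ λ M → M₀ ≤ M × Σ (Hypergraph (suc h + j ∸ h) M) λ H →
    Free (𝓛 h 𝓕) H × q′ ℚ.* fromℕ (M C (suc h + j ∸ h)) ℚ.< fromℕ (δ 0 H)

  -- With densities over the common denominator 20 (c + 1) (c′ + 1), the construction loses at most 8
  -- in the numerator, one for each estimate.
  module Positive (α₀ c β₀ c′ : ℕ) (q q′ : ℚ) (q≡ : toℚᵘ q ≡ mkℚᵘ (ℤ.+ α₀) c)
    (q′≡ : toℚᵘ q′ ≡ mkℚᵘ (ℤ.+ β₀) c′)
    (α<β : α₀ * suc c′ < β₀ * suc c) (p d y : ℕ) (p≡ : 8 + p ≡ 20 * (β₀ * suc c))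
    (d≡ : suc d ≡ 20 * (suc c * suc c′)) (y≡ : suc y ≡ 2 * (suc c * suc c′)) where
    open ≤-Reasoning
    -- Over the denominator `g = suc c * suc c′`, `q` is `α / g` and `q′` is at least `(α + 1) / g`;
    -- `q″` is the midpoint `(2 α + 1) / (2 g)` of these two values.
    α x : ℕ
    α = α₀ * suc c′
    x = 2 * α + 1
    q″ : ℚ
    q″ = fromℚᵘ (mkℚᵘ (ℤ.+ x) y)

    q<q″ : q ℚ.< q″
    q<q″ = frac-< q (ℤ.+ x) y
      (subst (ℚᵘ._< mkℚᵘ (ℤ.+ x) y) (sym q≡) (ℚᵘ.*<* (ℤ-< {α₀} {suc y} {x} {suc c} (begin-strict
      α₀ * suc y                    ≡⟨ trans (cong (α₀ *_) y≡) (e α₀ (suc c) (suc c′)) ⟩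
      2 * (α₀ * suc c′) * suc c     <⟨ *-monoˡ-< (suc c) (≤-reflexive (+-comm 1 (2 * α))) ⟩
      x * suc c                     ∎))))
      where
      e : ∀ a b c → a * (2 * (b * c)) ≡ 2 * (a * c) * b
      e = solve-∀

    -- The denominator `20 g` makes the gap between `q` and `q′` at least 20 units. After the loss
    -- of 8 the numerator `p` still exceeds the `20 α + 10` of `q″` by at least 2, which yields
    -- strictness in `degrees`.
    12+20α≤p : 12 + 20 * α ≤ p
    12+20α≤p = +-cancelˡ-≤ 8 (12 + 20 * α) p (begin
      8 + (12 + 20 * α)    ≡⟨ e α ⟩
      20 * suc α           ≤⟨ *-monoʳ-≤ 20 α<β ⟩
      20 * (β₀ * suc c)    ≡⟨ sym p≡ ⟩
      8 + p                ∎)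
      where
      e : ∀ α → 8 + (12 + 20 * α) ≡ 20 * suc α
      e = solve-∀

    edges : ∀ b s → β₀ * b ≤ s * suc c′ → (8 + p) * b ≤ suc d * s
    edges b s le = begin
      (8 + p) * b                    ≡⟨ trans (cong (_* b) p≡) (e₂ β₀ (suc c) b) ⟩
      20 * suc c * (β₀ * b)          ≤⟨ *-monoʳ-≤ (20 * suc c) le ⟩
      20 * suc c * (s * suc c′)      ≡⟨ e₃ (suc c) s (suc c′) ⟩
      20 * (suc c * suc c′) * s      ≡⟨ cong (_* s) (sym d≡) ⟩
      suc d * s                      ∎
      where
      e₂ : ∀ a b c → 20 * (a * b) * c ≡ 20 * b * (a * c)
      e₂ = solve-∀
      e₃ : ∀ a b c → 20 * a * (b * c) ≡ 20 * (a * c) * b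
      e₃ = solve-∀

    degrees : ∀ b s → 0 < b → p * b ≤ suc d * s → x * b < s * suc y
    degrees b s b>0 le = *-cancelˡ-< 10 (x * b) (s * suc y) (begin-strict
      10 * (x * b)                       <⟨ m<m+n (10 * (x * b)) (≤-trans b>0 (m≤m+n b (b + 0))) ⟩
      10 * (x * b) + 2 * b               ≡⟨ e₁ α b ⟩
      (12 + 20 * α) * b                  ≤⟨ *-monoˡ-≤ b 12+20α≤p ⟩
      p * b                              ≤⟨ le ⟩
      suc d * s                          ≡⟨ cong (_* s) d≡ ⟩
      20 * (suc c * suc c′) * s          ≡⟨ e₂ (suc c * suc c′) s ⟩
      10 * (s * (2 * (suc c * suc c′)))  ≡⟨ cong (λ t → 10 * (s * t)) (sym y≡) ⟩
      10 * (s * suc y)                   ∎)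
      where
      e₁ : ∀ α b → 10 * ((2 * α + 1) * b) + 2 * b ≡ (12 + 20 * α) * b
      e₁ = solve-∀
      e₂ : ∀ g z → 20 * g * z ≡ 10 * (z * (2 * g))
      e₂ = solve-∀

    denseLinkFree : DenseBelow q′ → ∀ M₀ → ∃ λ M → M₀ ≤ M × DenseLinkFree h j p d 𝓕 h≤ M
    denseLinkFree hyp M₀ = convert (hyp M₀)
      where
      convert : (∃ λ M → M₀ ≤ M × Σ (Hypergraph (suc h + j ∸ h) M) λ H → Free (𝓛 h 𝓕) H × q′ ℚ.* fromℕ
        (M C (suc h + j ∸ h)) ℚ.< fromℕ (δ 0 H)) →
        ∃ λ M → M₀ ≤ M × DenseLinkFree h j p d 𝓕 h≤ M
      convert (M , M₀≤M , H , H-free , lt) = M , M₀≤M , H , H-free , edges (M C (suc h + j ∸ h)) (sizeEdges H)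
        (≤-trans (<⇒≤ (frac-*-<⁻ q′ β₀ c′ (M C (suc h + j ∸ h)) (δ 0 H) q′≡ lt))
          (*-monoˡ-≤ (suc c′) (δ₀≤sizeEdges H)))

    finish : ∀ N → (∃ λ n → N + suc (suc h + j) ≤ n × DenseFree h j p d 𝓕 h≤ n) →
      ∃ λ n → N ≤ n × Σ (Hypergraph (suc h + j) n) λ G → Free 𝓕 G × q″ ℚ.* fromℕ (n C j) ℚ.< fromℕ
        (δ (suc h) G)
    finish N (n , large , G , free , G-dense) = n , m+n≤o⇒m≤o N large , G , free ,
      frac-*-<⁺ x y (n C j) (δ (suc h) G) (δ-property (suc h) G (λ z → x * (n C j) < z * suc y) each
        -- The extra candidate of the minimum is at least the degree of `t₀`, so it inherits the
        -- bound; `n` was taken large enough for `t₀` to exist.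
        (<-≤-trans (each (proj₁ t₀) (proj₂ t₀))
          (*-monoˡ-≤ (suc y)
          (length-filter (λ s → T? (edge G (s ∪ proj₁ t₀))) (subsetsOfSize n (h + j ∸ h))))))
      where
      n> : suc (suc h + j) ≤ n
      n> = m+n≤o⇒n≤o N large
      t₀ : ∃ λ t → ∣ t ∣ ≡ suc h
      t₀ = initial (≤-trans (m≤n⇒m≤1+n (m≤m+n (suc h) j)) n>)
      each : ∀ t → ∣ t ∣ ≡ suc h → x * (n C j) < deg (suc h) G t * suc y
      each t |t| = degrees (n C j) (deg (suc h) G t) (C>0 n j (≤-trans (s≤s (m≤n+m j (suc h))) n>))
        (G-dense t |t|)

    conclusion : DenseBelow q′ → π (suc h) 𝓕 q
    conclusion hyp = q″ , q<q″ , λ N → ex-bound q″ N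
      (finish N (transfer h j p d 𝓕 h≤ (denseLinkFree hyp) (N + suc (suc h + j))))

  positive : ∀ α₀ c β₀ c′ q q′ → toℚᵘ q ≡ mkℚᵘ (ℤ.+ α₀) c → toℚᵘ q′ ≡ mkℚᵘ (ℤ.+ β₀) c′ → α₀ * suc c′ < β₀ *
    suc c →
    DenseBelow q′ → π (suc h) 𝓕 q
  positive α₀ c β₀ c′ q q′ q≡ q′≡ α<β = Positive.conclusion α₀ c β₀ c′ q q′ q≡ q′≡ α<β
    (20 * (β₀ * suc c) ∸ 8) (pred (20 * (suc c * suc c′))) (pred (2 * (suc c * suc c′)))
    (m+[n∸m]≡n (≤-trans (m≤m+n 8 12) (*-monoʳ-≤ 20 (≤-trans (s≤s z≤n) α<β))))
    (suc-pred (20 * (suc c * suc c′))) (suc-pred (2 * (suc c * suc c′)))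

  nonnegative : ∀ α₀ c q q′ → toℚᵘ q ≡ mkℚᵘ (ℤ.+ α₀) c → q ℚ.< q′ → DenseBelow q′ → π (suc h) 𝓕 q
  nonnegative α₀ c q q′ q≡ q<q′ hyp = split (toℚᵘ q′) refl
    where
    split : ∀ u → toℚᵘ q′ ≡ u → π (suc h) 𝓕 q
    split (mkℚᵘ (ℤ.+ β₀) c′) q′≡ = positive α₀ c β₀ c′ q q′ q≡ q′≡
      (ℤ-<⁻ {α₀} {suc c′} {β₀} {suc c} (ℚᵘ.drop-*<* (subst₂ ℚᵘ._<_ q≡ q′≡ (ℚ.toℚᵘ-mono-< q<q′)))) hyp
    split (mkℚᵘ -[1+ b ] c′) q′≡ = ⊥-elim (+≮- {b = b} {c}
      (subst (ℤ._< -[1+ b ] ℤ.* ℤ.+ suc c) (sym (ℤ.pos-* α₀ (suc c′)))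
        (ℚᵘ.drop-*<* (subst₂ ℚᵘ._<_ q≡ q′≡ (ℚ.toℚᵘ-mono-< q<q′)))))

  link-bound : π (suc h) 𝓕 ≥ᶜ turánDensity (𝓛 h 𝓕)
  link-bound q (q′ , q<q′ , hyp) = split (toℚᵘ q) refl
    where
    hyp′ : DenseBelow q′
    hyp′ = hyp
    dropDensity : DenseBelow q′ → ∀ M₀ → ∃ λ M → M₀ ≤ M × Σ (Hypergraph (suc h + j ∸ h) M) (Free (𝓛 h 𝓕))
    dropDensity f M₀ = let M , M₀≤M , H , H-free , _ = f M₀ in M , M₀≤M , H , H-free
    split : ∀ u → toℚᵘ q ≡ u → π (suc h) 𝓕 q
    split (mkℚᵘ (ℤ.+ α₀) c)   q≡ = nonnegative α₀ c q q′ q≡ q<q′ hyp′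
    split (mkℚᵘ -[1+ x ] c) q≡ = negative x c q q≡ (dropDensity hyp′)

proposition1p1 : ∀ {a : Level} (k ℓ : ℕ) → 2 ≤ ℓ → ℓ < k →
    (𝓕 : Family k a) →
    (∀ {n} (F : Hypergraph k n) → 𝓕 F → ℓ ∸ 1 ≤ n) →
    π ℓ 𝓕 ≥ᶜ turánDensity (𝓛 (ℓ ∸ 1) 𝓕)
proposition1p1 {a} k (suc h) _ ℓ<k = go k (m+[n∸m]≡n (<⇒≤ ℓ<k))
  where
  go : ∀ k′ → suc h + (k ∸ suc h) ≡ k′ → (𝓕 : Family k′ a) →
    (∀ {n} (F : Hypergraph k′ n) → 𝓕 F → h ≤ n) → π (suc h) 𝓕 ≥ᶜ turánDensity (𝓛 h 𝓕)
  go _ refl = link-bound h (k ∸ suc h)
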